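{- Let $k \ge 4$ and $G$ be a $k$-dicritical digraph. If $G$ is neither $\overset \leftrightarrow K_k$ nor in $\mathcal D_k$, then:\[\lvert A(G)\rvert \ge (k-1)\lvert V(G)\rvert + (k-2).\]
   Context: A dicolouring of a digraph is a partition of its vertex set into sets inducing acyclic subdigraphs; $\vec{\chi}(G)$ is the minimum number of parts. $G$ is $k$-dicritical if $\vec{\chi}(G)=k$ and every proper subdigraph has dichromatic number at most $k-1$. $\overset \leftrightarrow K_m$ is the complete symmetric digraph on $m$ vertices and $\overset \leftrightarrow C_5$ the symmetric cycle on 5 vertices (each edge of the 5-cycle replaced by a digon). For a digraph $H$ with vertices $u_1,\dots,u_n$ and digraphs $G_1,\dots,G_n$, the substitution $H(G_1,\dots,G_n)$ is obtained by replacing each $u_i$ by a copy of $G_i$ and, for each arc $u_iu_j$ of $H$, adding all arcs from $V(G_i)$ to $V(G_j)$. For $k\ge 4$, $\mathcal D_k = \{\overset \leftrightarrow C_5(\overset \leftrightarrow K_{k-2}, \overset \leftrightarrow K_1, \overset \leftrightarrow K_n, \overset \leftrightarrow K_{k-1-n}, \overset \leftrightarrow K_1) : 1 \le n \le k-2\}$ (substituting along the cyclic order of $\overset \leftrightarrow C_5$); these are symmetric $k$-dicritical digraphs with exactly $(k-1)\lvert V\rvert+k-3$ arcs. -}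

module Defs where

open import Level using (0ℓ)
open import Data.Nat using (ℕ; zero; suc; _+_; _∸_; _*_; _%_; _≤_)
open import Data.Fin using (Fin; toℕ)
open import Data.Bool using (Bool; true; false; if_then_else_; _∧_)
open import Data.List using (List; map; allFin)
open import Data.Nat.ListAction using (sum)
open import Data.Product using (Σ; _×_; _,_; ∃)
open import Data.Sum using (_⊎_)
open import Relation.Nullary using (¬_)
open import Relation.Binary.PropositionalEquality using (_≡_; _≢_)
open import Function.Bundles using (_↔_; Inverse)

record Digraph : Set where
  field
    n        : ℕ
    arc      : Fin n → Fin n → Bool
    loopless : ∀ i → arc i i ≡ false
open Digraph public

arcCount : Digraph → ℕ
arcCount G = sum (map (λ i → sum (map (λ j → if arc G i j then 1 else 0) (allFin (n G)))) (allFin (n G)))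

data Walk {V : Set} (R : V → V → Set) : V → V → Set where
  step : ∀ {a b} → R a b → Walk R a b
  _∷ʷ_ : ∀ {a b c} → R a b → Walk R b c → Walk R a c

record Subdigraph (G : Digraph) : Set where
  field
    keepV : Fin (n G) → Bool
    keepA : Fin (n G) → Fin (n G) → Bool
    keepA-arc : ∀ i j → keepA i j ≡ true → arc G i j ≡ true
    keepA-V   : ∀ i j → keepA i j ≡ true → (keepV i ≡ true × keepV j ≡ true)
open Subdigraph public

Proper : {G : Digraph} → Subdigraph G → Set
Proper {G} H = (∃ λ i → keepV H i ≡ false) ⊎
               (∃ λ i → ∃ λ j → arc G i j ≡ true × keepA H i j ≡ false)

whole : (G : Digraph) → Subdigraph G
whole G = record { keepV = λ _ → true ; keepA = arc G
                 ; keepA-arc = λ _ _ p → p ; keepA-V = λ _ _ _ → _≡_.refl , _≡_.refl }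

-- H admits a c-dicolouring: a colouring of the vertices with c colours
-- such that no colour class induces a directed cycle (closed walk) in H.
Dicolourable : {G : Digraph} → Subdigraph G → ℕ → Set
Dicolourable {G} H c =
  Σ (Fin (n G) → Fin c) λ f →
    ∀ v → ¬ Walk (λ x y → keepA H x y ≡ true × f x ≡ f y) v v

-- Dichromatic number equals k (k ≥ 1).
DichromaticEq : Digraph → ℕ → Set
DichromaticEq G k = Dicolourable (whole G) k × ¬ Dicolourable (whole G) (k ∸ 1)

Dicritical : ℕ → Digraph → Set
Dicritical k G = DichromaticEq G k ×
  (∀ (H : Subdigraph G) → Proper H → Dicolourable H (k ∸ 1))

IsoTo : Digraph → (V : Set) → (V → V → Set) → Set
IsoTo G V R = Σ (Fin (n G) ↔ V) λ φ →
  ∀ i j → (arc G i j ≡ true → R (Inverse.to φ i) (Inverse.to φ j))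
        × (R (Inverse.to φ i) (Inverse.to φ j) → arc G i j ≡ true)

Karc : (m : ℕ) → Fin m → Fin m → Set
Karc m x y = x ≢ y

C5arc : Fin 5 → Fin 5 → Set
C5arc i j = (toℕ j ≡ suc (toℕ i) % 5) ⊎ (toℕ i ≡ suc (toℕ j) % 5)

SubV : (m : ℕ) → (Fin m → ℕ) → Set
SubV m sz = Σ (Fin m) (λ i → Fin (sz i))

SubArc : (m : ℕ) (Harc : Fin m → Fin m → Set) (sz : Fin m → ℕ)
         (Garc : (i : Fin m) → Fin (sz i) → Fin (sz i) → Set) →
         SubV m sz → SubV m sz → Set
SubArc m Harc sz Garc (i , x) (j , y) =
  (Σ (i ≡ j) λ { _≡_.refl → Garc i x y }) ⊎ Harc i j

Dsizes : ℕ → ℕ → Fin 5 → ℕ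
Dsizes k t Fin.zero = k ∸ 2
Dsizes k t (Fin.suc Fin.zero) = 1
Dsizes k t (Fin.suc (Fin.suc Fin.zero)) = t
Dsizes k t (Fin.suc (Fin.suc (Fin.suc Fin.zero))) = k ∸ 1 ∸ t
Dsizes k t (Fin.suc (Fin.suc (Fin.suc (Fin.suc Fin.zero)))) = 1

InDk : ℕ → Digraph → Set
InDk k G = Σ ℕ λ t → (1 ≤ t) × (t ≤ k ∸ 2) ×
  IsoTo G (SubV 5 (Dsizes k t))
          (SubArc 5 C5arc (Dsizes k t) (λ i → Karc (Dsizes k t i)))

IsK : ℕ → Digraph → Set
IsK k G = IsoTo G (Fin k) (Karc k)

{-# OPTIONS --safe #-}

-- Write m = k − 1 and call a vertex set W critical if it is not m-dicolourable but W − v is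
-- for every v ∈ W. By induction on |W|, with k fixed, a critical W spanning at most
-- m |W| + m − 2 arcs is a symmetric K_{m+1} or belongs to 𝒟_{m+1}. All degrees are at least m
-- and every cut of W contains at least m arcs in each direction, so there is little excess to spend.
--
-- If v has out-degree m and x, y are out-neighbours of v not joined by a digon, then W − v with
-- x and y merged is still not m-dicolourable. A critical set in it is again sparse, so by
-- induction it is K_{m+1} or in 𝒟_{m+1}, and W contains a symmetric clique K of size m (if all
-- out-neighbours of v are joined by digons, they form K).
--
-- A vertex of K with out-degree or in-degree m has a single neighbour outside K in that
-- direction. If two such attached vertices y, y′ differ, they are coloured alike in every
-- dicolouring of W minus (at most) two vertices of K, hence adding the digon y y′ there creates
-- a critical set P. Counting leaves no slack: P is K_{m+1} minus the digon y y′, everything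
-- outside P is m-regular, and W = P ∪ K is in 𝒟_{m+1}. If all attached vertices are the same y,
-- then either K ∪ {y} is K_{m+1}, or some x ∈ K may be merged with y as above; adding up the
-- out- and in-degree counts yields a second clique Z of size m, now m-regular, and the previous
-- argument applies to Z.
module Submission where

open import Defs
open import Data.Bool using (Bool; true; false; if_then_else_; _∧_; _∨_; not)
open import Data.Bool.Properties using (∨-zeroʳ)
open import Data.Empty using (⊥; ⊥-elim)
open import Data.Fin using (Fin; zero; suc; _≟_; toℕ)
open import Data.Fin.Properties using (any?; toℕ-injective; toℕ<n; toℕ-fromℕ<)
  renaming (suc-injective to Fin-suc-injective)
import Data.List as List
import Data.List.Properties as List
open import Data.Nat using (ℕ; zero; suc; _+_; _*_; _∸_; _≤_; _<_; z≤n; s≤s; _≤?_; _%_; _/_)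
open import Data.Nat.DivMod using (_mod_; m≡m%n+[m/n]*n; m%n<n)
import Data.Nat.ListAction as ListAction
open import Data.Nat.Properties hiding (_≟_)
open import Data.Nat.Tactic.RingSolver using (solve-∀)
open import Data.Product using (Σ; ∃; _×_; _,_; proj₁; proj₂)
open import Data.Sum using (_⊎_; inj₁; inj₂)
open import Data.Vec.Functional using (updateAt)
open import Data.Vec.Functional.Properties using (updateAt-updates; updateAt-minimal)
open import Function using (_∘_; _↔_; const; flip; mk↔ₛ′)
open import Function.Bundles using (Inverse)
open import Relation.Binary using (Tri; tri<; tri≈; tri>)
open import Relation.Binary.PropositionalEquality using (_≡_; _≢_; refl; sym; trans; cong; cong₂; subst; subst₂; module ≡-Reasoning)
open import Relation.Nullary using (¬_; Dec; yes; no; does)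
open import Relation.Nullary.Decidable using (decidable-stable; ¬¬-excluded-middle; _×-dec_)
open import Algebra.Properties.Semiring.Sum +-*-semiring using (sum; ∑-distrib-+; ∑-comm; sum-cong-≗; sum-replicate-zero; *-distribʳ-sum)

-- Vertex sets and sums over them

-- The induction is driven by one saving. A nonempty proper part P of W has m arcs leaving it, so it
-- spans at most m |P| - 2 arcs, a full m less than the bound allowed for W. Merging x into y trades
-- one vertex, worth m, and a new digon costs 2; both are covered, so the smaller critical set is
-- again sparse. Moreover K_{m+1} has exactly m |P| arcs and a member of 𝒟_{m+1} has m |P| + m - 2,
-- which is more because m ≥ 3. Hence a smaller critical set with at most m |P| arcs must be
-- K_{m+1}. Only out-degrees are treated directly: criticality and sparsity survive the reversal of
-- all arcs, which gives the in-degrees. The obstacle is that a vertex may have degree m in one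
-- direction and more in the other, so in the case of a single attached vertex neither direction can
-- be counted alone. Colourability is never decided. Existence claims stand under a double negation,
-- which is harmless because the final inequality is decidable.

VSet : ℕ → Set
VSet n = Fin n → Bool

infix 4 _∈_ _∉_ _⊆_

-- Wrapping the equation in a data type makes `A` recoverable from the type of a membership proof,
-- so set arguments can stay implicit.
data _∈_ {n : ℕ} (i : Fin n) (A : VSet n) : Set where
  mem : A i ≡ true → i ∈ A

_∉_ : ∀ {n} → Fin n → VSet n → Set
i ∉ A = ¬ (i ∈ A)

_⊆_ : ∀ {n} → VSet n → VSet n → Set
A ⊆ B = ∀ {i} → i ∈ A → i ∈ B

infixl 7 _∩_
infixl 6 _∪_ _∖_ _-_

opaque

  _∩_ _∪_ _∖_ : ∀ {n} → VSet n → VSet n → VSet n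
  (A ∩ B) i = A i ∧ B i
  (A ∪ B) i = A i ∨ B i
  (A ∖ B) i = A i ∧ not (B i)

  ⁅_⁆ : ∀ {n} → Fin n → VSet n
  ⁅ x ⁆ i = does (i ≟ x)

  _-_ : ∀ {n} → VSet n → Fin n → VSet n
  A - x = A ∖ ⁅ x ⁆

  Full : ∀ {n} → VSet n
  Full _ = true

module _ {n : ℕ} where

  infix 4 _∈?_

  opaque
    unfolding _∩_

    _∈?_ : (i : Fin n) (A : VSet n) → Dec (i ∈ A)
    i ∈? A with A i in p
    ... | true  = yes (mem p)
    ... | false = no λ { (mem q) → case-⊥ (trans (sym p) q) }
      where
      case-⊥ : false ≡ true → ⊥
      case-⊥ ()

    ∈⇒true : {i : Fin n} {A : VSet n} → i ∈ A → A i ≡ true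
    ∈⇒true (mem p) = p

    ∉⇒false : {i : Fin n} {A : VSet n} → i ∉ A → A i ≡ false
    ∉⇒false {i} {A} p with A i in q
    ... | true  = ⊥-elim (p (mem q))
    ... | false = refl

    ∈-∩⁺ : {i : Fin n} {A B : VSet n} → i ∈ A → i ∈ B → i ∈ A ∩ B
    ∈-∩⁺ {i} {A} {B} (mem p) (mem q) = mem (trans (cong (_∧ B i) p) q)

    ∈-∩⁻ : {i : Fin n} {A B : VSet n} → i ∈ A ∩ B → i ∈ A × i ∈ B
    ∈-∩⁻ {i} {A} {B} (mem p) with A i in a | B i in b
    ... | true | true = mem a , mem b

    ∩-⊆ˡ : {A B : VSet n} → A ∩ B ⊆ A
    ∩-⊆ˡ p = proj₁ (∈-∩⁻ p)

    ∩-⊆ʳ : {A B : VSet n} → A ∩ B ⊆ B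
    ∩-⊆ʳ p = proj₂ (∈-∩⁻ p)

    ∈-∖⁺ : {i : Fin n} {A B : VSet n} → i ∈ A → i ∉ B → i ∈ A ∖ B
    ∈-∖⁺ {i} {A} {B} (mem p) q = mem (cong₂ (λ a b → a ∧ not b) p (∉⇒false {i} {B} q))

    ∈-∖⁻ : {i : Fin n} {A B : VSet n} → i ∈ A ∖ B → i ∈ A × i ∉ B
    ∈-∖⁻ {i} {A} {B} (mem p) with A i in a | B i in b
    ... | true | false = mem a , λ { (mem q) → case (trans (sym b) q) }
      where
      case : false ≡ true → ⊥
      case ()

    ∖-⊆ : {A B : VSet n} → A ∖ B ⊆ A
    ∖-⊆ p = proj₁ (∈-∖⁻ p)

    ∈-∪ˡ : {i : Fin n} {A B : VSet n} → i ∈ A → i ∈ A ∪ B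
    ∈-∪ˡ {i} {A} {B} (mem p) = mem (cong (_∨ B i) p)

    ∈-∪ʳ : {i : Fin n} {A B : VSet n} → i ∈ B → i ∈ A ∪ B
    ∈-∪ʳ {i} {A} {B} (mem p) = mem (trans (cong (A i ∨_) p) (∨-zeroʳ (A i)))

    ∈-∪⁻ : {i : Fin n} {A B : VSet n} → i ∈ A ∪ B → i ∈ A ⊎ i ∈ B
    ∈-∪⁻ {i} {A} {B} (mem p) with A i in a
    ... | true  = inj₁ (mem a)
    ... | false = inj₂ (mem p)

    ∪-⊆ : {A B C : VSet n} → A ⊆ C → B ⊆ C → A ∪ B ⊆ C
    ∪-⊆ p q r with ∈-∪⁻ r
    ... | inj₁ a = p a
    ... | inj₂ b = q b

    x∈⁅x⁆ : {x : Fin n} → x ∈ ⁅ x ⁆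
    x∈⁅x⁆ {x} with x ≟ x in eq
    ... | yes _ = mem (cong does eq)
    ... | no ¬p = ⊥-elim (¬p refl)

    ∈⁅⁆⇒≡ : {i x : Fin n} → i ∈ ⁅ x ⁆ → i ≡ x
    ∈⁅⁆⇒≡ {i} {x} (mem p) with i ≟ x
    ... | yes q = q

    ⁅⁆-⊆ : {x : Fin n} {A : VSet n} → x ∈ A → ⁅ x ⁆ ⊆ A
    ⁅⁆-⊆ p q with ∈⁅⁆⇒≡ q
    ... | refl = p

    ∈--⁺ : {i x : Fin n} {A : VSet n} → i ∈ A → i ≢ x → i ∈ A - x
    ∈--⁺ p q = ∈-∖⁺ p (λ r → q (∈⁅⁆⇒≡ r))

    ∈--⁻ : {i x : Fin n} {A : VSet n} → i ∈ A - x → i ∈ A × i ≢ x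
    ∈--⁻ p with ∈-∖⁻ p
    ... | a , b = a , λ { refl → b x∈⁅x⁆ }

    remove-⊆ : {A : VSet n} {x : Fin n} → A - x ⊆ A
    remove-⊆ p = proj₁ (∈--⁻ p)

    ∈-full : {i : Fin n} → i ∈ Full
    ∈-full = mem refl

⟦_⟧ : Bool → ℕ
⟦ b ⟧ = if b then 1 else 0

opaque

  over : ∀ {n} → VSet n → (Fin n → ℕ) → ℕ
  over A f = sum (λ i → if A i then f i else 0)

card : ∀ {n} → VSet n → ℕ
card A = over A (λ _ → 1)

sum-mono : ∀ {n} {f g : Fin n → ℕ} → (∀ i → f i ≤ g i) → sum f ≤ sum g
sum-mono {zero}  p = z≤n
sum-mono {suc n} p = +-mono-≤ (p zero) (sum-mono (λ i → p (suc i)))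

module _ {n : ℕ} where

  opaque
    unfolding over _∩_

    over-mono : {A B : VSet n} {f g : Fin n → ℕ} → A ⊆ B → (∀ {i} → i ∈ A → f i ≤ g i) →
                over A f ≤ over B g
    over-mono {A} {B} {f} {g} s p = sum-mono pointwise
      where
      pointwise : ∀ i → (if A i then f i else 0) ≤ (if B i then g i else 0)
      pointwise i with A i in a | B i in b
      ... | false | _     = z≤n
      ... | true  | true  = p (mem a)
      ... | true  | false with s (mem a)
      ...   | mem c with trans (sym b) c
      ...     | ()

    over-cong : {A B : VSet n} {f g : Fin n → ℕ} → A ⊆ B → B ⊆ A → (∀ {i} → i ∈ A → f i ≡ g i) →
                over A f ≡ over B g
    over-cong s t p = ≤-antisym (over-mono s (λ a → ≤-reflexive (p a)))
                                (over-mono t (λ b → ≤-reflexive (sym (p (t b)))))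

    over-monoʳ : (A : VSet n) {f g : Fin n → ℕ} → (∀ {i} → i ∈ A → f i ≤ g i) → over A f ≤ over A g
    over-monoʳ A = over-mono (λ a → a)

    over-congʳ : (A : VSet n) {f g : Fin n → ℕ} → (∀ {i} → i ∈ A → f i ≡ g i) → over A f ≡ over A g
    over-congʳ A = over-cong (λ a → a) (λ a → a)

    over-+ : (A : VSet n) (f g : Fin n → ℕ) → over A (λ i → f i + g i) ≡ over A f + over A g
    over-+ A f g = trans (sum-cong-≗ pointwise) (∑-distrib-+ (λ i → if A i then f i else 0) _)
      where
      pointwise : ∀ i → (if A i then f i + g i else 0) ≡ (if A i then f i else 0) + (if A i then g i else 0)
      pointwise i with A i
      ... | true  = refl
      ... | false = refl

    over-const : (A : VSet n) (c : ℕ) → over A (λ _ → c) ≡ card A * c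
    over-const A c = trans (sum-cong-≗ pointwise) (sym (*-distribʳ-sum c (λ i → if A i then 1 else 0)))
      where
      pointwise : ∀ i → (if A i then c else 0) ≡ (if A i then 1 else 0) * c
      pointwise i with A i
      ... | true  = sym (+-identityʳ c)
      ... | false = refl

    over-split : (A B : VSet n) (f : Fin n → ℕ) → over A f ≡ over (A ∩ B) f + over (A ∖ B) f
    over-split A B f = trans (sum-cong-≗ pointwise) (∑-distrib-+ (λ i → if (A ∩ B) i then f i else 0) _)
      where
      pointwise : ∀ i → (if A i then f i else 0) ≡
                        (if (A ∩ B) i then f i else 0) + (if (A ∖ B) i then f i else 0)
      pointwise i with A i | B i
      ... | true  | true  = sym (+-identityʳ (f i))
      ... | true  | false = refl
      ... | false | _     = refl

    over-∖ : {A B : VSet n} → B ⊆ A → (f : Fin n → ℕ) → over A f ≡ over B f + over (A ∖ B) f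
    over-∖ {A} {B} s f = trans (over-split A B f)
      (cong (_+ over (A ∖ B) f) (over-cong ∩-⊆ʳ (λ b → ∈-∩⁺ (s b) b) (λ _ → refl)))

    over-∪ : {A B : VSet n} → (∀ {i} → i ∈ A → i ∉ B) → (f : Fin n → ℕ) →
             over (A ∪ B) f ≡ over A f + over B f
    over-∪ {A} {B} d f = trans (over-∖ {A = A ∪ B} {B = A} ∈-∪ˡ f) (cong (over A f +_) (over-cong to from (λ _ → refl)))
      where
      to : (A ∪ B) ∖ A ⊆ B
      to p with ∈-∖⁻ {A = A ∪ B} {B = A} p
      ... | q , r with ∈-∪⁻ q
      ...   | inj₁ a = ⊥-elim (r a)
      ...   | inj₂ b = b
      from : B ⊆ (A ∪ B) ∖ A
      from b = ∈-∖⁺ (∈-∪ʳ b) (λ a → d a b)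

opaque
  unfolding over _∩_

  over-⁅⁆ : ∀ {n} (x : Fin n) (f : Fin n → ℕ) → over ⁅ x ⁆ f ≡ f x
  over-⁅⁆ {suc n} zero    f = trans (cong (f zero +_) (sum-replicate-zero n)) (+-identityʳ _)
  over-⁅⁆ {suc n} (suc x) f = over-⁅⁆ x (λ i → f (suc i))

  over-swap : ∀ {n p} (A : VSet n) (B : VSet p) (h : Fin n → Fin p → ℕ) →
              over A (λ i → over B (h i)) ≡ over B (λ j → over A (λ i → h i j))
  over-swap {n} {p} A B h = begin
    sum (λ i → if A i then over B (h i) else 0)
      ≡⟨ sum-cong-≗ inner ⟩
    sum (λ i → sum (λ j → if A i then (if B j then h i j else 0) else 0))
      ≡⟨ ∑-comm (λ i j → if A i then (if B j then h i j else 0) else 0) ⟩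
    sum (λ j → sum (λ i → if A i then (if B j then h i j else 0) else 0))
      ≡⟨ sum-cong-≗ outer ⟩
    over B (λ j → over A (λ i → h i j)) ∎
    where
    open ≡-Reasoning
    inner : ∀ i → (if A i then over B (h i) else 0) ≡ sum (λ j → if A i then (if B j then h i j else 0) else 0)
    inner i with A i
    ... | true  = refl
    ... | false = sym (sum-replicate-zero p)
    outer : ∀ j → sum (λ i → if A i then (if B j then h i j else 0) else 0) ≡
                  (if B j then over A (λ i → h i j) else 0)
    outer j with B j
    ... | true  = refl
    ... | false = trans (sum-cong-≗ (λ i → const0 (A i))) (sum-replicate-zero n)
      where
      const0 : ∀ b → (if b then 0 else 0) ≡ 0
      const0 true  = refl
      const0 false = refl

module _ {n : ℕ} where

  opaque
    unfolding _∩_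

    over-remove : {A : VSet n} {x : Fin n} → x ∈ A → (f : Fin n → ℕ) → over A f ≡ f x + over (A - x) f
    over-remove {A} {x} p f = trans (over-∖ (⁅⁆-⊆ p) f) (cong (_+ over (A - x) f) (over-⁅⁆ x f))

  over-insert : {A : VSet n} {x : Fin n} → x ∉ A → (f : Fin n → ℕ) → over (A ∪ ⁅ x ⁆) f ≡ over A f + f x
  over-insert {A} {x} p f = trans (over-∪ (λ a b → p (subst (_∈ A) (∈⁅⁆⇒≡ b) a)) f)
                                  (cong (over A f +_) (over-⁅⁆ x f))

  over-lower : {A : VSet n} {f : Fin n → ℕ} {c : ℕ} → (∀ {i} → i ∈ A → c ≤ f i) → card A * c ≤ over A f
  over-lower {A} {f} {c} p = subst (_≤ over A f) (over-const A c) (over-monoʳ A p)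

  -- A deficit at one element cannot be made up by the others and would survive in the totals. This
  -- turns an exhausted counting bound into an equality at each vertex.
  over-tight : {A : VSet n} {f g : Fin n → ℕ} → (∀ {i} → i ∈ A → f i ≤ g i) → over A g ≤ over A f →
               ∀ {i} → i ∈ A → g i ≤ f i
  over-tight {A} {f} {g} p q {x} a = +-cancelʳ-≤ (over (A - x) g) (g x) (f x) (begin
    g x + over (A - x) g ≡⟨ over-remove a g ⟨
    over A g             ≤⟨ q ⟩
    over A f             ≡⟨ over-remove a f ⟩
    f x + over (A - x) f ≤⟨ +-monoʳ-≤ (f x) (over-monoʳ (A - x) (λ b → p (proj₁ (∈--⁻ b)))) ⟩
    f x + over (A - x) g ∎)
    where open ≤-Reasoning

  card-mono : {A B : VSet n} → A ⊆ B → card A ≤ card B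
  card-mono s = over-mono s (λ _ → ≤-refl)

  opaque
    unfolding over _∩_

    card-∩ : (A B : VSet n) → card (A ∩ B) ≡ over A (λ i → ⟦ B i ⟧)
    card-∩ A B = sum-cong-≗ pointwise
      where
      pointwise : ∀ i → (if A i ∧ B i then 1 else 0) ≡ (if A i then ⟦ B i ⟧ else 0)
      pointwise i with A i
      ... | true  = refl
      ... | false = refl

  card-remove : {A : VSet n} {x : Fin n} → x ∈ A → card A ≡ suc (card (A - x))
  card-remove p = over-remove p (λ _ → 1)

  card-insert : {A : VSet n} {x : Fin n} → x ∉ A → card (A ∪ ⁅ x ⁆) ≡ suc (card A)
  card-insert {A} p = trans (over-insert p (λ _ → 1)) (+-comm (card A) 1)

  card-< : {A B : VSet n} {x : Fin n} → A ⊆ B → x ∈ B → x ∉ A → card A < card B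
  card-< {A} {B} {x} s b ¬a = subst (suc (card A) ≤_) (sym (card-remove b))
    (s≤s (card-mono (λ {i} a → ∈--⁺ (s a) (λ { refl → ¬a a }))))

  opaque
    unfolding over _∩_

    card-empty : {A : VSet n} → (∀ {i} → i ∉ A) → card A ≡ 0
    card-empty {A} e = n≤0⇒n≡0 (subst (card A ≤_) (sum-replicate-zero n)
      (over-mono {A = A} {B = λ _ → false} {g = λ _ → 0} (λ a → ⊥-elim (e a)) (λ a → ⊥-elim (e a))))

  opaque

    card-pos : {A : VSet n} → 1 ≤ card A → ∃ λ i → i ∈ A
    card-pos {A} p with any? (_∈? A)
    ... | yes q = q
    ... | no ¬q = ⊥-elim (<⇒≢ p (sym (card-empty (λ a → ¬q (_ , a)))))

  card≤1 : {A : VSet n} → card A ≤ 1 → ∀ {i j} → i ∈ A → j ∈ A → i ≡ j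
  card≤1 {A} p {i} {j} a b with i ≟ j
  ... | yes q = q
  ... | no ¬q = ⊥-elim (<⇒≱ (subst (1 <_) (sym (card-remove a))
                  (s≤s (subst (1 ≤_) (sym (card-remove (∈--⁺ b (λ q → ¬q (sym q))))) (s≤s z≤n)))) p)

opaque
  unfolding over Full

  card-Full : ∀ n → card (Full {n}) ≡ n
  card-Full zero    = refl
  card-Full (suc n) = cong suc (card-Full n)

-- The fibres of `g` partition `A`. Both pigeonhole principles `fresh` and `collision` rest on this
-- count.
card-⊎ : ∀ {n p} (A : VSet n) (g : Fin n → Fin p) →
         over {p} Full (λ α → card (A ∩ (λ i → ⁅ g i ⁆ α))) ≡ card A
card-⊎ {n} {p} A g = begin
  over Full (λ α → card (A ∩ (λ i → ⁅ g i ⁆ α)))      ≡⟨ over-congʳ Full (λ {α} _ → card-∩ A (λ i → ⁅ g i ⁆ α)) ⟩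
  over Full (λ α → over A (λ i → ⟦ ⁅ g i ⁆ α ⟧))       ≡⟨ over-swap A Full (λ i α → ⟦ ⁅ g i ⁆ α ⟧) ⟨
  over A (λ i → over Full (λ α → ⟦ ⁅ g i ⁆ α ⟧))       ≡⟨ over-congʳ A (λ {i} _ → one (g i)) ⟩
  card A ∎
  where
  open ≡-Reasoning
  one : ∀ x → over Full (λ α → ⟦ ⁅ x ⁆ α ⟧) ≡ 1
  one x = begin
    over Full (λ α → ⟦ ⁅ x ⁆ α ⟧) ≡⟨ card-∩ Full ⁅ x ⁆ ⟨
    card (Full ∩ ⁅ x ⁆)            ≡⟨ over-cong ∩-⊆ʳ (λ a → ∈-∩⁺ ∈-full a) (λ _ → refl) ⟩
    card ⁅ x ⁆                     ≡⟨ over-⁅⁆ x (λ _ → 1) ⟩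
    1                              ∎

module _ {n p : ℕ} (A : VSet n) (g : Fin n → Fin p) where

  private
    fibre : Fin p → VSet n
    fibre α = A ∩ (λ i → ⁅ g i ⁆ α)

    fibre⁺ : ∀ {α i} → i ∈ A → g i ≡ α → i ∈ fibre α
    fibre⁺ {i = i} a refl with x∈⁅x⁆ {x = g i}
    ... | mem q = ∈-∩⁺ {A = A} {B = λ j → ⁅ g j ⁆ (g i)} a (mem q)

    fibre⁻ : ∀ {α i} → i ∈ fibre α → i ∈ A × g i ≡ α
    fibre⁻ {α} {i} q with ∈-∩⁻ {A = A} {B = λ j → ⁅ g j ⁆ α} q
    ... | a , mem r = a , sym (∈⁅⁆⇒≡ {i = α} {x = g i} (mem r))

  opaque

    fresh : card A < p → ∃ λ α → ∀ {i} → i ∈ A → g i ≢ α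
    fresh c with any? (λ α → card (fibre α) ≤? 0)
    ... | yes (α , q) = α , λ {i} a e → <⇒≱ (subst (1 ≤_) (sym (card-remove {A = fibre α} (fibre⁺ a e))) (s≤s z≤n)) q
    ... | no ¬q = ⊥-elim (<⇒≱ c (begin
        p                      ≡⟨ card-Full p ⟨
        card (Full {p})        ≤⟨ over-monoʳ Full (λ {α} _ → ≰⇒> (λ z → ¬q (α , z))) ⟩
        over {p} Full (λ α → card (fibre α)) ≡⟨ card-⊎ A g ⟩
        card A                 ∎))
      where open ≤-Reasoning

    collision : p < card A → ∃ λ i → ∃ λ j → i ∈ A × j ∈ A × i ≢ j × g i ≡ g j
    collision c with any? (λ α → 2 ≤? card (fibre α))
    ... | yes (α , q) = i , j , proj₁ (fibre⁻ {α} i∈) , proj₁ (fibre⁻ {α} (proj₁ j∈′)) , (λ e → proj₂ j∈′ (sym e)) ,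
                        trans (proj₂ (fibre⁻ {α} i∈)) (sym (proj₂ (fibre⁻ {α} (proj₁ j∈′))))
      where
      i∃ : ∃ λ i → i ∈ fibre α
      i∃ = card-pos {A = fibre α} (≤-trans (s≤s z≤n) q)
      i : Fin n
      i = proj₁ i∃
      i∈ : i ∈ fibre α
      i∈ = proj₂ i∃
      j∃ : ∃ λ j → j ∈ fibre α - i
      j∃ = card-pos {A = fibre α - i} (≤-pred (subst (2 ≤_) (card-remove i∈) q))
      j : Fin n
      j = proj₁ j∃
      j∈′ : j ∈ fibre α × j ≢ i
      j∈′ = ∈--⁻ {A = fibre α} (proj₂ j∃)
    ... | no ¬q = ⊥-elim (<⇒≱ c (begin
        card A                 ≡⟨ card-⊎ A g ⟨
        over {p} Full (λ α → card (fibre α)) ≤⟨ over-monoʳ Full (λ {α} _ → ≤-pred (≰⇒> (λ z → ¬q (α , z)))) ⟩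
        card (Full {p})        ≡⟨ card-Full p ⟩
        p                      ∎))
      where open ≤-Reasoning

module _ {n : ℕ} where

  over-≥ : {A : VSet n} {i : Fin n} → i ∈ A → (f : Fin n → ℕ) → f i ≤ over A f
  over-≥ {A} {i} a f = subst (f i ≤_) (sym (over-remove a f)) (m≤m+n (f i) (over (A - i) f))

  card-≥1 : {A : VSet n} {i : Fin n} → i ∈ A → 1 ≤ card A
  card-≥1 a = over-≥ a (λ _ → 1)

-- Walks, dicolourings and critical sets

module _ {V : Set} {R S : V → V → Set} where

  walk-map : (∀ {x y} → R x y → S x y) → ∀ {a b} → Walk R a b → Walk S a b
  walk-map f (step r)  = step (f r)
  walk-map f (r ∷ʷ w) = f r ∷ʷ walk-map f w

module _ {V : Set} {R : V → V → Set} where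

  walk-snoc : ∀ {a b c} → Walk R a b → R b c → Walk R a c
  walk-snoc (step r)  s = r ∷ʷ step s
  walk-snoc (r ∷ʷ w) s = r ∷ʷ walk-snoc w s

module _ {V : Set} {R : V → V → Set} where

  walk-flip : ∀ {a b} → Walk R a b → Walk (flip R) b a
  walk-flip (step r)  = step r
  walk-flip (r ∷ʷ w) = walk-snoc (walk-flip w) r

  walk-head : ∀ {a b} → Walk R a b → ∃ λ c → R a c
  walk-head (step r)  = _ , r
  walk-head (r ∷ʷ _) = _ , r

  walk-last : ∀ {a b} → Walk R a b → ∃ λ c → R c b
  walk-last (step r)  = _ , r
  walk-last (_ ∷ʷ w) = walk-last w

  -- Records along the walk a property that arcs cannot leave; for closed walks this confines them
  -- to one side of a cut.
  walk-forward : (Q : V → Set) → (∀ {x y} → R x y → Q x → Q y) →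
                 ∀ {a b} → Walk R a b → Q a → Walk (λ x y → R x y × Q x × Q y) a b
  walk-forward Q p (step r)  q = step (r , q , p r q)
  walk-forward Q p (r ∷ʷ w) q = (r , q , p r q) ∷ʷ walk-forward Q p w (p r q)

  walk-backward : (Q : V → Set) → (∀ {x y} → R x y → Q y → Q x) →
                  ∀ {a b} → Walk R a b → Q b → Walk (λ x y → R x y × Q x × Q y) a b
  walk-backward Q p w q = proj₁ (go w q)
    where
    go : ∀ {a b} → Walk R a b → Q b → Walk (λ x y → R x y × Q x × Q y) a b × Q a
    go (step r)  q = step (r , p r q , q) , p r q
    go (r ∷ʷ w) q with go w q
    ... | w′ , q′ = (r , p r q′ , q′) ∷ʷ w′ , p r q′

-- `E i` is the out-neighbourhood of i, hence `flip E i` its in-neighbourhood. Statements on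
-- out-degrees used at `flip E` give those on in-degrees.
Arcs : ℕ → Set
Arcs n = Fin n → VSet n

Loopless : ∀ {n} → Arcs n → Set
Loopless E = ∀ {i} → i ∉ E i

module _ {n : ℕ} where

  ∈-flip : {E : Arcs n} {i j : Fin n} → j ∈ E i → i ∈ flip E j
  ∈-flip (mem p) = mem p

  Loopless-flip : {E : Arcs n} → Loopless E → Loopless (flip E)
  Loopless-flip l (mem p) = l (mem p)

  arcs : Arcs n → VSet n → VSet n → ℕ
  arcs E A B = over A (λ i → card (B ∩ E i))

  arcs-flip : (E : Arcs n) (A B : VSet n) → arcs (flip E) B A ≡ arcs E A B
  arcs-flip E A B = begin
    over B (λ j → card (A ∩ flip E j))        ≡⟨ over-congʳ B (λ {j} _ → card-∩ A (flip E j)) ⟩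
    over B (λ j → over A (λ i → ⟦ E i j ⟧))   ≡⟨ over-swap A B (λ i j → ⟦ E i j ⟧) ⟨
    over A (λ i → over B (λ j → ⟦ E i j ⟧))   ≡⟨ over-congʳ A (λ {i} _ → card-∩ B (E i)) ⟨
    over A (λ i → card (B ∩ E i))             ∎
    where open ≡-Reasoning

  arcs-∖ʳ : (E : Arcs n) (A : VSet n) {B C : VSet n} → C ⊆ B → arcs E A B ≡ arcs E A C + arcs E A (B ∖ C)
  arcs-∖ʳ E A {B} {C} s = trans (over-congʳ A (λ {i} _ → split i)) (over-+ A _ _)
    where
    split : ∀ i → card (B ∩ E i) ≡ card (C ∩ E i) + card ((B ∖ C) ∩ E i)
    split i = begin
      card (B ∩ E i)                     ≡⟨ card-∩ B (E i) ⟩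
      over B (λ j → ⟦ E i j ⟧)           ≡⟨ over-∖ s (λ j → ⟦ E i j ⟧) ⟩
      over C (λ j → ⟦ E i j ⟧) + over (B ∖ C) (λ j → ⟦ E i j ⟧) ≡⟨ cong₂ _+_ (card-∩ C (E i)) (card-∩ (B ∖ C) (E i)) ⟨
      card (C ∩ E i) + card ((B ∖ C) ∩ E i) ∎
      where open ≡-Reasoning

module _ {n m : ℕ} where

  Mono : Arcs n → VSet n → (Fin n → Fin m) → Fin n → Fin n → Set
  Mono E W f i j = i ∈ W × j ∈ W × j ∈ E i × f i ≡ f j

  Valid : Arcs n → VSet n → (Fin n → Fin m) → Set
  Valid E W f = ∀ v → ¬ Walk (Mono E W f) v v

  Valid-⊆ : {E F : Arcs n} {A B : VSet n} {f : Fin n → Fin m} → A ⊆ B →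
            (∀ {i j} → i ∈ A → j ∈ A → j ∈ E i → j ∈ F i) → Valid F B f → Valid E A f
  Valid-⊆ s e val v w = val v (walk-map (λ (a , b , c , d) → s a , s b , e a b c , d) w)

  Valid-flip : {E : Arcs n} {W : VSet n} {f : Fin n → Fin m} → Valid E W f → Valid (flip E) W f
  Valid-flip val v w = val v (walk-map (λ { (a , b , mem c , d) → b , a , mem c , sym d }) (walk-flip w))

  Valid-digon : {E : Arcs n} {W : VSet n} {f : Fin n → Fin m} → Valid E W f →
                ∀ {i j} → i ∈ W → j ∈ W → j ∈ E i → i ∈ E j → f i ≢ f j
  Valid-digon val {i} a b p q e = val i ((a , b , p , e) ∷ʷ step (b , a , q , sym e))

  -- No monochromatic arc leaves x in the first case and none enters it in the second, so a closed
  -- monochromatic walk misses x and lives in `A - x`. One direction suffices, so a bound on the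
  -- out-degree or on the in-degree alone is already useful.
  Valid-extend : {E : Arcs n} {A : VSet n} {f : Fin n → Fin m} {x : Fin n} {α : Fin m} →
                 Loopless E → Valid E (A - x) f →
                 (∀ {j} → j ∈ A → j ∈ E x → f j ≢ α) ⊎ (∀ {j} → j ∈ A → x ∈ E j → f j ≢ α) →
                 Valid E A (updateAt f x (const α))
  Valid-extend {E} {A} {f} {x} {α} irr val free v w = by free
    where
    f′ = updateAt f x (const α)

    x↦α : f′ x ≡ α
    x↦α = updateAt-updates x f

    same : ∀ {i} → i ≢ x → f′ i ≡ f i
    same {i} p = updateAt-minimal i x f p

    restrict : Walk (λ i j → Mono E A f′ i j × i ≢ x × j ≢ x) v v → ⊥
    restrict u = val v (walk-map (λ ((a , b , c , d) , p , q) →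
      ∈--⁺ a p , ∈--⁺ b q , c , trans (sym (same p)) (trans d (same q))) u)

    by : (∀ {j} → j ∈ A → j ∈ E x → f j ≢ α) ⊎ (∀ {j} → j ∈ A → x ∈ E j → f j ≢ α) → ⊥
    by (inj₁ out) = restrict (walk-backward (_≢ x) (λ r _ → not-from r) w (not-from (proj₂ (walk-head w))))
      where
      not-from : ∀ {i j} → Mono E A f′ i j → i ≢ x
      not-from {_} {j} (a , b , c , d) refl =
        out b c (trans (sym (same (λ { refl → irr c }))) (trans (sym d) x↦α))
    by (inj₂ inn) = restrict (walk-forward (_≢ x) (λ r _ → not-to r) w (not-to (proj₂ (walk-last w))))
      where
      not-to : ∀ {i j} → Mono E A f′ i j → j ≢ x
      not-to {i} (a , b , c , d) refl =
        inn a c (trans (sym (same (λ { refl → irr c }))) (trans d x↦α))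

module _ (m : ℕ) {n : ℕ} where

  Colourable : Arcs n → VSet n → Set
  Colourable E W = Σ (Fin n → Fin m) (Valid E W)

  -- Criticality with respect to vertex deletion, so that a minimal non-colourable vertex set is
  -- critical. The double negation avoids deciding colourability.
  Critical : Arcs n → VSet n → Set
  Critical E W = ¬ Colourable E W × (∀ {v} → v ∈ W → ¬ ¬ Colourable E (W - v))

module _ {m n : ℕ} where

  Colourable-⊆ : {E : Arcs n} {A B : VSet n} → A ⊆ B → Colourable m E B → Colourable m E A
  Colourable-⊆ s (f , val) = f , Valid-⊆ s (λ _ _ e → e) val

  Critical-flip : {E : Arcs n} {W : VSet n} → Critical m E W → Critical m (flip E) W
  Critical-flip (c , d) = (λ (f , val) → c (f , Valid-flip val)) ,
                          (λ v k → d v (λ (f , val) → k (f , Valid-flip val)))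

  Critical-⊆ : {E : Arcs n} {A W : VSet n} {v : Fin n} → Critical m E W → v ∈ W → v ∉ A → A ⊆ W →
               ¬ ¬ Colourable m E A
  Critical-⊆ {A = A} (_ , d) v∈ v∉ s k =
    d v∈ (λ c → k (Colourable-⊆ (λ {i} a → ∈--⁺ (s a) (λ { refl → v∉ a })) c))

  -- Vertices are deleted as long as the set stays non-colourable; whether one can be deleted is
  -- decided classically under the double negation.
  exists-critical : (E : Arcs n) (W : VSet n) → ¬ Colourable m E W →
                    ¬ ¬ (Σ (VSet n) λ P → P ⊆ W × Critical m E P)
  exists-critical E W = go (card W) W ≤-refl
    where
    go : ∀ c (W : VSet n) → card W ≤ c → ¬ Colourable m E W →
         ¬ ¬ (Σ (VSet n) λ P → P ⊆ W × Critical m E P)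
    go zero    W le nc k = k (W , (λ x → x) , nc , λ {v} v∈ → ⊥-elim (1+n≰n (≤-trans (subst (1 ≤_) (sym (card-remove v∈)) (s≤s z≤n)) le)))
    go (suc c) W le nc k = ¬¬-excluded-middle {A = ∃ λ v → v ∈ W × ¬ Colourable m E (W - v)} λ
      { (yes (v , v∈ , nc′)) →
          go c (W - v) (≤-pred (subst (_≤ suc c) (card-remove v∈) le)) nc′
            (λ (P , s , cr) → k (P , (λ p → remove-⊆ (s p)) , cr))
      ; (no none) → k (W , (λ x → x) , nc , λ v∈ nc′ → none (_ , v∈ , nc′)) }

  min-degree : {E : Arcs n} {W : VSet n} → Loopless E → Critical m E W →
               ∀ {v} → v ∈ W → m ≤ card (W ∩ E v)
  min-degree {E} {W} irr (nc , d) {v} v∈ = decidable-stable (m ≤? card (W ∩ E v)) λ small →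
    d v∈ λ (f , val) →
      let α , new = fresh (W ∩ E v) f (≰⇒> small)
      in nc (_ , Valid-extend irr val (inj₁ (λ a b → new (∈-∩⁺ a b))))

-- Rotations of the colours and arc-connectivity

mod-cancelˡ : ∀ {p} s {a b} → a < suc p → b < suc p → (s + a) % suc p ≡ (s + b) % suc p → a ≡ b
mod-cancelˡ {p} s {a} {b} a< b< r = go (<-cmp ((s + a) / suc p) ((s + b) / suc p))
  where
  -- Equal remainders with different quotients would put s + c and s + d at least `suc p` apart,
  -- beyond the range of d.
  far : ∀ {c d} → d < suc p → (s + c) % suc p ≡ (s + d) % suc p → (s + c) / suc p < (s + d) / suc p → ⊥
  far {c} {d} d< r lt = <⇒≱ d< (+-cancelˡ-≤ s (suc p) d (begin
    s + suc p                                 ≤⟨ +-monoˡ-≤ (suc p) (m≤m+n s c) ⟩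
    C + suc p                                 ≡⟨ cong (_+ suc p) (m≡m%n+[m/n]*n C (suc p)) ⟩
    C % suc p + C / suc p * suc p + suc p     ≡⟨ +-assoc (C % suc p) _ _ ⟩
    C % suc p + (C / suc p * suc p + suc p)   ≡⟨ cong₂ _+_ r (+-comm (C / suc p * suc p) (suc p)) ⟩
    D % suc p + suc (C / suc p) * suc p       ≤⟨ +-monoʳ-≤ (D % suc p) (*-monoˡ-≤ (suc p) lt) ⟩
    D % suc p + D / suc p * suc p             ≡⟨ m≡m%n+[m/n]*n D (suc p) ⟨
    D                                         ∎))
    where
    open ≤-Reasoning
    C = s + c
    D = s + d

  go : Tri ((s + a) / suc p < (s + b) / suc p) ((s + a) / suc p ≡ (s + b) / suc p) ((s + b) / suc p < (s + a) / suc p) → a ≡ b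
  go (tri< lt _ _) = ⊥-elim (far {a} {b} b< r lt)
  go (tri> _ _ gt) = ⊥-elim (far {b} {a} a< (sym r) gt)
  go (tri≈ _ q _)  = +-cancelˡ-≡ s a b (trans (m≡m%n+[m/n]*n (s + a) (suc p))
    (trans (cong₂ (λ x y → x + y * suc p) r q) (sym (m≡m%n+[m/n]*n (s + b) (suc p)))))

opaque

  rotate : ∀ {p} → Fin (suc p) → Fin (suc p) → Fin (suc p)
  rotate {p} s a = (toℕ s + toℕ a) mod suc p

  rotate-injective : ∀ {p} (s : Fin (suc p)) {a b} → rotate s a ≡ rotate s b → a ≡ b
  rotate-injective {p} s {a} {b} e = toℕ-injective (mod-cancelˡ (toℕ s) (toℕ<n a) (toℕ<n b)
    (trans (sym (toℕ-fromℕ< (m%n<n (toℕ s + toℕ a) (suc p))))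
           (trans (cong toℕ e) (toℕ-fromℕ< (m%n<n (toℕ s + toℕ b) (suc p))))))

  rotate-comm : ∀ {p} (s a : Fin (suc p)) → rotate s a ≡ rotate a s
  rotate-comm {p} s a = cong (_mod suc p) (+-comm (toℕ s) (toℕ a))

card-≤1 : ∀ {n} (A : VSet n) → (∀ {i j} → i ∈ A → j ∈ A → i ≡ j) → card A ≤ 1
card-≤1 A uniq with any? (_∈? A)
... | no ¬q       = subst (_≤ 1) (sym (card-empty (λ a → ¬q (_ , a)))) z≤n
... | yes (x , a) = ≤-reflexive (trans (card-remove a) (cong suc (card-empty (λ b →
                      let c , d = ∈--⁻ {A = A} b in d (uniq c a)))))

-- Rotating the colours of W ∖ U in m ways, every rotation must be spoilt by an
-- arc from U to W ∖ U with equally coloured ends, and an arc spoils only one.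
arc-connectivity : ∀ {m n} {E : Arcs n} {U W : VSet n} → Critical m E W → U ⊆ W →
                   ∀ {u w} → u ∈ U → w ∈ W → w ∉ U → m ≤ arcs E U (W ∖ U)
arc-connectivity {zero} _ _ _ _ _ = z≤n
arc-connectivity {suc p} {n} {E} {U} {W} cr U⊆W {u} {w} u∈ w∈ w∉ =
  decidable-stable (suc p ≤? arcs E U C) λ small →
  Critical-⊆ {A = U} cr w∈ w∉ U⊆W λ (f , valf) →
  Critical-⊆ {A = C} cr (U⊆W u∈) (λ q → proj₂ (∈-∖⁻ {A = W} {B = U} q) u∈) ∖-⊆ λ (g , valg) →
  small (count f valf g valg)
  where
  C = W ∖ U

  module _ (f : Fin n → Fin (suc p)) (valf : Valid E U f) (g : Fin n → Fin (suc p)) (valg : Valid E C g) where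

    bad : Fin (suc p) → Arcs n
    bad s i j = E i j ∧ does (f i ≟ rotate s (g j))

    bad⁺ : ∀ {s i j} → j ∈ E i → f i ≡ rotate s (g j) → j ∈ bad s i
    bad⁺ {s} {i} {j} (mem p) q with f i ≟ rotate s (g j) in eq
    ... | yes _ = mem (cong₂ _∧_ p (cong does eq))
    ... | no ¬q = ⊥-elim (¬q q)

    match : Fin n → Fin n → VSet (suc p)
    match i j s = does (f i ≟ rotate s (g j))

    match⁻ : ∀ {i j s} → s ∈ match i j → f i ≡ rotate s (g j)
    match⁻ {i} {j} {s} (mem q) with f i ≟ rotate s (g j)
    ... | yes r = r

    combined : Fin (suc p) → Fin n → Fin (suc p)
    combined s i = if U i then f i else rotate s (g i)

    on-U : ∀ {s i} → i ∈ U → combined s i ≡ f i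
    on-U {s} {i} (mem q) = cong (λ b → if b then f i else rotate s (g i)) q

    off-U : ∀ {s i} → i ∉ U → combined s i ≡ rotate s (g i)
    off-U {s} {i} q = cong (λ b → if b then f i else rotate s (g i)) (∉⇒false {A = U} q)

    combined-valid : ∀ s → arcs (bad s) U C ≡ 0 → Valid E W (combined s)
    combined-valid s none v walk = by (v ∈? U)
      where
      -- With no spoilt arc a monochromatic walk never leaves `U`, so a closed one stays on one
      -- side, where `f` or the rotated `g` is valid.
      no-exit : ∀ {i j} → Mono E W (combined s) i j → i ∈ U → j ∈ U
      no-exit {i} {j} (a , b , c , d) i∈ with j ∈? U
      ... | yes j∈ = j∈
      ... | no  j∉ = ⊥-elim (<⇒≢ (≤-trans (card-≥1 {A = C ∩ bad s i} spoilt) (over-≥ i∈ (λ i → card (C ∩ bad s i)))) (sym none))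
        where
        spoilt : j ∈ C ∩ bad s i
        spoilt = ∈-∩⁺ {A = C} {B = bad s i} (∈-∖⁺ {A = W} {B = U} b j∉)
                   (bad⁺ c (trans (sym (on-U {s} i∈)) (trans d (off-U {s} j∉))))

      by : Dec (v ∈ U) → ⊥
      by (yes v∈) = valf v (walk-map (λ ((a , b , c , d) , q , r) →
        q , r , c , trans (sym (on-U {s} q)) (trans d (on-U {s} r))) (walk-forward (_∈ U) no-exit walk v∈))
      by (no v∉) = valg v (walk-map (λ ((a , b , c , d) , q , r) →
        ∈-∖⁺ a q , ∈-∖⁺ b r , c ,
        rotate-injective s (trans (sym (off-U {s} q)) (trans d (off-U {s} r))))
          (walk-backward (_∉ U) (λ r j∉ i∈ → j∉ (no-exit r i∈)) walk v∉))

    count : suc p ≤ arcs E U C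
    count = begin
      suc p                                     ≡⟨ card-Full (suc p) ⟨
      card (Full {suc p})                       ≤⟨ over-monoʳ Full (λ {s} _ → n≢0⇒n>0 (λ z → proj₁ cr (_ , combined-valid s z))) ⟩
      over {suc p} Full (λ s → arcs (bad s) U C) ≡⟨ over-swap Full U (λ s i → card (C ∩ bad s i)) ⟩
      over U (λ i → over {suc p} Full (λ s → card (C ∩ bad s i)))
        ≡⟨ over-congʳ U (λ {i} _ → over-congʳ Full (λ {s} _ → card-∩ C (bad s i))) ⟩
      over U (λ i → over {suc p} Full (λ s → over C (λ j → ⟦ bad s i j ⟧)))
        ≡⟨ over-congʳ U (λ {i} _ → over-swap Full C (λ s j → ⟦ bad s i j ⟧)) ⟩
      over U (λ i → over C (λ j → over {suc p} Full (λ s → ⟦ bad s i j ⟧)))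
        ≤⟨ over-monoʳ U (λ {i} _ → over-monoʳ C (λ {j} _ → one-rotation i j)) ⟩
      over U (λ i → over C (λ j → ⟦ E i j ⟧))
        ≡⟨ over-congʳ U (λ {i} _ → card-∩ C (E i)) ⟨
      arcs E U C                                ∎
      where
      open ≤-Reasoning
      -- For a fixed arc from i to j the equation `f i ≡ rotate s (g j)` determines s.
      one-rotation : ∀ i j → over {suc p} Full (λ s → ⟦ bad s i j ⟧) ≤ ⟦ E i j ⟧
      one-rotation i j with E i j
      ... | false = ≤-reflexive (over-const {suc p} Full 0) ⟨≤⟩ ≤-reflexive (*-zeroʳ (card (Full {suc p})))
        where
        _⟨≤⟩_ = ≤-trans
      ... | true  = subst (_≤ 1) (card-∩ Full (match i j)) (card-≤1 (Full ∩ match i j) λ {s} {t} a b →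
              rotate-injective (g j) (trans (rotate-comm (g j) s) (trans
                (sym (match⁻ {i} {j} (∩-⊆ʳ {A = Full} {B = match i j} a)))
                (trans (match⁻ {i} {j} (∩-⊆ʳ {A = Full} {B = match i j} b)) (rotate-comm t (g j))))))

-- Excess counting

-- This is (a - 1)(b - 1) ≥ 0. It compares the a b arcs from one part of a split clique to the other
-- with the size of the clique.
product-≥ : ∀ {a b} → 1 ≤ a → 1 ≤ b → a + b ≤ suc (a * b)
product-≥ {suc a} {suc b} _ _ = s≤s (begin
  a + suc b             ≡⟨ +-comm a (suc b) ⟩
  suc b + a             ≡⟨ cong (suc b +_) (sym (*-identityʳ a)) ⟩
  suc b + a * 1         ≤⟨ +-monoʳ-≤ (suc b) (*-monoʳ-≤ a (s≤s z≤n)) ⟩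
  suc b + a * suc b     ∎)
  where open ≤-Reasoning

module _ {n : ℕ} where

  card-∪-≤ : (A B : VSet n) → card (A ∪ B) ≤ card A + card B
  card-∪-≤ A B = begin
    card (A ∪ B)                 ≡⟨ over-∖ {A = A ∪ B} {B = A} ∈-∪ˡ (λ _ → 1) ⟩
    card A + card ((A ∪ B) ∖ A)  ≤⟨ +-monoʳ-≤ (card A) (card-mono B-only) ⟩
    card A + card B              ∎
    where
    open ≤-Reasoning
    B-only : (A ∪ B) ∖ A ⊆ B
    B-only p with ∈-∖⁻ p
    ... | q , r with ∈-∪⁻ q
    ...   | inj₁ a = ⊥-elim (r a)
    ...   | inj₂ b = b

  Clique : Arcs n → VSet n → Set
  Clique E A = ∀ {i j} → i ∈ A → j ∈ A → i ≢ j → j ∈ E i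

  -- The bound m |W| + m - 2, written without subtraction.
  Sparse : ℕ → Arcs n → VSet n → Set
  Sparse m E W = arcs E W W + 2 ≤ m * card W + m

  Sparse-flip : ∀ {m} {E : Arcs n} {W : VSet n} → Sparse m E W → Sparse m (flip E) W
  Sparse-flip {m} {E} {W} = subst (λ a → a + 2 ≤ m * card W + m) (sym (arcs-flip E W W))

  arcs-split : (E : Arcs n) {P W : VSet n} → P ⊆ W →
               arcs E W W ≡ arcs E P P + arcs E P (W ∖ P) + arcs E (W ∖ P) W
  arcs-split E {P} {W} s = trans (over-∖ s (λ i → card (W ∩ E i)))
                                 (cong (_+ arcs E (W ∖ P) W) (arcs-∖ʳ E P s))

module _ {m n : ℕ} {E : Arcs n} {W : VSet n} (irr : Loopless E) (cr : Critical m E W) where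

  -- Among m + 1 mutually joined vertices two share one of m colours, so `A` is already
  -- non-colourable and criticality forbids a vertex outside it.
  clique-whole : {A : VSet n} → A ⊆ W → card A ≡ suc m → Clique E A → card W ≡ suc m × Clique E W
  clique-whole {A} s c cl = trans (≤-antisym (card-mono all) (card-mono s)) c , λ a b → cl (all a) (all b)
    where
    all : W ⊆ A
    all {w} w∈ with w ∈? A
    ... | yes a = a
    ... | no ¬a = ⊥-elim (Critical-⊆ {A = A} cr w∈ ¬a s λ (f , val) →
      let i , j , i∈ , j∈ , i≢j , e = collision A f (subst (m <_) (sym c) ≤-refl)
      in Valid-digon {f = f} val i∈ j∈ (cl i∈ j∈ i≢j) (cl j∈ i∈ (λ q → i≢j (sym q))) e)

  rows-≥ : {A : VSet n} → A ⊆ W → m * card A ≤ arcs E A W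
  rows-≥ {A} s = subst (_≤ arcs E A W) (*-comm (card A) m) (over-lower (λ a → min-degree irr cr (s a)))

module _ {m n : ℕ} {E : Arcs n} {W : VSet n} (irr : Loopless E) (cr : Critical m E W) (sp : Sparse m E W) where

  module _ {P : VSet n} (s : P ⊆ W) where

    private
      a = arcs E P P
      b = arcs E P (W ∖ P)
      c = arcs E (W ∖ P) W
      p = m * card P
      r = m * card (W ∖ P)

    split-bound : a + b + c + 2 ≤ p + r + m
    split-bound = subst₂ (λ x y → x + 2 ≤ y + m) (arcs-split E s)
      (trans (cong (m *_) (over-∖ s (λ _ → 1))) (*-distribˡ-+ m (card P) (card (W ∖ P)))) sp

    module _ {u w : Fin n} (u∈ : u ∈ P) (w∈ : w ∈ W) (w∉ : w ∉ P) where

      private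
        cut : m ≤ b
        cut = arc-connectivity cr s u∈ w∈ w∉

        rest : r ≤ c
        rest = rows-≥ irr cr ∖-⊆

      -- The cut leaving `P` takes m arcs and each row outside `P` at least m, which uses up the
      -- summand m of `Sparse`.
      part-sparse : arcs E P P + 2 ≤ m * card P
      part-sparse = +-cancelʳ-≤ (m + r) (a + 2) p (begin
        a + 2 + (m + r)  ≤⟨ +-monoʳ-≤ (a + 2) (+-mono-≤ cut rest) ⟩
        a + 2 + (b + c)  ≡⟨ shuffle a b c ⟩
        a + b + c + 2    ≤⟨ split-bound ⟩
        p + r + m        ≡⟨ shuffle′ p r m ⟩
        p + (m + r)      ∎)
        where
        open ≤-Reasoning
        shuffle : ∀ a b c → a + 2 + (b + c) ≡ a + b + c + 2
        shuffle = solve-∀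
        shuffle′ : ∀ p r m → p + r + m ≡ p + (m + r)
        shuffle′ = solve-∀

      module _ (tight : m * card P ≤ arcs E P P + 2) where

        -- The hypothesis `tight` is equality in `part-sparse`, so the estimates made there, for the
        -- cut and for the outer degrees, are equalities too.
        tight-cut : arcs E P (W ∖ P) ≤ m
        tight-cut = +-cancelʳ-≤ (p + r) b m (begin
          b + (p + r)      ≤⟨ +-monoʳ-≤ b (+-mono-≤ tight rest) ⟩
          b + (a + 2 + c)  ≡⟨ shuffle a b c ⟩
          a + b + c + 2    ≤⟨ split-bound ⟩
          p + r + m        ≡⟨ +-comm (p + r) m ⟩
          m + (p + r)      ∎)
          where
          open ≤-Reasoning
          shuffle : ∀ a b c → b + (a + 2 + c) ≡ a + b + c + 2
          shuffle = solve-∀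

        tight-rest : ∀ {i} → i ∈ W → i ∉ P → card (W ∩ E i) ≤ m
        tight-rest i∈ i∉ = over-tight {A = W ∖ P} {f = λ _ → m} (λ q → min-degree irr cr (∖-⊆ q))
          (subst (c ≤_) (trans (*-comm m (card (W ∖ P))) (sym (over-const (W ∖ P) m))) c≤r) (∈-∖⁺ i∈ i∉)
          where
          c≤r : c ≤ r
          c≤r = +-cancelʳ-≤ (p + m) c r (begin
            c + (p + m)      ≤⟨ +-monoʳ-≤ c (+-mono-≤ tight cut) ⟩
            c + (a + 2 + b)  ≡⟨ shuffle a b c ⟩
            a + b + c + 2    ≤⟨ split-bound ⟩
            p + r + m        ≡⟨ shuffle′ p r m ⟩
            r + (p + m)      ∎)
            where
            open ≤-Reasoning
            shuffle : ∀ a b c → c + (a + 2 + b) ≡ a + b + c + 2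
            shuffle = solve-∀
            shuffle′ : ∀ p r m → p + r + m ≡ r + (p + m)
            shuffle′ = solve-∀

  -- If every vertex of `A` had out-degree above m, then `W` would span at least m |W| + |A| ≥ m |W|
  -- + m - 1 arcs, one too many. Thus `A` may be an m-clique without one vertex.
  low-exists : {A : VSet n} → A ⊆ W → m ≤ suc (card A) → ∃ λ v → v ∈ A × card (W ∩ E v) ≤ m
  low-exists {A} s big with any? (λ v → (v ∈? A) ×-dec (card (W ∩ E v) ≤? m))
  ... | yes q = q
  ... | no ¬q = ⊥-elim (<⇒≱ (≤-trans (≤-reflexive (+-comm 1 (suc (card A)))) bound) big)
    where
    open ≤-Reasoning
    α = card A
    β = card (W ∖ A)
    shuffle : ∀ m α β → α + 2 + (m * (α + β)) ≡ α * suc m + m * β + 2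
    shuffle = solve-∀
    bound : suc α + 1 ≤ m
    bound = +-cancelʳ-≤ (m * (α + β)) (suc α + 1) m (begin
      suc α + 1 + m * (α + β)   ≡⟨ cong (_+ m * (α + β)) (sym (+-suc α 1)) ⟩
      α + 2 + m * (α + β)       ≡⟨ shuffle m α β ⟩
      α * suc m + m * β + 2     ≤⟨ +-monoˡ-≤ 2 (+-mono-≤ (over-lower (λ {v} a → ≰⇒> (λ l → ¬q (v , a , l)))) (rows-≥ irr cr ∖-⊆)) ⟩
      arcs E A W + arcs E (W ∖ A) W + 2 ≡⟨ cong (_+ 2) (over-∖ s (λ i → card (W ∩ E i))) ⟨
      arcs E W W + 2            ≤⟨ sp ⟩
      m * card W + m            ≡⟨ cong (λ x → m * x + m) (over-∖ s (λ _ → 1)) ⟩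
      m * (α + β) + m           ≡⟨ +-comm (m * (α + β)) m ⟩
      m + m * (α + β)           ∎)

critical-nonempty : ∀ {m n} {E : Arcs n} {W : VSet n} → 1 ≤ m → Critical m E W → ∃ λ v → v ∈ W
critical-nonempty {suc _} {W = W} (s≤s _) (nc , _) with any? (_∈? W)
... | yes q = q
... | no ¬q = ⊥-elim (nc ((λ _ → zero) , λ v w → ¬q (v , proj₁ (proj₂ (walk-head w)))))

-- E′ arises from E by redirecting to y all arcs at x.
record Merge {n : ℕ} (E E′ : Arcs n) (x y : Fin n) : Set where
  field
    elsewhere  : ∀ {i j} → i ≢ y → j ≢ y → j ∈ E′ i → j ∈ E i
    elsewhere⁻ : ∀ {i j} → i ≢ y → j ≢ y → j ∈ E i → j ∈ E′ i
    from       : ∀ {j} → j ∈ E′ y → j ∈ E y ⊎ j ∈ E x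
    from-y     : ∀ {j} → j ≢ y → j ∈ E y → j ∈ E′ y
    from-x     : ∀ {j} → j ≢ y → j ∈ E x → j ∈ E′ y
    to         : ∀ {i} → y ∈ E′ i → y ∈ E i ⊎ x ∈ E i
    to-y       : ∀ {i} → i ≢ y → y ∈ E i → y ∈ E′ i
    to-x       : ∀ {i} → i ≢ y → x ∈ E i → y ∈ E′ i
    loop-free   : Loopless E′

-- This symmetry is the reason for describing a merger by its properties: `flip (merge E x y)` is
-- again one, without any comparison with `merge (flip E) x y`.
Merge-flip : ∀ {n} {E E′ : Arcs n} {x y : Fin n} → Merge E E′ x y → Merge (flip E) (flip E′) x y
Merge-flip {E = E} {E′} M = record
  { elsewhere  = λ { p q (mem e) → ∈-flip {E = E} (elsewhere q p (mem e)) }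
  ; elsewhere⁻ = λ { p q (mem e) → ∈-flip {E = E′} (elsewhere⁻ q p (mem e)) }
  ; from       = λ { (mem e) → flip₂ (to (mem e)) }
  ; from-y     = λ { p (mem e) → ∈-flip {E = E′} (to-y p (mem e)) }
  ; from-x     = λ { p (mem e) → ∈-flip {E = E′} (to-x p (mem e)) }
  ; to         = λ { (mem e) → flip₂ (from (mem e)) }
  ; to-y       = λ { p (mem e) → ∈-flip {E = E′} (from-y p (mem e)) }
  ; to-x       = λ { p (mem e) → ∈-flip {E = E′} (from-x p (mem e)) }
  ; loop-free   = Loopless-flip {E = E′} loop-free
  }
  where
  open Merge M
  flip₂ : ∀ {a b c d} → a ∈ E b ⊎ c ∈ E d → b ∈ flip E a ⊎ d ∈ flip E c
  flip₂ (inj₁ (mem p)) = inj₁ (mem p)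
  flip₂ (inj₂ (mem p)) = inj₂ (mem p)

module _ {n : ℕ} (E : Arcs n) (x y : Fin n) where

  merge : Arcs n
  merge i with i ≟ y
  ... | yes _ = (E y ∪ E x) - y
  ... | no _  = λ j → if does (j ≟ y) then (E i y ∨ E i x) else E i j

  private
    at-y : merge y ≡ (E y ∪ E x) - y
    at-y with y ≟ y
    ... | yes _ = refl
    ... | no ¬p = ⊥-elim (¬p refl)

    off-y : ∀ {i} → i ≢ y → ∀ j → merge i j ≡ (if does (j ≟ y) then (E i y ∨ E i x) else E i j)
    off-y {i} p j with i ≟ y
    ... | yes q = ⊥-elim (p q)
    ... | no _  = refl

    off-off : ∀ {i} → i ≢ y → ∀ {j} → j ≢ y → merge i j ≡ E i j
    off-off {i} p {j} q with off-y p j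
    ... | e with j ≟ y
    ...   | yes r = ⊥-elim (q r)
    ...   | no _  = e

    off-at : ∀ {i} → i ≢ y → merge i y ≡ E i y ∨ E i x
    off-at {i} p with off-y p y
    ... | e with y ≟ y
    ...   | yes _ = e
    ...   | no ¬q = ⊥-elim (¬q refl)

    or⁻ : ∀ {a b} → a ∨ b ≡ true → a ≡ true ⊎ b ≡ true
    or⁻ {true}  _ = inj₁ refl
    or⁻ {false} p = inj₂ p

    or⁺ : ∀ {a b} → a ≡ true ⊎ b ≡ true → a ∨ b ≡ true
    or⁺ (inj₁ refl) = refl
    or⁺ {a} (inj₂ refl) = ∨-zeroʳ a

  merge-Merge : Loopless E → Merge E merge x y
  merge-Merge irr = record
    { elsewhere  = λ { p q (mem e) → mem (trans (sym (off-off p q)) e) }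
    ; elsewhere⁻ = λ { p q (mem e) → mem (trans (off-off p q) e) }
    ; from       = λ {j} e → ∈-∪⁻ (remove-⊆ (subst (j ∈_) at-y e))
    ; from-y     = λ {j} p e → subst (j ∈_) (sym at-y) (∈--⁺ (∈-∪ˡ e) p)
    ; from-x     = λ {j} p e → subst (j ∈_) (sym at-y) (∈--⁺ (∈-∪ʳ e) p)
    ; to         = to
    ; to-y       = λ { p (mem e) → mem (trans (off-at p) (or⁺ (inj₁ e))) }
    ; to-x       = λ { p (mem e) → mem (trans (off-at p) (or⁺ (inj₂ e))) }
    ; loop-free   = loop-free
    }
    where
    loop-free : Loopless merge
    loop-free {i} e = by (i ≟ y) e
      where
      by : Dec (i ≡ y) → i ∉ merge i
      by (yes refl) e = proj₂ (∈--⁻ (subst (y ∈_) at-y e)) refl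
      by (no p) (mem e) = irr (mem (trans (sym (off-off p p)) e))
    to : ∀ {i} → y ∈ merge i → y ∈ E i ⊎ x ∈ E i
    to {i} (mem e) = by (i ≟ y)
      where
      by : Dec (i ≡ y) → y ∈ E i ⊎ x ∈ E i
      by (yes refl) = ⊥-elim (loop-free {y} (mem e))
      by (no p) with or⁻ {E i y} (trans (sym (off-at p)) e)
      ... | inj₁ a = inj₁ (mem a)
      ... | inj₂ b = inj₂ (mem b)

module _ {n : ℕ} {E E′ : Arcs n} {x y : Fin n} (M : Merge E E′ x y)
         {P : VSet n} (x∉ : x ∉ P) (y∈ : y ∈ P) where

  open Merge M

  -- The only possible new out-neighbour is y, and it stands for an out-neighbour x or y of i in
  -- `P ∪ ⁅ x ⁆`.
  merge-degree : ∀ {i} → i ≢ y → card (P ∩ E′ i) ≤ card ((P ∪ ⁅ x ⁆) ∩ E i)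
  merge-degree {i} i≢y = by (y ∈? E′ i)
    where
    same : ∀ {j} → j ∈ P ∩ E′ i → j ≢ y → j ∈ (P ∪ ⁅ x ⁆) ∩ E i
    same q j≢y = ∈-∩⁺ (∈-∪ˡ (∩-⊆ˡ q)) (elsewhere i≢y j≢y (∩-⊆ʳ q))

    lose : ∀ {z} → z ∈ (P ∪ ⁅ x ⁆) ∩ E i → z ≡ x ⊎ z ≡ y → y ∈ E′ i → card (P ∩ E′ i) ≤ card ((P ∪ ⁅ x ⁆) ∩ E i)
    lose {z} z∈ which e = subst₂ _≤_ (sym (card-remove (∈-∩⁺ y∈ e))) (sym (card-remove z∈))
      (s≤s (card-mono λ {j} q → let r , j≢y = ∈--⁻ q in ∈--⁺ (same r j≢y) (avoid which (∩-⊆ˡ r) j≢y)))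
      where
      avoid : z ≡ x ⊎ z ≡ y → ∀ {j} → j ∈ P → j ≢ y → j ≢ z
      avoid (inj₁ refl) j∈ _ refl = x∉ j∈
      avoid (inj₂ refl) _ j≢y q   = j≢y q

    by : Dec (y ∈ E′ i) → card (P ∩ E′ i) ≤ card ((P ∪ ⁅ x ⁆) ∩ E i)
    by (no ¬e) = card-mono λ {j} q → same q λ { refl → ¬e (∩-⊆ʳ q) }
    by (yes e) with to e
    ... | inj₁ a = lose (∈-∩⁺ (∈-∪ˡ y∈) a) (inj₂ refl) e
    ... | inj₂ b = lose (∈-∩⁺ (∈-∪ʳ x∈⁅x⁆) b) (inj₁ refl) e

  merge-degree-y : card (P ∩ E′ y) ≤ card (P ∩ E y) + card (P ∩ E x)
  merge-degree-y = ≤-trans (card-mono λ q → split (∩-⊆ˡ q) (from (∩-⊆ʳ q))) (card-∪-≤ (P ∩ E y) (P ∩ E x))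
    where
    split : ∀ {j} → j ∈ P → j ∈ E y ⊎ j ∈ E x → j ∈ (P ∩ E y) ∪ (P ∩ E x)
    split p (inj₁ a) = ∈-∪ˡ (∈-∩⁺ p a)
    split p (inj₂ b) = ∈-∪ʳ (∈-∩⁺ p b)

  -- The row of y after the merger is charged to the rows of y and x together, which is why x joins
  -- `P` on the right.
  merge-arcs : arcs E′ P P ≤ arcs E (P ∪ ⁅ x ⁆) (P ∪ ⁅ x ⁆)
  merge-arcs = begin
    arcs E′ P P
      ≡⟨ over-remove y∈ (λ i → card (P ∩ E′ i)) ⟩
    card (P ∩ E′ y) + over (P - y) (λ i → card (P ∩ E′ i))
      ≤⟨ +-mono-≤ merge-degree-y (over-monoʳ (P - y) (λ q → merge-degree (proj₂ (∈--⁻ q)))) ⟩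
    card (P ∩ E y) + card (P ∩ E x) + over (P - y) d
      ≤⟨ +-monoˡ-≤ _ (+-mono-≤ (wider y) (wider x)) ⟩
    d y + d x + over (P - y) d
      ≡⟨ shuffle (d y) (d x) (over (P - y) d) ⟩
    d y + over (P - y) d + d x
      ≡⟨ cong (_+ d x) (over-remove y∈ d) ⟨
    over P d + d x
      ≡⟨ over-insert x∉ d ⟨
    arcs E (P ∪ ⁅ x ⁆) (P ∪ ⁅ x ⁆) ∎
    where
    open ≤-Reasoning
    d : Fin n → ℕ
    d i = card ((P ∪ ⁅ x ⁆) ∩ E i)
    wider : ∀ i → card (P ∩ E i) ≤ d i
    wider i = card-mono λ q → ∈-∩⁺ (∈-∪ˡ (∩-⊆ˡ q)) (∩-⊆ʳ q)
    shuffle : ∀ a b c → a + b + c ≡ a + c + b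
    shuffle = solve-∀

-- Merging two vertices

module _ {n : ℕ} where

module _ {m n : ℕ} {E : Arcs n} {W : VSet n} (irr : Loopless E) (cr : Critical m E W)
         {v x y : Fin n} (v∈ : v ∈ W) (low : card (W ∩ E v) ≤ m)
         (x∈ : x ∈ W) (y∈ : y ∈ W) (vx : x ∈ E v) (vy : y ∈ E v) (x≢y : x ≢ y)
         (no-digon : ¬ (y ∈ E x × x ∈ E y)) where

  private
    E′ = merge E x y
    W′ = W - v - x
    open Merge (merge-Merge E x y irr)

    v≢x : v ≢ x
    v≢x refl = irr vx

    v≢y : v ≢ y
    v≢y refl = irr vy

    τ : Fin n → Fin n
    τ i with i ≟ x
    ... | yes _ = y
    ... | no _  = i

    τx : τ x ≡ y
    τx with x ≟ x
    ... | yes _ = refl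
    ... | no ¬p = ⊥-elim (¬p refl)

    τ-other : ∀ {i} → i ≢ x → τ i ≡ i
    τ-other {i} p with i ≟ x
    ... | yes q = ⊥-elim (p q)
    ... | no _  = refl

    τ-∈ : ∀ {i} → i ∈ W - v → τ i ∈ W′
    τ-∈ {i} p with i ≟ x
    ... | yes _ = ∈--⁺ (∈--⁺ y∈ (λ q → v≢y (sym q))) (λ q → x≢y (sym q))
    ... | no q  = ∈--⁺ p q

    τ-arc : ∀ {i j} → j ∈ E i → τ i ≢ τ j → τ j ∈ E′ (τ i)
    τ-arc {i} {j} e d = by (i ≟ x) (j ≟ x)
      where
      by : Dec (i ≡ x) → Dec (j ≡ x) → τ j ∈ E′ (τ i)
      by (yes refl) (yes refl) = ⊥-elim (d refl)
      by (yes refl) (no q) = subst₂ (λ a b → b ∈ E′ a) (sym τx) (sym (τ-other q))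
        (from-x (λ { refl → d (trans τx (sym (τ-other q))) }) e)
      by (no p) (yes refl) = subst₂ (λ a b → b ∈ E′ a) (sym (τ-other p)) (sym τx)
        (to-x (λ { refl → d (trans (τ-other p) (sym τx)) }) e)
      by (no p) (no q) = subst₂ (λ a b → b ∈ E′ a) (sym (τ-other p)) (sym (τ-other q)) (inner (i ≟ y) (j ≟ y))
        where
        inner : Dec (i ≡ y) → Dec (j ≡ y) → j ∈ E′ i
        inner (yes refl) (yes refl) = ⊥-elim (d refl)
        inner (yes refl) (no s) = from-y s e
        inner (no r) (yes refl) = to-y r e
        inner (no r) (no s) = elsewhere⁻ r s e

    -- Arcs collapsed by τ join x and y in one direction only, so they do not concatenate.
    collapsed : ∀ {i j} → i ≢ j → τ i ≡ τ j → (i ≡ x × j ≡ y) ⊎ (i ≡ y × j ≡ x)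
    collapsed {i} {j} i≢j e = by (i ≟ x) (j ≟ x)
      where
      by : Dec (i ≡ x) → Dec (j ≡ x) → (i ≡ x × j ≡ y) ⊎ (i ≡ y × j ≡ x)
      by (yes p) (yes q) = ⊥-elim (i≢j (trans p (sym q)))
      by (yes refl) (no q) = inj₁ (refl , trans (sym (τ-other q)) (trans (sym e) τx))
      by (no p) (yes refl) = inj₂ (trans (sym (τ-other p)) (trans e τx) , refl)
      by (no p) (no q) = ⊥-elim (i≢j (trans (sym (τ-other p)) (trans e (τ-other q))))

    module _ (f : Fin n → Fin m) (val : Valid E′ W′ f) where

      g : Fin n → Fin m
      g i = f (τ i)

      R = Mono E (W - v) g

      arc≢ : ∀ {i j} → R i j → i ≢ j
      arc≢ (_ , _ , e , _) refl = irr e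

      no-two : ∀ {i j k} → R i j → R j k → τ i ≡ τ j → τ j ≡ τ k → ⊥
      no-two r@(_ , _ , e , _) s@(_ , _ , e′ , _) p q with collapsed (arc≢ r) p | collapsed (arc≢ s) q
      ... | inj₁ (refl , refl) | inj₁ (refl , _)   = x≢y refl
      ... | inj₁ (refl , refl) | inj₂ (_ , refl)   = no-digon (e , e′)
      ... | inj₂ (refl , refl) | inj₁ (_ , refl)   = no-digon (e′ , e)
      ... | inj₂ (refl , refl) | inj₂ (refl , _)   = x≢y refl

      image : ∀ {i j} → R i j → τ i ≢ τ j → Mono E′ W′ f (τ i) (τ j)
      image (a , b , c , d) p = τ-∈ a , τ-∈ b , τ-arc c p , d

      -- Collapsed arcs are never consecutive, so a walk either keeps an arc under τ or is a single
      -- collapsed arc, and the latter is not closed.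
      project : ∀ {i j} → Walk R i j → Walk (Mono E′ W′ f) (τ i) (τ j) ⊎ (R i j × τ i ≡ τ j)
      project {i} {j} (step r) with τ i ≟ τ j
      ... | yes q = inj₂ (r , q)
      ... | no ¬q = inj₁ (step (image r ¬q))
      project {i} {j} (_∷ʷ_ {b = k} r w) with τ i ≟ τ k | project w
      ... | yes q | inj₁ w′      = inj₁ (subst (λ z → Walk (Mono E′ W′ f) z (τ j)) (sym q) w′)
      ... | yes q | inj₂ (s , t) = ⊥-elim (no-two r s q t)
      ... | no ¬q | inj₁ w′      = inj₁ (image r ¬q ∷ʷ w′)
      ... | no ¬q | inj₂ (s , t) = inj₁ (step (subst (Mono E′ W′ f (τ i)) t (image r ¬q)))

      g-valid : Valid E (W - v) g
      g-valid u w with project w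
      ... | inj₁ w′ = val (τ u) w′
      ... | inj₂ (r , _) = arc≢ r refl

      few : card (W ∩ E v - x) < m
      few = subst (_≤ m) (card-remove (∈-∩⁺ x∈ vx)) low

      -- x and y share a colour, so the at most m out-neighbours of v miss one.
      absurd : ⊥
      absurd with fresh (W ∩ E v - x) g few
      ... | α , new = proj₁ cr (_ , Valid-extend irr g-valid (inj₁ avoid))
        where
        avoid : ∀ {j} → j ∈ W → j ∈ E v → g j ≢ α
        avoid {j} j∈ e = by (j ≟ x)
          where
          y≢x : y ≢ x
          y≢x q = x≢y (sym q)
          by : Dec (j ≡ x) → g j ≢ α
          by (no p)     = new (∈--⁺ (∈-∩⁺ j∈ e) p)
          by (yes refl) q = new (∈--⁺ (∈-∩⁺ y∈ vy) y≢x) (trans (cong f (trans (τ-other y≢x) (sym τx))) q)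

  -- A dicolouring of the merged `W - v - x` would lift to `W - v` by giving x the colour of y, and
  -- then extend to v. The critical set contains y, since otherwise it would be an unaltered part of
  -- `W - v`.
  merge-critical : ¬ ¬ Σ (VSet n) λ P → P ⊆ W × v ∉ P × x ∉ P × y ∈ P × Critical m (merge E x y) P
  merge-critical k = exists-critical E′ W′ (λ (f , val) → absurd f val) λ (P , s , crP) →
    k (P , (λ p → remove-⊆ (remove-⊆ (s p))) ,
       (λ p → proj₂ (∈--⁻ (remove-⊆ (s p))) refl) , (λ p → proj₂ (∈--⁻ (s p)) refl) ,
       y∈P P s crP , crP)
    where
    y∈P : (P : VSet n) → P ⊆ W′ → Critical m E′ P → y ∈ P
    y∈P P s crP with y ∈? P
    ... | yes p = p
    ... | no ¬p = ⊥-elim (proj₂ cr v∈ λ c → proj₁ crP (proj₁ c ,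
        Valid-⊆ (λ p → remove-⊆ (s p))
          (λ i∈ j∈ → elsewhere (λ { refl → ¬p i∈ }) (λ { refl → ¬p j∈ })) (proj₂ c)))

-- The induced subdigraph E[W] is in 𝒟_{m+1}; cl assigns to each vertex its part in the blown up C₅.
record Shape (m : ℕ) {n : ℕ} (E : Arcs n) (W : VSet n) : Set where
  field
    cl     : Fin n → Fin 5
    t      : ℕ
    1≤t    : 1 ≤ t
    t≤     : t ≤ suc m ∸ 2
    sizes  : ∀ c → card (W ∩ (λ i → ⁅ cl i ⁆ c)) ≡ Dsizes (suc m) t c
    arc⁺   : ∀ {i j} → i ∈ W → j ∈ W → j ∈ E i → (cl i ≡ cl j × i ≢ j) ⊎ C5arc (cl i) (cl j)
    arc⁻   : ∀ {i j} → i ∈ W → j ∈ W → (cl i ≡ cl j × i ≢ j) ⊎ C5arc (cl i) (cl j) → j ∈ E i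

record SubClique (m : ℕ) {n : ℕ} (E : Arcs n) (W : VSet n) : Set where
  field
    K      : VSet n
    K⊆     : K ⊆ W
    size   : card K ≡ m
    clique : Clique E K

-- Besides membership in 𝒟_{m+1} it holds the two facts that the induction consumes: `excess` rules
-- this case out when at most m |P| arcs are available, and `avoiding` provides an m-clique
-- untouched by a merger into a.
record Spindle (m : ℕ) {n : ℕ} (E : Arcs n) (W : VSet n) : Set where
  field
    shape    : Shape m E W
    excess   : m * card W < arcs E W W
    avoiding : ∀ a → Σ (SubClique m E W) λ C → a ∉ SubClique.K C

Conclusion : ℕ → ∀ {n} → Arcs n → VSet n → Set
Conclusion m E W = (card W ≡ suc m × Clique E W) ⊎ Spindle m E W

-- The arcs vary while the vertex type stays fixed, because the hypothesis is applied after merging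
-- vertices or adding a digon.
Smaller : ℕ → ∀ {n} → VSet n → Set
Smaller m {n} W = ∀ (E : Arcs n) (P : VSet n) → card P < card W → Loopless E → Critical m E P → Sparse m E P →
                  ¬ ¬ Conclusion m E P

-- Existence of a clique of size m

module _ {m n : ℕ} {E : Arcs n} {W : VSet n} (3≤m : 3 ≤ m) (irr : Loopless E) (cr : Critical m E W)
         (sp : Sparse m E W) (ih : Smaller m W) where

  clique-exists : ¬ ¬ SubClique m E W
  clique-exists k = ¬¬-excluded-middle {A = ∃ λ x → ∃ λ y → x ∈ N × y ∈ N × x ≢ y × ¬ (y ∈ E x × x ∈ E y)} λ
    { (no none) → k (record
        { K = N ; K⊆ = ∩-⊆ˡ ; size = ≤-antisym low (min-degree irr cr v∈)
        ; clique = λ {i} {j} a b i≢j → clique-at none i j a b i≢j })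
    ; (yes (x , y , x∈ , y∈ , x≢y , nd)) →
        merge-critical irr cr v∈ low (∩-⊆ˡ x∈) (∩-⊆ˡ y∈) (∩-⊆ʳ x∈) (∩-⊆ʳ y∈) x≢y nd
          λ (P , P⊆ , v∉ , x∉ , y∈P , crP) → merged x y (∩-⊆ˡ x∈) x≢y (∩-⊆ʳ x∈) P P⊆ v∉ x∉ y∈P crP }
    where
    u∃ = critical-nonempty (≤-trans (s≤s z≤n) 3≤m) cr
    v∃ = low-exists irr cr sp {A = W} (λ a → a)
           (≤-trans (≤-trans (min-degree irr cr (proj₂ u∃)) (card-mono ∩-⊆ˡ)) (n≤1+n (card W)))
    v = proj₁ v∃
    v∈ = proj₁ (proj₂ v∃)
    low = proj₂ (proj₂ v∃)
    N = W ∩ E v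

    clique-at : ¬ (∃ λ x → ∃ λ y → x ∈ N × y ∈ N × x ≢ y × ¬ (y ∈ E x × x ∈ E y)) →
                ∀ i j → i ∈ N → j ∈ N → i ≢ j → j ∈ E i
    clique-at none i j a b i≢j with j ∈? E i
    ... | yes e = e
    ... | no ¬e = ⊥-elim (none (i , j , a , b , i≢j , λ (e , _) → ¬e e))

    merged : ∀ x y → x ∈ W → x ≢ y → x ∈ E v → (P : VSet n) → P ⊆ W → v ∉ P → x ∉ P → y ∈ P →
             Critical m (merge E x y) P → ⊥
    merged x y x∈ x≢y vx P P⊆ v∉ x∉ y∈P crP =
      ih (merge E x y) P (card-< P⊆ v∈ v∉) M.loop-free crP sparse λ
        { (inj₁ (c , cl)) → k (record
            { K = P - y ; K⊆ = λ p → P⊆ (remove-⊆ p)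
            ; size = suc-injective (trans (sym (card-remove y∈P)) c)
            ; clique = λ a b i≢j → M.elsewhere (proj₂ (∈--⁻ a)) (proj₂ (∈--⁻ b)) (cl (remove-⊆ a) (remove-⊆ b) i≢j) })
        ; (inj₂ spindle) → let C , y∉ = Spindle.avoiding spindle y in k (record
            { K = SubClique.K C ; K⊆ = λ p → P⊆ (SubClique.K⊆ C p) ; size = SubClique.size C
            ; clique = λ a b i≢j → M.elsewhere (λ { refl → y∉ a }) (λ { refl → y∉ b }) (SubClique.clique C a b i≢j) }) }
      where
      module M = Merge (merge-Merge E x y irr)
      Px = P ∪ ⁅ x ⁆
      v∉Px : v ∉ Px
      v∉Px p with ∈-∪⁻ p
      ... | inj₁ a = v∉ a
      ... | inj₂ b = irr (subst (_∈ E v) (sym (∈⁅⁆⇒≡ b)) vx)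
      -- Counting x back in turns the bound m |P ∪ {x}| of `part-sparse` into m |P| + m; v witnesses
      -- that `Px` is a proper part.
      sparse : Sparse m (merge E x y) P
      sparse = begin
        arcs (merge E x y) P P + 2 ≤⟨ +-monoˡ-≤ 2 (merge-arcs (merge-Merge E x y irr) x∉ y∈P) ⟩
        arcs E Px Px + 2           ≤⟨ part-sparse irr cr sp (∪-⊆ P⊆ (⁅⁆-⊆ x∈)) (∈-∪ˡ y∈P) v∈ v∉Px ⟩
        m * card Px                ≡⟨ cong (m *_) (card-insert x∉) ⟩
        m * suc (card P)           ≡⟨ trans (*-suc m (card P)) (+-comm m (m * card P)) ⟩
        m * card P + m             ∎
        where open ≤-Reasoning

-- Adding a digon

module _ {n : ℕ} where

module _ {n : ℕ} (E : Arcs n) (y y′ : Fin n) where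

  add-digon : Arcs n
  add-digon i = E i ∪ λ j → (⁅ y ⁆ i ∧ ⁅ y′ ⁆ j) ∨ (⁅ y′ ⁆ i ∧ ⁅ y ⁆ j)

  private
    ∧-true : ∀ {a b} → a ∧ b ≡ true → a ≡ true × b ≡ true
    ∧-true {true} p = refl , p

    ∨-true : ∀ {a b} → a ∨ b ≡ true → a ≡ true ⊎ b ≡ true
    ∨-true {true}  _ = inj₁ refl
    ∨-true {false} p = inj₂ p

  add-digon-new : y′ ∈ add-digon y
  add-digon-new = ∈-∪ʳ (mem (trans (cong₂ (λ a b → (a ∧ b) ∨ (⁅ y′ ⁆ y ∧ ⁅ y ⁆ y′)) (∈⇒true {A = ⁅ y ⁆} x∈⁅x⁆) (∈⇒true {A = ⁅ y′ ⁆} x∈⁅x⁆)) refl))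

  add-digon-new′ : y ∈ add-digon y′
  add-digon-new′ = ∈-∪ʳ (mem (trans (cong₂ (λ a b → (⁅ y ⁆ y′ ∧ ⁅ y′ ⁆ y) ∨ (a ∧ b)) (∈⇒true {A = ⁅ y′ ⁆} x∈⁅x⁆) (∈⇒true {A = ⁅ y ⁆} x∈⁅x⁆)) (∨-zeroʳ _)))

  add-digon⁻ : ∀ {i j} → j ∈ add-digon i → j ∈ E i ⊎ (i ≡ y × j ≡ y′) ⊎ (i ≡ y′ × j ≡ y)
  add-digon⁻ {i} {j} e with ∈-∪⁻ e
  ... | inj₁ a = inj₁ a
  ... | inj₂ (mem b) with ∨-true b
  ...   | inj₁ c = let p , q = ∧-true c in inj₂ (inj₁ (∈⁅⁆⇒≡ (mem p) , ∈⁅⁆⇒≡ (mem q)))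
  ...   | inj₂ c = let p , q = ∧-true c in inj₂ (inj₂ (∈⁅⁆⇒≡ (mem p) , ∈⁅⁆⇒≡ (mem q)))

  add-digon-other : ∀ {i} → i ≢ y → i ≢ y′ → add-digon i ⊆ E i
  add-digon-other p q e with add-digon⁻ e
  ... | inj₁ a              = a
  ... | inj₂ (inj₁ (r , _)) = ⊥-elim (p r)
  ... | inj₂ (inj₂ (r , _)) = ⊥-elim (q r)

  add-digon-loopless : Loopless E → y ≢ y′ → Loopless add-digon
  add-digon-loopless irr d e with add-digon⁻ e
  ... | inj₁ a                 = irr a
  ... | inj₂ (inj₁ (p , q))    = d (trans (sym p) q)
  ... | inj₂ (inj₂ (p , q))    = d (trans (sym q) p)

  module _ (y≢y′ : y ≢ y′) {P : VSet n} where

    add-digon-row : card (P ∩ add-digon y) ≤ card (P ∩ E y) + 1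
    add-digon-row = ≤-trans (card-mono sub) (≤-trans (card-∪-≤ (P ∩ E y) ⁅ y′ ⁆)
      (≤-reflexive (cong (card (P ∩ E y) +_) (over-⁅⁆ y′ (λ _ → 1)))))
      where
      sub : P ∩ add-digon y ⊆ (P ∩ E y) ∪ ⁅ y′ ⁆
      sub p with add-digon⁻ (∩-⊆ʳ p)
      ... | inj₁ a                 = ∈-∪ˡ (∈-∩⁺ (∩-⊆ˡ p) a)
      ... | inj₂ (inj₁ (_ , refl)) = ∈-∪ʳ x∈⁅x⁆
      ... | inj₂ (inj₂ (q , _))    = ⊥-elim (y≢y′ q)

    add-digon-row′ : card (P ∩ add-digon y′) ≤ card (P ∩ E y′) + 1
    add-digon-row′ = ≤-trans (card-mono sub) (≤-trans (card-∪-≤ (P ∩ E y′) ⁅ y ⁆)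
      (≤-reflexive (cong (card (P ∩ E y′) +_) (over-⁅⁆ y (λ _ → 1)))))
      where
      sub : P ∩ add-digon y′ ⊆ (P ∩ E y′) ∪ ⁅ y ⁆
      sub p with add-digon⁻ (∩-⊆ʳ p)
      ... | inj₁ a                 = ∈-∪ˡ (∈-∩⁺ (∩-⊆ˡ p) a)
      ... | inj₂ (inj₁ (q , _))    = ⊥-elim (y≢y′ (sym q))
      ... | inj₂ (inj₂ (_ , refl)) = ∈-∪ʳ x∈⁅x⁆

    -- An arc already present lowers the number of arcs gained by the digon; this will contradict
    -- the count and show that both arcs were missing.
    add-digon-row-present : y′ ∈ E y → card (P ∩ add-digon y) ≤ card (P ∩ E y) + 0
    add-digon-row-present e = ≤-trans (card-mono sub) (≤-reflexive (sym (+-identityʳ _)))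
      where
      sub : P ∩ add-digon y ⊆ P ∩ E y
      sub p with add-digon⁻ (∩-⊆ʳ p)
      ... | inj₁ a                 = ∈-∩⁺ (∩-⊆ˡ p) a
      ... | inj₂ (inj₁ (_ , refl)) = ∈-∩⁺ (∩-⊆ˡ p) e
      ... | inj₂ (inj₂ (q , _))    = ⊥-elim (y≢y′ q)

    add-digon-row-present′ : y ∈ E y′ → card (P ∩ add-digon y′) ≤ card (P ∩ E y′) + 0
    add-digon-row-present′ e = ≤-trans (card-mono sub) (≤-reflexive (sym (+-identityʳ _)))
      where
      sub : P ∩ add-digon y′ ⊆ P ∩ E y′
      sub p with add-digon⁻ (∩-⊆ʳ p)
      ... | inj₁ a                 = ∈-∩⁺ (∩-⊆ˡ p) a
      ... | inj₂ (inj₁ (q , _))    = ⊥-elim (y≢y′ (sym q))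
      ... | inj₂ (inj₂ (_ , refl)) = ∈-∩⁺ (∩-⊆ˡ p) e

    add-digon-arcs : y ∈ P → y′ ∈ P → ∀ {c c′} → card (P ∩ add-digon y) ≤ card (P ∩ E y) + c →
                     card (P ∩ add-digon y′) ≤ card (P ∩ E y′) + c′ →
                     arcs add-digon P P ≤ arcs E P P + (c + c′)
    add-digon-arcs y∈ y′∈ {c} {c′} h h′ = begin
      over P d⁺                                   ≡⟨ unfold d⁺ ⟩
      d⁺ y + (d⁺ y′ + over P′ d⁺)                 ≤⟨ +-mono-≤ h (+-mono-≤ h′ (over-monoʳ P′ λ q →
                                                       card-mono λ p → ∈-∩⁺ (∩-⊆ˡ p) (add-digon-other (proj₂ (∈--⁻ (remove-⊆ q))) (proj₂ (∈--⁻ q)) (∩-⊆ʳ p)))) ⟩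
      d y + c + (d y′ + c′ + over P′ d)           ≡⟨ shuffle (d y) c (d y′) c′ (over P′ d) ⟩
      d y + (d y′ + over P′ d) + (c + c′)         ≡⟨ cong (_+ (c + c′)) (unfold d) ⟨
      over P d + (c + c′)                         ∎
      where
      open ≤-Reasoning
      d d⁺ : Fin n → ℕ
      d i = card (P ∩ E i)
      d⁺ i = card (P ∩ add-digon i)
      P′ = P - y - y′
      unfold : ∀ f → over P f ≡ f y + (f y′ + over P′ f)
      unfold f = trans (over-remove y∈ f) (cong (f y +_) (over-remove (∈--⁺ y′∈ (λ q → y≢y′ (sym q))) f))
      shuffle : ∀ a b c d e → a + b + (c + d + e) ≡ a + (c + e) + (b + d)
      shuffle = solve-∀

-- Only the absence of other neighbours is recorded, since that is what colouring x requires; the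
-- arc itself then follows from the degree bound in `attached-arc`.
record Attached {n : ℕ} (E : Arcs n) (W K : VSet n) (x y : Fin n) : Set where
  field
    x∈K  : x ∈ K
    y∈W  : y ∈ W
    y∉K  : y ∉ K
    only : (∀ {j} → j ∈ W → j ∈ E x → j ∈ K ⊎ j ≡ y) ⊎ (∀ {j} → j ∈ W → x ∈ E j → j ∈ K ⊎ j ≡ y)

record Link (m : ℕ) {n : ℕ} (E : Arcs n) (W K : VSet n) (y y′ : Fin n) : Set where
  field
    P        : VSet n
    P⊆W      : P ⊆ W
    y∈P      : y ∈ P
    y′∈P     : y′ ∈ P
    disjoint : ∀ {i} → i ∈ K → i ∉ P
    size     : card P ≡ suc m
    adjacent : ∀ {i j} → i ∈ P → j ∈ P → i ≢ j → ¬ (i ≡ y × j ≡ y′) → ¬ (i ≡ y′ × j ≡ y) → j ∈ E i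
    no-arc   : y′ ∉ E y
    no-arc′  : y ∉ E y′
    tight    : m * card P ≤ arcs E P P + 2
    exits    : arcs E P (W ∖ P) ≤ m
    leaves   : 1 ≤ card ((W ∖ P) ∩ E y)
    leaves′  : 1 ≤ card ((W ∖ P) ∩ E y′)
    low      : ∀ {i} → i ∈ W → i ∉ P → card (W ∩ E i) ≤ m
    low⁻     : ∀ {i} → i ∈ W → i ∉ P → card (W ∩ flip E i) ≤ m

module _ {m n : ℕ} {E : Arcs n} {W : VSet n} (3≤m : 3 ≤ m) (irr : Loopless E) (cr : Critical m E W)
         (sp : Sparse m E W) (ih : Smaller m W) (C : SubClique m E W) where

  open SubClique C

  private
    card-K- : ∀ {x} → x ∈ K → card (K - x) < m
    card-K- x∈ = ≤-reflexive (trans (sym (card-remove x∈)) size)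

  module _ {x x′ y y′ : Fin n} (at : Attached E W K x y) (at′ : Attached E W K x′ y′) (y≢y′ : y ≢ y′) where

    private
      open Attached at using (x∈K; y∈W; y∉K)
      open Attached at′ using () renaming (x∈K to x′∈K; y∈W to y′∈W; y∉K to y′∉K)
      E⁺ = add-digon E y y′
      W′ = W - x - x′

      K∌ : ∀ {i z} → i ∈ K → z ∉ K → z ≢ i
      K∌ i∈ z∉ refl = z∉ i∈

      y∈W′ : y ∈ W′
      y∈W′ = ∈--⁺ (∈--⁺ y∈W (K∌ x∈K y∉K)) (K∌ x′∈K y∉K)

      y′∈W′ : y′ ∈ W′
      y′∈W′ = ∈--⁺ (∈--⁺ y′∈W (K∌ x∈K y′∉K)) (K∌ x′∈K y′∉K)

      attach-colour : ∀ {A u z α} {f : Fin n → Fin m} → Attached E W K u z → A ⊆ W → Valid E (A - u) f →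
                      (∀ {q} → q ∈ K → q ∈ A → q ≢ u → f q ≢ α) → f z ≢ α →
                      Valid E A (updateAt f u (const α))
      attach-colour {A} {u} {z} {α} {f} a s val new new-z = Valid-extend irr val (free (Attached.only a))
        where
        by : ∀ {j} → j ∈ A → j ≢ u → j ∈ K ⊎ j ≡ z → f j ≢ α
        by j∈ j≢u (inj₁ j∈K) = new j∈K j∈ j≢u
        by j∈ j≢u (inj₂ refl) = new-z

        free : _ ⊎ _ → (∀ {j} → j ∈ A → j ∈ E u → f j ≢ α) ⊎ (∀ {j} → j ∈ A → u ∈ E j → f j ≢ α)
        free (inj₁ o) = inj₁ λ j∈ e → by j∈ (λ { refl → irr e }) (o (s j∈) e)
        free (inj₂ o) = inj₂ λ j∈ e → by j∈ (λ { refl → irr e }) (o (s j∈) e)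

    -- The digon forces different colours on y and y′, and this suffices to colour the deleted
    -- vertices of `K` again.
    no-colouring : ¬ Colourable m E⁺ W′
    no-colouring (f , val⁺) = by (x ≟ x′)
      where
      val : Valid E W′ f
      val = Valid-⊆ (λ a → a) (λ _ _ → ∈-∪ˡ) val⁺

      fy≢fy′ : f y ≢ f y′
      fy≢fy′ = Valid-digon val⁺ y∈W′ y′∈W′ (add-digon-new E y y′) (add-digon-new′ E y y′)

      by : Dec (x ≡ x′) → ⊥
      by (yes refl) with fresh (K - x) f (card-K- x∈K)
      ... | α , new = try (f y ≟ α)
        where
        val-x : Valid E (W - x) f
        val-x = Valid-⊆ (λ a → ∈--⁺ a (proj₂ (∈--⁻ a))) (λ _ _ e → e) val
        new-K : ∀ {q} → q ∈ K → q ∈ W → q ≢ x → f q ≢ α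
        new-K q∈ _ q≢ = new (∈--⁺ q∈ q≢)
        -- Both attachments are at x. The colour α missing on `K - x` differs from `f y` or from
        -- `f y′`, and x takes it through the corresponding attachment.
        try : Dec (f y ≡ α) → ⊥
        try (no p)  = proj₁ cr (_ , attach-colour at (λ a → a) val-x new-K p)
        try (yes p) = proj₁ cr (_ , attach-colour at′ (λ a → a) val-x new-K λ q → fy≢fy′ (trans p (sym q)))
      by (no x≢x′) = try (any? λ c → (c ∈? K - x - x′) ×-dec (f c ≟ f y′))
        where
        x′≢x : x′ ≢ x
        x′≢x p = x≢x′ (sym p)

        module _ {α} (new : ∀ {q} → q ∈ K - x - x′ → f q ≢ α) (new-y : f y ≢ α) where

          f₁ : Fin n → Fin m
          f₁ = updateAt f x (const α)

          val₁ : Valid E (W - x′) f₁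
          val₁ = attach-colour at remove-⊆
            (Valid-⊆ (λ a → let b , p = ∈--⁻ a ; c , q = ∈--⁻ b in ∈--⁺ (∈--⁺ c p) q) (λ _ _ e → e) val)
            (λ q∈ q∈′ q≢ → new (∈--⁺ (∈--⁺ q∈ q≢) (proj₂ (∈--⁻ q∈′)))) new-y

          -- Once the colour of y′ occurs in `K - x′`, any colour β missing there differs from it,
          -- so x′ can take β.
          finish : ∀ {c} → c ∈ K - x′ → f₁ c ≡ f y′ → ⊥
          finish {c} c∈ e with fresh (K - x′) f₁ (card-K- x′∈K)
          ... | β , new₁ = proj₁ cr (_ , attach-colour at′ (λ a → a) val₁ (λ q∈ _ q≢ → new₁ (∈--⁺ q∈ q≢))
                  λ p → new₁ c∈ (trans e (trans (sym (updateAt-minimal y′ x f (K∌ x∈K y′∉K))) p)))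

        try : Dec (∃ λ c → c ∈ K - x - x′ × f c ≡ f y′) → ⊥
        -- The colour of y′ is missing from the rest of the clique, so x itself takes it; y has
        -- another colour.
        try (no none) = finish (λ q∈ e → none (_ , q∈ , e)) fy≢fy′ (∈--⁺ x∈K x≢x′) (updateAt-updates x f)
        -- The colour of y′ already occurs; x takes a colour missing from the m - 1 vertices of
        -- `K - x - x′` and y.
        try (yes (c , c∈ , e)) with fresh ((K - x - x′) ∪ ⁅ y ⁆) f (≤-trans (s≤s few) (card-K- x∈K))
          where
          few : card ((K - x - x′) ∪ ⁅ y ⁆) ≤ card (K - x)
          few = ≤-reflexive (trans (card-insert (λ q → y∉K (remove-⊆ (remove-⊆ q)))) (sym (card-remove (∈--⁺ x′∈K x′≢x))))
        ... | α , new = finish (λ q∈ → new (∈-∪ˡ q∈)) (new (∈-∪ʳ x∈⁅x⁆))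
                          (let d , p = ∈--⁻ c∈ in ∈--⁺ (remove-⊆ d) p)
                          (trans (updateAt-minimal c x f (proj₂ (∈--⁻ (remove-⊆ c∈)))) e)

    private
      y-in : (P : VSet n) → P ⊆ W′ → Critical m E⁺ P → y ∈ P × y′ ∈ P
      y-in P s crP = by (y ∈? P) (y′ ∈? P)
        where
        absurd : (∀ {i j} → i ∈ P → j ∈ P → j ∈ E⁺ i → j ∈ E i) → ⊥
        absurd sub = proj₂ cr (K⊆ x∈K) λ (f , val) →
          proj₁ crP (f , Valid-⊆ (λ p → remove-⊆ (s p)) sub val)
        by : Dec (y ∈ P) → Dec (y′ ∈ P) → y ∈ P × y′ ∈ P
        by (yes p) (yes q) = p , q
        by (no ¬p) _ = ⊥-elim (absurd λ i∈ j∈ e → pick i∈ j∈ (add-digon⁻ E y y′ e))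
          where
          pick : ∀ {i j} → i ∈ P → j ∈ P → j ∈ E i ⊎ (i ≡ y × j ≡ y′) ⊎ (i ≡ y′ × j ≡ y) → j ∈ E i
          pick _ _ (inj₁ a) = a
          pick i∈ _ (inj₂ (inj₁ (refl , _))) = ⊥-elim (¬p i∈)
          pick _ j∈ (inj₂ (inj₂ (_ , refl))) = ⊥-elim (¬p j∈)
        by _ (no ¬p) = ⊥-elim (absurd λ i∈ j∈ e → pick i∈ j∈ (add-digon⁻ E y y′ e))
          where
          pick : ∀ {i j} → i ∈ P → j ∈ P → j ∈ E i ⊎ (i ≡ y × j ≡ y′) ⊎ (i ≡ y′ × j ≡ y) → j ∈ E i
          pick _ _ (inj₁ a) = a
          pick _ j∈ (inj₂ (inj₁ (_ , refl))) = ⊥-elim (¬p j∈)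
          pick i∈ _ (inj₂ (inj₂ (refl , _))) = ⊥-elim (¬p i∈)

      irr⁺ : Loopless E⁺
      irr⁺ = add-digon-loopless E y y′ irr y≢y′

      module _ {P : VSet n} (s : P ⊆ W′) (crP : Critical m E⁺ P) where

        P⊆W : P ⊆ W
        P⊆W p = remove-⊆ (remove-⊆ (s p))

        y∈P : y ∈ P
        y∈P = proj₁ (y-in P s crP)

        y′∈P : y′ ∈ P
        y′∈P = proj₂ (y-in P s crP)

        x∉P : x ∉ P
        x∉P p = proj₂ (∈--⁻ (remove-⊆ (s p))) refl

        bound : arcs E P P + 2 ≤ m * card P
        bound = part-sparse irr cr sp P⊆W y∈P (K⊆ x∈K) x∉P

        bound⁺ : arcs E⁺ P P ≤ arcs E P P + 2
        bound⁺ = add-digon-arcs E y y′ y≢y′ y∈P y′∈P (add-digon-row E y y′ y≢y′) (add-digon-row′ E y y′ y≢y′)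

        degrees : m * card P ≤ arcs E⁺ P P
        degrees = rows-≥ irr⁺ crP (λ p → p)

        sparse⁺ : Sparse m E⁺ P
        sparse⁺ = +-mono-≤ (≤-trans bound⁺ bound) (≤-trans (n≤1+n 2) 3≤m)

        -- Between `bound` and `degrees` the digon has to supply two arcs, so neither of them can
        -- have been present before.
        one-short : ∀ {c} → arcs E⁺ P P ≤ arcs E P P + c → 2 ≤ c
        one-short {c} h = +-cancelˡ-≤ (arcs E P P) 2 c (≤-trans bound (≤-trans degrees h))

        module _ (c : card P ≡ suc m) (cl : Clique E⁺ P) where

          no-arc : y′ ∉ E y
          no-arc e = 1+n≰n (one-short (add-digon-arcs E y y′ y≢y′ y∈P y′∈P
            (add-digon-row-present E y y′ y≢y′ e) (add-digon-row′ E y y′ y≢y′)))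

          no-arc′ : y ∉ E y′
          no-arc′ e = 1+n≰n (one-short (add-digon-arcs E y y′ y≢y′ y∈P y′∈P
            (add-digon-row E y y′ y≢y′) (add-digon-row-present′ E y y′ y≢y′ e)))

          adjacent : ∀ {i j} → i ∈ P → j ∈ P → i ≢ j → ¬ (i ≡ y × j ≡ y′) → ¬ (i ≡ y′ × j ≡ y) → j ∈ E i
          adjacent a b i≢j p q with add-digon⁻ E y y′ (cl a b i≢j)
          ... | inj₁ e        = e
          ... | inj₂ (inj₁ r) = ⊥-elim (p r)
          ... | inj₂ (inj₂ r) = ⊥-elim (q r)

          tight : m * card P ≤ arcs E P P + 2
          tight = ≤-trans degrees bound⁺

          exits : arcs E P (W ∖ P) ≤ m
          exits = tight-cut irr cr sp P⊆W y∈P (K⊆ x∈K) x∉P tight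

          -- Without z′ only m - 1 vertices of `P` can be out-neighbours of z, and its out-degree is
          -- at least m.
          leaves-P : ∀ {z z′} → z ∈ P → z′ ∈ P → z ≢ z′ → z′ ∉ E z → 1 ≤ card ((W ∖ P) ∩ E z)
          leaves-P {z} {z′} z∈ z′∈ z≢z′ ¬e = +-cancelˡ-≤ (card (P - z - z′)) 1 _ (begin
            card (P - z - z′) + 1                              ≡⟨ trans (+-comm _ 1) few ⟩
            m                                                  ≤⟨ min-degree irr cr (P⊆W z∈) ⟩
            card (W ∩ E z)                                     ≡⟨ over-split (W ∩ E z) P (λ _ → 1) ⟩
            card ((W ∩ E z) ∩ P) + card ((W ∩ E z) ∖ P)        ≤⟨ +-mono-≤ (card-mono inside) (card-mono outside) ⟩
            card (P - z - z′) + card ((W ∖ P) ∩ E z)           ∎)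
            where
            open ≤-Reasoning
            few : suc (card (P - z - z′)) ≡ m
            few = suc-injective (trans (cong suc (sym (card-remove (∈--⁺ z′∈ (λ q → z≢z′ (sym q)))))) (trans (sym (card-remove z∈)) c))
            inside : (W ∩ E z) ∩ P ⊆ P - z - z′
            inside p = ∈--⁺ (∈--⁺ (∩-⊆ʳ p) (λ { refl → irr (∩-⊆ʳ (∩-⊆ˡ p)) })) (λ { refl → ¬e (∩-⊆ʳ (∩-⊆ˡ p)) })
            outside : (W ∩ E z) ∖ P ⊆ (W ∖ P) ∩ E z
            outside p with ∈-∖⁻ p
            ... | q , r = ∈-∩⁺ (∈-∖⁺ (∩-⊆ˡ q) r) (∩-⊆ʳ q)

          -- If `K` met `P`, the arcs from its a vertices inside to its b vertices outside would
          -- number a b ≥ m - 1. As y and y′ lie outside `K` and send one more arc each, m + 1 arcs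
          -- would leave `P`, against `exits`.
          disjoint : ∀ {q} → q ∈ K → q ∉ P
          disjoint {q} q∈K q∈P = 1+n≰n (begin
            suc m                              ≡⟨ cong suc (trans (sym size) (over-split K P (λ _ → 1))) ⟩
            suc (a + b)                        ≤⟨ s≤s (product-≥ (card-≥1 (∈-∩⁺ q∈K q∈P)) (card-≥1 (∈-∖⁺ x∈K x∉P))) ⟩
            1 + (1 + a * b)                    ≤⟨ +-mono-≤ (leaves-P y∈P y′∈P y≢y′ no-arc)
                                                    (+-mono-≤ (leaves-P y′∈P y∈P (λ r → y≢y′ (sym r)) no-arc′)
                                                      (≤-trans (over-lower row) (over-mono sub (λ _ → ≤-refl)))) ⟩
            d y + (d y′ + over (P - y - y′) d) ≡⟨ cong (d y +_) (over-remove (∈--⁺ y′∈P (λ r → y≢y′ (sym r))) d) ⟨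
            d y + over (P - y) d               ≡⟨ over-remove y∈P d ⟨
            arcs E P (W ∖ P)                   ≤⟨ exits ⟩
            m                                  ∎)
            where
            open ≤-Reasoning
            a b : ℕ
            a = card (K ∩ P)
            b = card (K ∖ P)
            d : Fin n → ℕ
            d i = card ((W ∖ P) ∩ E i)
            row : ∀ {i} → i ∈ K ∩ P → b ≤ d i
            row {i} i∈ = card-mono λ {j} j∈ → let j∈K , j∉P = ∈-∖⁻ j∈ in
              ∈-∩⁺ (∈-∖⁺ (K⊆ j∈K) j∉P) (clique (∩-⊆ˡ i∈) j∈K (λ { refl → j∉P (∩-⊆ʳ i∈) }))
            sub : K ∩ P ⊆ P - y - y′
            sub i∈ = ∈--⁺ (∈--⁺ (∩-⊆ʳ i∈) (λ { refl → y∉K (∩-⊆ˡ i∈) })) (λ { refl → y′∉K (∩-⊆ˡ i∈) })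

          link : Link m E W K y y′
          link = record
            { P = P ; P⊆W = P⊆W ; y∈P = y∈P ; y′∈P = y′∈P ; disjoint = disjoint ; size = c
            ; adjacent = adjacent ; no-arc = no-arc ; no-arc′ = no-arc′ ; tight = tight ; exits = exits
            ; leaves  = leaves-P y∈P y′∈P y≢y′ no-arc
            ; leaves′ = leaves-P y′∈P y∈P (λ r → y≢y′ (sym r)) no-arc′
            ; low  = tight-rest irr cr sp P⊆W y∈P (K⊆ x∈K) x∉P tight
            ; low⁻ = tight-rest (Loopless-flip {E = E} irr) (Critical-flip cr) (Sparse-flip {m = m} {E = E} {W = W} sp) P⊆W y∈P (K⊆ x∈K) x∉P
                       (subst (λ e → m * card P ≤ e + 2) (sym (arcs-flip E P P)) tight)
            }

    link-exists : ¬ ¬ Link m E W K y y′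
    link-exists k = exists-critical E⁺ W′ no-colouring λ (P , s , crP) →
      ih E⁺ P (card-< (P⊆W s crP) (K⊆ x∈K) (x∉P s crP)) irr⁺ crP (sparse⁺ s crP) λ
        { (inj₁ (c , cl)) → k (link s crP c cl)
        -- A spindle has more than m |P| arcs, but even with the digon `P` spans at most m |P|.
        ; (inj₂ spindle) → <⇒≱ (Spindle.excess spindle) (≤-trans (bound⁺ s crP) (bound s crP)) }

-- Recognising 𝒟_k

module _ {n : ℕ} where

walk-increasing : ∀ {V : Set} {R : V → V → Set} (rank : V → ℕ) → (∀ {a b} → R a b → rank a < rank b) →
                  ∀ {a b} → Walk R a b → rank a < rank b
walk-increasing rank h (step r)  = h r
walk-increasing rank h (r ∷ʷ w) = <-trans (h r) (walk-increasing rank h w)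

SubClique-flip : ∀ {m n} {E : Arcs n} {W : VSet n} → SubClique m E W → SubClique m (flip E) W
SubClique-flip {E = E} C = record
  { K = K ; K⊆ = K⊆ ; size = size ; clique = λ a b i≢j → ∈-flip {E = E} (clique b a (λ q → i≢j (sym q))) }
  where open SubClique C

module _ {m n : ℕ} {E : Arcs n} {W : VSet n} (irr : Loopless E) (cr : Critical m E W) (C : SubClique m E W) where

  open SubClique C

  inside-degree : ∀ {x} → x ∈ K → card ((W ∩ E x) ∩ K) ≡ card (K - x)
  inside-degree x∈ = ≤-antisym
    (card-mono λ p → ∈--⁺ (∩-⊆ʳ p) (λ { refl → irr (∩-⊆ʳ (∩-⊆ˡ p)) }))
    (card-mono λ p → let q , i≢x = ∈--⁻ p in
      ∈-∩⁺ (∈-∩⁺ (K⊆ q) (clique x∈ q (λ r → i≢x (sym r)))) q)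

  degree-split : ∀ {x} → x ∈ K → suc (card (W ∩ E x)) ≡ m + card ((W ∩ E x) ∖ K)
  degree-split {x} x∈ = begin
    suc (card (W ∩ E x))                                   ≡⟨ cong suc (over-split (W ∩ E x) K (λ _ → 1)) ⟩
    suc (card ((W ∩ E x) ∩ K)) + card ((W ∩ E x) ∖ K)      ≡⟨ cong (λ a → suc a + card ((W ∩ E x) ∖ K)) (inside-degree x∈) ⟩
    suc (card (K - x)) + card ((W ∩ E x) ∖ K)              ≡⟨ cong (_+ card ((W ∩ E x) ∖ K)) (trans (sym (card-remove x∈)) size) ⟩
    m + card ((W ∩ E x) ∖ K)                               ∎
    where open ≡-Reasoning

  opaque

    -- A vertex of `K` has m - 1 out-neighbours in `K`, so out-degree m leaves exactly one outside.
    low-attached : ∀ {x} → x ∈ K → card (W ∩ E x) ≤ m →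
                   ∃ λ z → z ∈ W × z ∉ K × z ∈ E x × (∀ {j} → j ∈ W → j ∈ E x → j ∈ K ⊎ j ≡ z)
    low-attached {x} x∈ low = z , ∩-⊆ˡ (∖-⊆ z∈) , proj₂ (∈-∖⁻ z∈) , ∩-⊆ʳ (∖-⊆ z∈) , only
      where
      outside : VSet n
      outside = (W ∩ E x) ∖ K
      ≤1 : card outside ≤ 1
      ≤1 = +-cancelˡ-≤ m _ 1 (subst₂ _≤_ (degree-split x∈) (+-comm 1 m) (s≤s low))
      ≥1 : 1 ≤ card outside
      ≥1 = +-cancelˡ-≤ m 1 _ (subst₂ _≤_ (+-comm 1 m) (degree-split x∈) (s≤s (min-degree irr cr (K⊆ x∈))))
      z∃ : ∃ λ z → z ∈ outside
      z∃ = card-pos ≥1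
      z : Fin n
      z = proj₁ z∃
      z∈ : z ∈ outside
      z∈ = proj₂ z∃
      only : ∀ {j} → j ∈ W → j ∈ E x → j ∈ K ⊎ j ≡ z
      only {j} j∈ e with j ∈? K
      ... | yes p = inj₁ p
      ... | no ¬p = inj₂ (card≤1 ≤1 (∈-∖⁺ (∈-∩⁺ j∈ e) ¬p) z∈)

  only-arc : ∀ {x z} → x ∈ K → (∀ {j} → j ∈ W → j ∈ E x → j ∈ K ⊎ j ≡ z) → z ∈ E x
  only-arc {x} {z} x∈ only with z ∈? E x
  ... | yes p = p
  ... | no ¬p = ⊥-elim (1+n≰n (begin
    suc m                       ≤⟨ s≤s (min-degree irr cr (K⊆ x∈)) ⟩
    suc (card (W ∩ E x))        ≡⟨ degree-split x∈ ⟩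
    m + card ((W ∩ E x) ∖ K)    ≡⟨ cong (m +_) (card-empty none) ⟩
    m + 0                       ≡⟨ +-identityʳ m ⟩
    m                           ∎))
    where
    open ≤-Reasoning
    none : ∀ {j} → j ∉ (W ∩ E x) ∖ K
    none p with ∈-∖⁻ p
    ... | q , j∉ with only (∩-⊆ˡ q) (∩-⊆ʳ q)
    ...   | inj₁ a    = j∉ a
    ...   | inj₂ refl = ¬p (∩-⊆ʳ q)

module _ {m n : ℕ} {E : Arcs n} {W : VSet n} (irr : Loopless E) (cr : Critical m E W) (C : SubClique m E W) where

  open SubClique C

  attached-out : ∀ {x} → x ∈ K → card (W ∩ E x) ≤ m → ∃ λ z → Attached E W K x z × z ∈ E x
  attached-out x∈ low = let z , a , b , c , d = low-attached irr cr C x∈ low in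
    z , record { x∈K = x∈ ; y∈W = a ; y∉K = b ; only = inj₁ d } , c

  attached-in : ∀ {x} → x ∈ K → card (W ∩ flip E x) ≤ m → ∃ λ z → Attached E W K x z × x ∈ E z
  attached-in x∈ low =
    let z , a , b , c , d = low-attached (Loopless-flip {E = E} irr) (Critical-flip cr) (SubClique-flip C) x∈ low
    in z , record { x∈K = x∈ ; y∈W = a ; y∉K = b ; only = inj₂ λ j∈ e → d j∈ (∈-flip {E = E} e) } , ∈-flip {E = flip E} c

  attached-arc : ∀ {x z} → Attached E W K x z → z ∈ E x ⊎ x ∈ E z
  attached-arc a with Attached.only a
  ... | inj₁ o = inj₁ (only-arc irr cr C (Attached.x∈K a) o)
  ... | inj₂ o = inj₂ (∈-flip {E = flip E} (only-arc (Loopless-flip {E = E} irr) (Critical-flip cr) (SubClique-flip C)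
                   (Attached.x∈K a) λ j∈ e → o j∈ (∈-flip {E = flip E} e)))

module _ {m n : ℕ} {E : Arcs n} {W : VSet n} (3≤m : 3 ≤ m) (irr : Loopless E) (cr : Critical m E W)
         (sp : Sparse m E W) (ih : Smaller m W) (C : SubClique m E W)
         {x x′ y y′ : Fin n} (at : Attached E W (SubClique.K C) x y) (at′ : Attached E W (SubClique.K C) x′ y′)
         (y≢y′ : y ≢ y′) (L : Link m E W (SubClique.K C) y y′) where

  open SubClique C
  open Link L hiding (size)
  open Attached at using (x∈K; y∈W; y∉K)
  open Attached at′ using () renaming (x∈K to x′∈K; y∈W to y′∈W; y∉K to y′∉K)

  private
    y′≢y : y′ ≢ y
    y′≢y p = y≢y′ (sym p)

    K∌ : ∀ {i z} → i ∈ K → z ∈ P → i ≢ z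
    K∌ i∈ z∈ refl = disjoint i∈ z∈

    -- A third attached vertex z gives links for y, z and for y′, z. By the latter, y has degree m
    -- in each direction. In the direction of an arc joining it to x, its neighbourhood contains x
    -- and the cores, of size m - 1, of both links at y, so the cores coincide. Each core vertex
    -- then sends an arc out of `P` to z, and together with y and y′ at least m + 1 arcs leave `P`.
    no-third : ∀ {q z} → Attached E W K q z → z ≢ y → z ≢ y′ → ⊥
    no-third {q} {z} a z≢y z≢y′ =
      link-exists 3≤m irr cr sp ih C at a (λ p → z≢y (sym p)) λ L₂ →
      link-exists 3≤m irr cr sp ih C at′ a (λ p → z≢y′ (sym p)) λ L₃ →
      absurd L₂ L₃ (attached-arc irr cr C at)
      where
      module _ (L₂ : Link m E W K y z) (L₃ : Link m E W K y′ z) where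
        module L₂ = Link L₂
        module L₃ = Link L₃

        z∉P : z ∉ P
        z∉P z∈ = L₂.no-arc (adjacent y∈P z∈ (λ p → z≢y (sym p)) (λ (_ , p) → z≢y′ p) (λ (p , _) → y≢y′ p))

        y∉P₃ : y ∉ L₃.P
        y∉P₃ y∈ = no-arc′ (L₃.adjacent L₃.y∈P y∈ y′≢y (λ (_ , p) → z≢y (sym p)) (λ (p , _) → z≢y′ (sym p)))

        core⊆P₂ : (N : VSet n) → card N ≤ m → x ∈ N → (∀ {u} → u ∈ P → u ≢ y → u ≢ y′ → u ∈ N) →
                  (∀ {u} → u ∈ L₂.P → u ≢ y → u ≢ z → u ∈ N) →
                  ∀ {u} → u ∈ P → u ≢ y → u ≢ y′ → u ∈ L₂.P
        core⊆P₂ N small x∈N fromP fromP₂ {u} u∈ u≢y u≢y′ with u ∈? L₂.P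
        ... | yes p = p
        ... | no ¬p = ⊥-elim (1+n≰n (begin
          suc m                                        ≡⟨ cong suc (suc-injective (trans (sym L₂.size) (card-remove L₂.y∈P))) ⟩
          suc (card (L₂.P - y))                        ≡⟨ cong suc (card-remove (∈--⁺ L₂.y′∈P z≢y)) ⟩
          suc (suc (card B))                           ≡⟨ cong suc (card-insert x∉B) ⟨
          suc (card (B ∪ ⁅ x ⁆))                       ≡⟨ card-insert u∉Bx ⟨
          card (B ∪ ⁅ x ⁆ ∪ ⁅ u ⁆)                     ≤⟨ card-mono (∪-⊆ (∪-⊆ B⊆N (⁅⁆-⊆ x∈N)) (⁅⁆-⊆ (fromP u∈ u≢y u≢y′))) ⟩
          card N                                       ≤⟨ small ⟩
          m                                            ∎))
          where
          open ≤-Reasoning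
          B = L₂.P - y - z
          B⊆N : B ⊆ N
          B⊆N b = let c , p = ∈--⁻ b ; d , q = ∈--⁻ c in fromP₂ d q p
          x∉B : x ∉ B
          x∉B b = L₂.disjoint x∈K (remove-⊆ (remove-⊆ b))
          u∉Bx : u ∉ B ∪ ⁅ x ⁆
          u∉Bx b with ∈-∪⁻ b
          ... | inj₁ c = ¬p (remove-⊆ (remove-⊆ c))
          ... | inj₂ c = K∌ x∈K u∈ (sym (∈⁅⁆⇒≡ c))

        overfull : (∀ {u} → u ∈ P → u ≢ y → u ≢ y′ → u ∈ L₂.P) → ⊥
        overfull core = 1+n≰n (begin
          suc m              ≡⟨ Link.size L ⟨
          card P             ≡⟨ *-identityʳ (card P) ⟨
          card P * 1         ≤⟨ over-lower (λ {u} u∈ → row u∈ (u ≟ y) (u ≟ y′)) ⟩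
          arcs E P (W ∖ P)   ≤⟨ exits ⟩
          m                  ∎)
          where
          open ≤-Reasoning
          row : ∀ {u} → u ∈ P → Dec (u ≡ y) → Dec (u ≡ y′) → 1 ≤ card ((W ∖ P) ∩ E u)
          row u∈ (yes refl) _ = leaves
          row u∈ _ (yes refl) = leaves′
          row u∈ (no p) (no q) = card-≥1 (∈-∩⁺ (∈-∖⁺ (Attached.y∈W a) z∉P)
            (L₂.adjacent (core u∈ p q) L₂.y′∈P (λ { refl → z∉P u∈ }) (λ (r , _) → p r) (λ (_ , r) → z≢y r)))

        absurd : y ∈ E x ⊎ x ∈ E y → ⊥
        absurd (inj₁ xy) = overfull (core⊆P₂ (W ∩ flip E y) (L₃.low⁻ y∈W y∉P₃)
          (∈-∩⁺ (K⊆ x∈K) (∈-flip {E = E} xy))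
          (λ u∈ p q → ∈-∩⁺ (P⊆W u∈) (∈-flip {E = E} (adjacent u∈ y∈P p (λ (r , _) → p r) (λ (r , _) → q r))))
          (λ u∈ p q → ∈-∩⁺ (L₂.P⊆W u∈) (∈-flip {E = E} (L₂.adjacent u∈ L₂.y∈P p (λ (r , _) → p r) (λ (r , _) → q r)))))
        absurd (inj₂ yx) = overfull (core⊆P₂ (W ∩ E y) (L₃.low y∈W y∉P₃)
          (∈-∩⁺ (K⊆ x∈K) yx)
          (λ u∈ p q → ∈-∩⁺ (P⊆W u∈) (adjacent y∈P u∈ (λ r → p (sym r)) (λ (_ , r) → q r) (λ (r , _) → y≢y′ r)))
          (λ u∈ p q → ∈-∩⁺ (L₂.P⊆W u∈) (L₂.adjacent L₂.y∈P u∈ (λ r → p (sym r)) (λ (_ , r) → q r) (λ (_ , r) → p r))))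

    one-of : ∀ {q z} → Attached E W K q z → z ≡ y ⊎ z ≡ y′
    one-of {q} {z} a with z ≟ y | z ≟ y′
    ... | yes p | _     = inj₁ p
    ... | no _  | yes p = inj₂ p
    ... | no p  | no q  = ⊥-elim (no-third a p q)

    in-P : ∀ {z} → z ≡ y ⊎ z ≡ y′ → z ∈ P
    in-P (inj₁ refl) = y∈P
    in-P (inj₂ refl) = y′∈P

    record Ends (q : Fin n) : Set where
      field
        o i  : Fin n
        qo   : o ∈ E q
        iq   : q ∈ E i
        only-o : ∀ {j} → j ∈ W → j ∈ E q → j ∈ K ⊎ j ≡ o
        only-i : ∀ {j} → j ∈ W → q ∈ E j → j ∈ K ⊎ j ≡ i
        o∈   : o ≡ y ⊎ o ≡ y′
        i∈   : i ≡ y ⊎ i ≡ y′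

    opaque

      ends : ∀ {q} → q ∈ K → Ends q
      ends {q} q∈ =
        let o , o∈W , o∉K , qo , only-o = low-attached irr cr C q∈ (low (K⊆ q∈) (disjoint q∈))
            i , i∈W , i∉K , iq , only-i = low-attached (Loopless-flip {E = E} irr) (Critical-flip cr) (SubClique-flip C) q∈ (low⁻ (K⊆ q∈) (disjoint q∈))
            only-i′ = λ {j} (j∈ : j ∈ W) (e : q ∈ E j) → only-i j∈ (∈-flip {E = E} e)
        in record { o = o ; i = i ; qo = qo ; iq = ∈-flip {E = flip E} iq ; only-o = only-o ; only-i = only-i′
                  ; o∈ = one-of (record { x∈K = q∈ ; y∈W = o∈W ; y∉K = o∉K ; only = inj₁ only-o })
                  ; i∈ = one-of (record { x∈K = q∈ ; y∈W = i∈W ; y∉K = i∉K ; only = inj₂ only-i′ }) }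

    -- The remainder `M` would receive no arc from `P ∪ K`: none from `K`, whose outer arcs end in
    -- `P`, and none from `P`, whose at most m exits are used up by one arc into each vertex of `K`.
    -- Arc-connectivity forbids this.
    W⊆P∪K : ∀ {w} → w ∈ W → w ∈ P ⊎ w ∈ K
    W⊆P∪K {w} w∈ with w ∈? P | w ∈? K
    ... | yes p | _     = inj₁ p
    ... | no _  | yes p = inj₂ p
    ... | no w∉P | no w∉K = ⊥-elim (<⇒≱ (≤-trans (s≤s z≤n) 3≤m) (begin
      m                                        ≤⟨ arc-connectivity cr (∪-⊆ P⊆W K⊆) (∈-∪ˡ y∈P) w∈ w∉U ⟩
      arcs E U M                               ≡⟨ over-∪ (λ p k → disjoint k p) (λ i → card (M ∩ E i)) ⟩
      arcs E P M + arcs E K M                  ≤⟨ +-mono-≤ from-P (over-monoʳ K (λ q∈ → ≤-reflexive (card-empty (from-K q∈)))) ⟩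
      0 + over K (λ _ → 0)                     ≡⟨ trans (over-const K 0) (*-zeroʳ (card K)) ⟩
      0                                        ∎))
      where
      open ≤-Reasoning
      U = P ∪ K
      M = W ∖ U
      w∉U : w ∉ U
      w∉U u with ∈-∪⁻ u
      ... | inj₁ a = w∉P a
      ... | inj₂ b = w∉K b
      from-K : ∀ {q} → q ∈ K → ∀ {j} → j ∉ M ∩ E q
      from-K q∈ j∈ with ∈-∖⁻ (∩-⊆ˡ j∈) | Ends.only-o (ends q∈) (∖-⊆ (∩-⊆ˡ j∈)) (∩-⊆ʳ j∈)
      ... | _ , j∉ | inj₁ k    = j∉ (∈-∪ʳ k)
      ... | _ , j∉ | inj₂ refl = j∉ (∈-∪ˡ (in-P (Ends.o∈ (ends q∈))))
      into-K : m ≤ arcs E P K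
      into-K = begin
        m                                     ≡⟨ trans (sym size) (sym (*-identityʳ (card K))) ⟩
        card K * 1                            ≤⟨ over-lower (λ q∈ → card-≥1 (∈-∩⁺ (in-P (Ends.i∈ (ends q∈))) (∈-flip {E = E} (Ends.iq (ends q∈))))) ⟩
        arcs (flip E) K P                     ≡⟨ arcs-flip E P K ⟩
        arcs E P K                            ∎
      from-P : arcs E P M ≤ 0
      from-P = +-cancelˡ-≤ (arcs E P K) _ 0 (begin
        arcs E P K + arcs E P M               ≤⟨ +-monoʳ-≤ (arcs E P K) (over-monoʳ P (λ _ → card-mono λ j∈ →
                                                   let a , b = ∈-∖⁻ (∩-⊆ˡ j∈) in
                                                   ∈-∩⁺ (∈-∖⁺ (∈-∖⁺ a (λ p → b (∈-∪ˡ p))) (λ k → b (∈-∪ʳ k))) (∩-⊆ʳ j∈))) ⟩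
        arcs E P K + arcs E P ((W ∖ P) ∖ K)   ≡⟨ arcs-∖ʳ E P (λ k → ∈-∖⁺ (K⊆ k) (disjoint k)) ⟨
        arcs E P (W ∖ P)                      ≤⟨ exits ⟩
        m                                     ≤⟨ into-K ⟩
        arcs E P K                            ≡⟨ +-identityʳ _ ⟨
        arcs E P K + 0                        ∎)

    -- If the arc leaving q and the arc entering q had different ends o and i, then q could
    -- take the common colour of y and y′: the only monochromatic arcs would be i → q → o.
    module Recolour {q : Fin n} (q∈ : q ∈ K) (o≢i : Ends.o (ends q∈) ≢ Ends.i (ends q∈))
                    (f : Fin n → Fin m) (val : Valid E (W - q) f) where

      open Ends (ends q∈)

      c : Fin m
      c = f y

      P⊆ : P ⊆ W - q
      P⊆ p = ∈--⁺ (P⊆W p) (λ r → K∌ q∈ p (sym r))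

      distinct-P : ∀ {i j} → i ∈ P → j ∈ P → i ≢ j → f i ≡ f j → (i ≡ y × j ≡ y′) ⊎ (i ≡ y′ × j ≡ y)
      distinct-P {i} {j} i∈ j∈ i≢j e with (i ≟ y) ×-dec (j ≟ y′) | (i ≟ y′) ×-dec (j ≟ y)
      ... | yes p | _     = inj₁ p
      ... | no _  | yes p = inj₂ p
      ... | no p  | no r  = ⊥-elim (Valid-digon val (P⊆ i∈) (P⊆ j∈) (adjacent i∈ j∈ i≢j p r)
                              (adjacent j∈ i∈ (λ s → i≢j (sym s)) (λ (s , t) → r (t , s)) (λ (s , t) → p (t , s))) e)

      distinct-K : ∀ {i j} → i ∈ K → j ∈ K → i ≢ q → j ≢ q → f i ≡ f j → i ≡ j
      distinct-K {i} {j} i∈ j∈ i≢q j≢q e with i ≟ j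
      ... | yes p = p
      ... | no p  = ⊥-elim (Valid-digon val (∈--⁺ (K⊆ i∈) i≢q) (∈--⁺ (K⊆ j∈) j≢q) (clique i∈ j∈ p)
                      (clique j∈ i∈ (λ s → p (sym s))) e)

      -- `P` has m + 1 vertices, so two of them share a colour, and only y and y′ are not joined by
      -- a digon.
      fy′≡c : f y′ ≡ c
      fy′≡c with collision P f (subst (m <_) (sym (Link.size L)) ≤-refl)
      ... | i , j , i∈ , j∈ , i≢j , e with distinct-P i∈ j∈ i≢j e
      ...   | inj₁ (refl , refl) = sym e
      ...   | inj₂ (refl , refl) = e

      f-end : ∀ {z} → z ≡ y ⊎ z ≡ y′ → f z ≡ c
      f-end (inj₁ refl) = refl
      f-end (inj₂ refl) = fy′≡c

      spare : ∃ λ α → ∀ {i} → i ∈ K - q → f i ≢ α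
      spare = fresh (K - q) f (≤-reflexive (trans (sym (card-remove q∈)) size))

      α = proj₁ spare

      opaque

        -- The vertex of `K - q` that already had the colour c, if there is one, moves to the colour
        -- α missing on `K - q`.
        g : Fin n → Fin m
        g j with j ≟ q
        ... | yes _ = c
        ... | no _ with j ∈? K | f j ≟ c
        ...   | yes _ | yes _ = α
        ...   | _     | _     = f j

        g-q : g q ≡ c
        g-q with q ≟ q
        ... | yes _ = refl
        ... | no ¬p = ⊥-elim (¬p refl)

        g-P : ∀ {j} → j ∈ P → g j ≡ f j
        g-P {j} j∈ with j ≟ q
        ... | yes refl = ⊥-elim (disjoint q∈ j∈)
        ... | no _ with j ∈? K | f j ≟ c
        ...   | yes k | _ = ⊥-elim (disjoint k j∈)
        ...   | no _  | _ = refl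

        g-K : ∀ {j} → j ∈ K → j ≢ q → (f j ≡ c × g j ≡ α) ⊎ (f j ≢ c × g j ≡ f j)
        g-K {j} j∈ j≢q with j ≟ q
        ... | yes p = ⊥-elim (j≢q p)
        ... | no _ with j ∈? K | f j ≟ c
        ...   | yes _ | yes p = inj₁ (p , refl)
        ...   | yes _ | no p  = inj₂ (p , refl)
        ...   | no ¬k | _     = ⊥-elim (¬k j∈)

      g≢c : ∀ {j} → j ∈ K → j ≢ q → g j ≢ c
      g≢c j∈ j≢q e with g-K j∈ j≢q
      ... | inj₁ (p , r) = proj₂ spare (∈--⁺ j∈ j≢q) (trans p (trans (sym e) r))
      ... | inj₂ (p , r) = p (trans (sym r) e)

      g-injective : ∀ {i j} → i ∈ K → j ∈ K → i ≢ q → j ≢ q → g i ≡ g j → i ≡ j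
      g-injective i∈ j∈ i≢q j≢q e with g-K i∈ i≢q | g-K j∈ j≢q
      ... | inj₁ (p , _) | inj₁ (r , _) = distinct-K i∈ j∈ i≢q j≢q (trans p (sym r))
      ... | inj₁ (_ , p) | inj₂ (_ , r) = ⊥-elim (proj₂ spare (∈--⁺ j∈ j≢q) (trans (sym r) (trans (sym e) p)))
      ... | inj₂ (_ , p) | inj₁ (_ , r) = ⊥-elim (proj₂ spare (∈--⁺ i∈ i≢q) (trans (sym p) (trans e r)))
      ... | inj₂ (_ , p) | inj₂ (_ , r) = distinct-K i∈ j∈ i≢q j≢q (trans (sym p) (trans e r))

      mono-arc : ∀ {a b} → Mono E W g a b → (a ≡ q × b ≡ o) ⊎ (a ≡ i × b ≡ q)
      mono-arc {a} {b} (a∈ , b∈ , e , d) with W⊆P∪K a∈ | W⊆P∪K b∈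
      ... | inj₁ p | inj₁ r with distinct-P p r (λ { refl → irr e }) (trans (sym (g-P p)) (trans d (g-P r)))
      ...   | inj₁ (refl , refl) = ⊥-elim (no-arc e)
      ...   | inj₂ (refl , refl) = ⊥-elim (no-arc′ e)
      mono-arc {a} {b} (a∈ , b∈ , e , d) | inj₂ p | inj₂ r with a ≟ q | b ≟ q
      ... | yes refl | yes refl = ⊥-elim (irr e)
      ... | yes refl | no b≢q   = ⊥-elim (g≢c r b≢q (trans (sym d) g-q))
      ... | no a≢q   | yes refl = ⊥-elim (g≢c p a≢q (trans d g-q))
      ... | no a≢q   | no b≢q   = ⊥-elim (irr (subst (_∈ E a) (sym (g-injective p r a≢q b≢q d)) e))
      mono-arc {a} {b} (a∈ , b∈ , e , d) | inj₂ p | inj₁ r with Ends.only-o (ends p) b∈ e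
      ... | inj₁ k = ⊥-elim (disjoint k r)
      ... | inj₂ b≡ with a ≟ q
      ...   | no a≢q = ⊥-elim (g≢c p a≢q (trans d (trans (g-P r) (trans (cong f b≡) (f-end (Ends.o∈ (ends p)))))))
      ...   | yes refl with only-o b∈ e
      ...     | inj₁ k = ⊥-elim (disjoint k r)
      ...     | inj₂ s = inj₁ (refl , s)
      mono-arc {a} {b} (a∈ , b∈ , e , d) | inj₁ p | inj₂ r with Ends.only-i (ends r) a∈ e
      ... | inj₁ k = ⊥-elim (disjoint k p)
      ... | inj₂ a≡ with b ≟ q
      ...   | no b≢q = ⊥-elim (g≢c r b≢q (trans (sym d) (trans (g-P p) (trans (cong f a≡) (f-end (Ends.i∈ (ends r)))))))
      ...   | yes refl with only-i a∈ e
      ...     | inj₁ k = ⊥-elim (disjoint k p)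
      ...     | inj₂ s = inj₂ (s , refl)

      -- The ranks 0, 1, 2 of i, q, o are well defined because o differs from i; they grow along
      -- every monochromatic arc.
      rank : Fin n → ℕ
      rank j with j ≟ i | j ≟ q
      ... | yes _ | _     = 0
      ... | no _  | yes _ = 1
      ... | no _  | no _  = 2

      i≢q : i ≢ q
      i≢q p = K∌ q∈ (in-P i∈) (sym p)

      o≢q : o ≢ q
      o≢q p = K∌ q∈ (in-P o∈) (sym p)

      rank-i : rank i ≡ 0
      rank-i with i ≟ i
      ... | yes _ = refl
      ... | no ¬p = ⊥-elim (¬p refl)

      rank-q : rank q ≡ 1
      rank-q with q ≟ i | q ≟ q
      ... | yes p | _     = ⊥-elim (i≢q (sym p))
      ... | no _  | yes _ = refl
      ... | no _  | no ¬p = ⊥-elim (¬p refl)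

      rank-o : rank o ≡ 2
      rank-o with o ≟ i | o ≟ q
      ... | yes p | _     = ⊥-elim (o≢i p)
      ... | no _  | yes p = ⊥-elim (o≢q p)
      ... | no _  | no _  = refl

      increasing : ∀ {a b} → Mono E W g a b → rank a < rank b
      increasing r with mono-arc r
      ... | inj₁ (refl , refl) = subst₂ _<_ (sym rank-q) (sym rank-o) (s≤s (s≤s z≤n))
      ... | inj₂ (refl , refl) = subst₂ _<_ (sym rank-i) (sym rank-q) (s≤s z≤n)

      absurd : ⊥
      absurd = proj₁ cr (g , λ v w → <-irrefl refl (walk-increasing rank increasing w))

    same-ends : ∀ {q} (q∈ : q ∈ K) → Ends.o (ends q∈) ≡ Ends.i (ends q∈)
    same-ends q∈ with Ends.o (ends q∈) ≟ Ends.i (ends q∈)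
    ... | yes p = p
    ... | no ¬p = ⊥-elim (proj₂ cr (K⊆ q∈) λ (f , val) → Recolour.absurd q∈ ¬p f val)

    data Side (q : Fin n) : Set where
      side-y  : y ∈ E q → q ∈ E y → y′ ∉ E q → q ∉ E y′ → Side q
      side-y′ : y ∉ E q → q ∉ E y → y′ ∈ E q → q ∈ E y′ → Side q

    side : ∀ {q} → q ∈ K → Side q
    side {q} q∈ = by o∈ (sym (same-ends q∈))
      where
      open Ends (ends q∈)
      miss-o : ∀ {z} → z ∈ P → z ≢ o → z ∉ E q
      miss-o z∈ z≢ e with only-o (P⊆W z∈) e
      ... | inj₁ k = disjoint k z∈
      ... | inj₂ p = z≢ p
      miss-i : ∀ {z} → z ∈ P → z ≢ i → q ∉ E z
      miss-i z∈ z≢ e with only-i (P⊆W z∈) e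
      ... | inj₁ k = disjoint k z∈
      ... | inj₂ p = z≢ p
      by : o ≡ y ⊎ o ≡ y′ → i ≡ o → Side q
      by (inj₁ p) s = side-y (subst (_∈ E q) p qo) (subst (λ z → q ∈ E z) (trans s p) iq)
        (miss-o y′∈P (λ r → y≢y′ (trans (sym p) (sym r)))) (miss-i y′∈P (λ r → y≢y′ (trans (sym p) (trans (sym s) (sym r)))))
      by (inj₂ p) s = side-y′ (miss-o y∈P (λ r → y≢y′ (trans r p))) (miss-i y∈P (λ r → y≢y′ (trans r (trans s p))))
        (subst (_∈ E q) p qo) (subst (λ z → q ∈ E z) (trans s p) iq)

    Ky : VSet n
    Ky = K ∩ flip E y

    -- The cyclic order of C₅ is: core of `P`, y, vertices of `K` at y, vertices of `K` at y′, y′.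
    -- Each constructor stores the facts from which `adjacency` reads off the arcs.
    data Part (i : Fin n) : Fin 5 → Set where
      inZ   : i ∈ P → i ≢ y → i ≢ y′ → Part i zero
      isY   : i ≡ y → Part i (suc zero)
      inKy  : i ∈ K → y ∈ E i → i ∈ E y → y′ ∉ E i → i ∉ E y′ → Part i (suc (suc zero))
      inKy′ : i ∈ K → y ∉ E i → i ∉ E y → y′ ∈ E i → i ∈ E y′ → Part i (suc (suc (suc zero)))
      isY′  : i ≡ y′ → Part i (suc (suc (suc (suc zero))))

    cl : Fin n → Fin 5
    cl i with i ∈? K | y ∈? E i | i ≟ y | i ≟ y′
    ... | yes _ | yes _ | _     | _     = suc (suc zero)
    ... | yes _ | no _  | _     | _     = suc (suc (suc zero))
    ... | no _  | _     | yes _ | _     = suc zero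
    ... | no _  | _     | no _  | yes _ = suc (suc (suc (suc zero)))
    ... | no _  | _     | no _  | no _  = zero

    part : ∀ {i} → i ∈ W → Part i (cl i)
    part {i} i∈ with i ∈? K | y ∈? E i | i ≟ y | i ≟ y′ | W⊆P∪K i∈
    ... | yes k | yes e | _     | _     | _ with side k
    ...   | side-y a b c d  = inKy k a b c d
    ...   | side-y′ a _ _ _ = ⊥-elim (a e)
    part {i} i∈ | yes k | no ¬e | _     | _     | _ with side k
    ...   | side-y a _ _ _  = ⊥-elim (¬e a)
    ...   | side-y′ a b c d = inKy′ k a b c d
    part {i} i∈ | no _  | _     | yes p | _     | _ = isY p
    part {i} i∈ | no _  | _     | no _  | yes p | _ = isY′ p
    part {i} i∈ | no _  | _     | no p  | no r  | inj₁ q = inZ q p r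
    part {i} i∈ | no ¬k | _     | no _  | no _  | inj₂ k = ⊥-elim (¬k k)

    Adjacency : Fin n → Fin n → Fin 5 → Fin 5 → Set
    Adjacency i j c d = (j ∈ E i → (c ≡ d × i ≢ j) ⊎ C5arc c d) × ((c ≡ d × i ≢ j) ⊎ C5arc c d → j ∈ E i)

    same : ∀ {i j c} → (i ≢ j → j ∈ E i) → ¬ C5arc c c → Adjacency i j c c
    same h ¬c = (λ e → inj₁ (refl , λ { refl → irr e })) , λ { (inj₁ (_ , ne)) → h ne ; (inj₂ a) → ⊥-elim (¬c a) }

    present : ∀ {i j c d} → C5arc c d → j ∈ E i → Adjacency i j c d
    present a e = (λ _ → inj₂ a) , λ _ → e

    absent : ∀ {i j c d} → c ≢ d → ¬ C5arc c d → j ∉ E i → Adjacency i j c d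
    absent c≢d ¬a ¬e = (λ e → ⊥-elim (¬e e)) , λ { (inj₁ (p , _)) → ⊥-elim (c≢d p) ; (inj₂ a) → ⊥-elim (¬a a) }

    Z→K : ∀ {z q} → z ∈ P → z ≢ y → z ≢ y′ → q ∈ K → q ∉ E z
    Z→K z∈ p r q∈ e with Ends.only-i (ends q∈) (P⊆W z∈) e
    ... | inj₁ k = disjoint k z∈
    ... | inj₂ refl with Ends.i∈ (ends q∈)
    ...   | inj₁ s = p s
    ...   | inj₂ s = r s

    K→Z : ∀ {z q} → z ∈ P → z ≢ y → z ≢ y′ → q ∈ K → z ∉ E q
    K→Z z∈ p r q∈ e with Ends.only-o (ends q∈) (P⊆W z∈) e
    ... | inj₁ k = disjoint k z∈
    ... | inj₂ refl with Ends.o∈ (ends q∈)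
    ...   | inj₁ s = p s
    ...   | inj₂ s = r s

    adjacency : ∀ {i j c d} → Part i c → Part j d → Adjacency i j c d
    adjacency (inZ a p r) (inZ b _ _) = same (λ ne → adjacent a b ne (λ (s , _) → p s) (λ (s , _) → r s)) λ { (inj₁ ()) ; (inj₂ ()) }
    adjacency (inZ a p r) (isY refl) = present (inj₁ refl) (adjacent a y∈P p (λ (s , _) → p s) (λ (s , _) → r s))
    adjacency (inZ a p r) (inKy k _ _ _ _) = absent (λ ()) (λ { (inj₁ ()) ; (inj₂ ()) }) (Z→K a p r k)
    adjacency (inZ a p r) (inKy′ k _ _ _ _) = absent (λ ()) (λ { (inj₁ ()) ; (inj₂ ()) }) (Z→K a p r k)
    adjacency (inZ a p r) (isY′ refl) = present (inj₂ refl) (adjacent a y′∈P r (λ (s , _) → p s) (λ (s , _) → r s))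
    adjacency (isY refl) (inZ b p r) = present (inj₂ refl) (adjacent y∈P b (λ s → p (sym s)) (λ (_ , s) → r s) (λ (_ , s) → p s))
    adjacency (isY refl) (isY refl) = same (λ ne → ⊥-elim (ne refl)) λ { (inj₁ ()) ; (inj₂ ()) }
    adjacency (isY refl) (inKy _ _ e _ _) = present (inj₁ refl) e
    adjacency (isY refl) (inKy′ _ _ e _ _) = absent (λ ()) (λ { (inj₁ ()) ; (inj₂ ()) }) e
    adjacency (isY refl) (isY′ refl) = absent (λ ()) (λ { (inj₁ ()) ; (inj₂ ()) }) no-arc
    adjacency (inKy k _ _ _ _) (inZ b p r) = absent (λ ()) (λ { (inj₁ ()) ; (inj₂ ()) }) (K→Z b p r k)
    adjacency (inKy _ e _ _ _) (isY refl) = present (inj₂ refl) e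
    adjacency (inKy k _ _ _ _) (inKy l _ _ _ _) = same (clique k l) λ { (inj₁ ()) ; (inj₂ ()) }
    adjacency (inKy k e _ _ _) (inKy′ l ¬e _ _ _) = present (inj₁ refl) (clique k l λ { refl → ¬e e })
    adjacency (inKy _ _ _ e _) (isY′ refl) = absent (λ ()) (λ { (inj₁ ()) ; (inj₂ ()) }) e
    adjacency (inKy′ k _ _ _ _) (inZ b p r) = absent (λ ()) (λ { (inj₁ ()) ; (inj₂ ()) }) (K→Z b p r k)
    adjacency (inKy′ _ e _ _ _) (isY refl) = absent (λ ()) (λ { (inj₁ ()) ; (inj₂ ()) }) e
    adjacency (inKy′ k ¬e _ _ _) (inKy l e _ _ _) = present (inj₂ refl) (clique k l λ { refl → ¬e e })
    adjacency (inKy′ k _ _ _ _) (inKy′ l _ _ _ _) = same (clique k l) λ { (inj₁ ()) ; (inj₂ ()) }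
    adjacency (inKy′ _ _ _ e _) (isY′ refl) = present (inj₁ refl) e
    adjacency (isY′ refl) (inZ b p r) = present (inj₁ refl) (adjacent y′∈P b (λ s → r (sym s)) (λ (_ , s) → r s) (λ (_ , s) → p s))
    adjacency (isY′ refl) (isY refl) = absent (λ ()) (λ { (inj₁ ()) ; (inj₂ ()) }) no-arc′
    adjacency (isY′ refl) (inKy _ _ _ _ e) = absent (λ ()) (λ { (inj₁ ()) ; (inj₂ ()) }) e
    adjacency (isY′ refl) (inKy′ _ _ _ _ e) = present (inj₂ refl) e
    adjacency (isY′ refl) (isY′ refl) = same (λ ne → ⊥-elim (ne refl)) λ { (inj₁ ()) ; (inj₂ ()) }

    class : Fin 5 → VSet n
    class c = W ∩ λ i → ⁅ cl i ⁆ c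

    class⁺ : ∀ {i c} → i ∈ W → Part i c → (∀ {d} → Part i d → d ≡ c) → i ∈ class c
    class⁺ {i} {c} i∈ p uniq = ∈-∩⁺ {B = λ i → ⁅ cl i ⁆ c} i∈ (mem (∈⇒true (subst (λ d → d ∈ ⁅ cl i ⁆) (uniq (part i∈)) x∈⁅x⁆)))

    class⁻ : ∀ {c i} → i ∈ class c → Part i c
    class⁻ {c} {i} p with ∈-∩⁻ {B = λ i → ⁅ cl i ⁆ c} p
    ... | i∈ , mem q = subst (Part i) (sym (∈⁅⁆⇒≡ {i = c} {x = cl i} (mem q))) (part i∈)

    Part-unique : ∀ {i c d} → Part i c → Part i d → d ≡ c
    Part-unique (inZ _ _ _) (inZ _ _ _) = refl
    Part-unique (inZ _ p _) (isY q) = ⊥-elim (p q)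
    Part-unique (inZ a _ _) (inKy k _ _ _ _) = ⊥-elim (disjoint k a)
    Part-unique (inZ a _ _) (inKy′ k _ _ _ _) = ⊥-elim (disjoint k a)
    Part-unique (inZ _ _ p) (isY′ q) = ⊥-elim (p q)
    Part-unique (isY q) (inZ _ p _) = ⊥-elim (p q)
    Part-unique (isY _) (isY _) = refl
    Part-unique (isY refl) (inKy k _ _ _ _) = ⊥-elim (disjoint k y∈P)
    Part-unique (isY refl) (inKy′ k _ _ _ _) = ⊥-elim (disjoint k y∈P)
    Part-unique (isY refl) (isY′ q) = ⊥-elim (y≢y′ q)
    Part-unique (inKy k _ _ _ _) (inZ a _ _) = ⊥-elim (disjoint k a)
    Part-unique (inKy k _ _ _ _) (isY refl) = ⊥-elim (disjoint k y∈P)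
    Part-unique (inKy _ _ _ _ _) (inKy _ _ _ _ _) = refl
    Part-unique (inKy _ e _ _ _) (inKy′ _ ¬e _ _ _) = ⊥-elim (¬e e)
    Part-unique (inKy k _ _ _ _) (isY′ refl) = ⊥-elim (disjoint k y′∈P)
    Part-unique (inKy′ k _ _ _ _) (inZ a _ _) = ⊥-elim (disjoint k a)
    Part-unique (inKy′ k _ _ _ _) (isY refl) = ⊥-elim (disjoint k y∈P)
    Part-unique (inKy′ _ ¬e _ _ _) (inKy _ e _ _ _) = ⊥-elim (¬e e)
    Part-unique (inKy′ _ _ _ _ _) (inKy′ _ _ _ _ _) = refl
    Part-unique (inKy′ k _ _ _ _) (isY′ refl) = ⊥-elim (disjoint k y′∈P)
    Part-unique (isY′ q) (inZ _ _ p) = ⊥-elim (p q)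
    Part-unique (isY′ refl) (isY q) = ⊥-elim (y≢y′ (sym q))
    Part-unique (isY′ refl) (inKy k _ _ _ _) = ⊥-elim (disjoint k y′∈P)
    Part-unique (isY′ refl) (inKy′ k _ _ _ _) = ⊥-elim (disjoint k y′∈P)
    Part-unique (isY′ _) (isY′ _) = refl

    class-of : ∀ {i c} → i ∈ W → Part i c → i ∈ class c
    class-of i∈ p = class⁺ i∈ p (Part-unique p)

    card-class : ∀ c {A} → (∀ {i} → i ∈ A → i ∈ W × Part i c) → (∀ {i} → Part i c → i ∈ A) → card (class c) ≡ card A
    card-class c to from = ≤-antisym (card-mono λ p → from (class⁻ p))
                                     (card-mono λ a → let i∈ , p = to a in class-of i∈ p)

    Ky⁻ : ∀ {q} → q ∈ K - y → y ∈ E q → Part q (suc (suc zero))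
    Ky⁻ {q} q∈ e with side (remove-⊆ q∈)
    ... | side-y a b c d  = inKy (remove-⊆ q∈) a b c d
    ... | side-y′ a _ _ _ = ⊥-elim (a e)

    sizes : ∀ c → card (class c) ≡ Dsizes (suc m) (card Ky) c
    sizes zero = begin
      card (class zero)            ≡⟨ card-class zero
                                        (λ a → let b , p = ∈--⁻ a ; d , q = ∈--⁻ b in P⊆W d , inZ d q p)
                                        (λ { (inZ a p r) → ∈--⁺ (∈--⁺ a p) r }) ⟩
      card (P - y - y′)            ≡⟨ cong (λ a → a ∸ 2) (trans (card-remove y∈P) (cong suc (card-remove (∈--⁺ y′∈P y′≢y)))) ⟨
      card P ∸ 2                   ≡⟨ cong (_∸ 2) (Link.size L) ⟩
      suc m ∸ 2                    ∎
      where open ≡-Reasoning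
    sizes (suc zero) = trans (card-class (suc zero) (λ a → P⊆W (subst (_∈ P) (sym (∈⁅⁆⇒≡ a)) y∈P) , isY (∈⁅⁆⇒≡ a))
                                (λ { (isY refl) → x∈⁅x⁆ })) (over-⁅⁆ y (λ _ → 1))
    sizes (suc (suc zero)) = card-class (suc (suc zero)) to λ { (inKy k e _ _ _) → ∈-∩⁺ k (∈-flip {E = E} e) }
      where
      to : ∀ {i} → i ∈ Ky → i ∈ W × Part i (suc (suc zero))
      to a = K⊆ (∩-⊆ˡ a) , Ky⁻ (∈--⁺ (∩-⊆ˡ a) (K∌ (∩-⊆ˡ a) y∈P)) (∈-flip {E = flip E} (∩-⊆ʳ a))
    sizes (suc (suc (suc zero))) = begin
      card (class _)               ≡⟨ card-class (suc (suc (suc zero))) to (λ { (inKy′ k ¬e _ _ _) → ∈-∖⁺ k λ e → ¬e (∈-flip {E = flip E} e) }) ⟩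
      card (K ∖ flip E y)          ≡⟨ m+n∸m≡n (card Ky) _ ⟨
      card Ky + card (K ∖ flip E y) ∸ card Ky ≡⟨ cong (_∸ card Ky) (trans (sym (over-split K (flip E y) (λ _ → 1))) size) ⟩
      m ∸ card Ky                  ∎
      where
      open ≡-Reasoning
      to : ∀ {i} → i ∈ K ∖ flip E y → i ∈ W × Part i (suc (suc (suc zero)))
      to {i} a with ∈-∖⁻ a
      ... | k , ¬e with side k
      ...   | side-y e _ _ _  = ⊥-elim (¬e (∈-flip {E = E} e))
      ...   | side-y′ p q r s = K⊆ k , inKy′ k p q r s
    sizes (suc (suc (suc (suc zero)))) =
      trans (card-class (suc (suc (suc (suc zero)))) (λ a → P⊆W (subst (_∈ P) (sym (∈⁅⁆⇒≡ a)) y′∈P) , isY′ (∈⁅⁆⇒≡ a))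
        (λ { (isY′ refl) → x∈⁅x⁆ })) (over-⁅⁆ y′ (λ _ → 1))

    x∈Ky : x ∈ Ky
    x∈Ky = ∈-∩⁺ x∈K (∈-flip {E = E} (by (side x∈K) (attached-arc irr cr C at)))
      where
      by : Side x → y ∈ E x ⊎ x ∈ E y → y ∈ E x
      by (side-y a _ _ _)  _        = a
      by (side-y′ a _ _ _) (inj₁ e) = ⊥-elim (a e)
      by (side-y′ _ a _ _) (inj₂ e) = ⊥-elim (a e)

    x′∉Ky : x′ ∉ flip E y
    x′∉Ky p = by (side x′∈K) (attached-arc irr cr C at′) (∈-flip {E = flip E} p)
      where
      by : Side x′ → y′ ∈ E x′ ⊎ x′ ∈ E y′ → y ∉ E x′
      by (side-y _ _ a _)  (inj₁ e) _ = a e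
      by (side-y _ _ _ a)  (inj₂ e) _ = a e
      by (side-y′ a _ _ _) _        e = a e

    shape : Shape m E W
    shape = record
      -- x and x′ lie in different halves of `K`, whence 1 ≤ t ≤ m - 1.
      { cl = cl ; t = card Ky ; 1≤t = card-≥1 x∈Ky
      ; t≤ = ∸-monoˡ-≤ 1 (≤-trans (card-< ∩-⊆ˡ x′∈K (λ p → x′∉Ky (∩-⊆ʳ p))) (≤-reflexive size))
      ; sizes = sizes
      ; arc⁺ = λ i∈ j∈ → proj₁ (adjacency (part i∈) (part j∈))
      ; arc⁻ = λ i∈ j∈ → proj₂ (adjacency (part i∈) (part j∈)) }

    -- The contributions of `P`, of its exits and of the outer rows add up to at least m |W| + m -
    -- 2, and m ≥ 3.
    excess : m * card W < arcs E W W
    excess = +-cancelʳ-≤ 2 _ _ (begin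
      suc (m * card W) + 2                              ≡⟨ +-comm (suc (m * card W)) 2 ⟩
      3 + m * card W                                    ≤⟨ +-monoˡ-≤ (m * card W) 3≤m ⟩
      m + m * card W                                    ≡⟨ cong (λ a → m + m * a) (over-∖ P⊆W (λ _ → 1)) ⟩
      m + m * (card P + card (W ∖ P))                   ≡⟨ shuffle m (card P) (card (W ∖ P)) ⟩
      m * card P + m + m * card (W ∖ P)                 ≤⟨ +-mono-≤ (+-mono-≤ tight (arc-connectivity cr P⊆W y∈P (K⊆ x∈K) (disjoint x∈K))) (rows-≥ irr cr ∖-⊆) ⟩
      arcs E P P + 2 + arcs E P (W ∖ P) + arcs E (W ∖ P) W ≡⟨ shuffle′ (arcs E P P) _ _ ⟩
      arcs E P P + arcs E P (W ∖ P) + arcs E (W ∖ P) W + 2 ≡⟨ cong (_+ 2) (arcs-split E P⊆W) ⟨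
      arcs E W W + 2                                    ∎)
      where
      open ≤-Reasoning
      shuffle : ∀ m a b → m + m * (a + b) ≡ m * a + m + m * b
      shuffle = solve-∀
      shuffle′ : ∀ a b c → a + 2 + b + c ≡ a + b + c + 2
      shuffle′ = solve-∀

    P-clique : SubClique m E W
    P-clique = record
      { K = P - y′ ; K⊆ = λ p → P⊆W (remove-⊆ p)
      ; size = suc-injective (trans (sym (card-remove y′∈P)) (Link.size L))
      ; clique = λ a b i≢j → let c , p = ∈--⁻ a ; d , q = ∈--⁻ b in
          adjacent c d i≢j (λ (_ , r) → q r) (λ (r , _) → p r) }

    -- `K` and `P - y′` are disjoint m-cliques, so a lies outside one of them.
    avoiding : ∀ a → Σ (SubClique m E W) λ C → a ∉ SubClique.K C
    avoiding a with a ∈? K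
    ... | yes k = P-clique , λ p → disjoint k (remove-⊆ p)
    ... | no ¬k = C , ¬k

  link-spindle : Spindle m E W
  link-spindle = record { shape = shape ; excess = excess ; avoiding = avoiding }

-- The case of a single attached vertex

module _ {n : ℕ} where

module _ {m n : ℕ} {E : Arcs n} {W : VSet n} (irr : Loopless E) (cr : Critical m E W)
         (sp : Sparse m E W) (C : SubClique m E W)
         {E′ : Arcs n} {x y : Fin n} (M : Merge E E′ x y) (x∈K : x ∈ SubClique.K C) (y∉K : y ∉ SubClique.K C)
         {P : VSet n} (P⊆W : P ⊆ W) (x∉P : x ∉ P) (y∈P : y ∈ P) (crP : Critical m E′ P) where

  open SubClique C

  private
    d : Fin n → ℕ
    d i = card (W ∩ E i)

    b : ℕ
    b = card (K - x)

    sb : suc b ≡ m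
    sb = trans (sym (card-remove x∈K)) size

    two-parts : ∀ {A B} i → A ⊆ W ∩ E i → B ⊆ W ∩ E i → (∀ {j} → j ∈ A → j ∉ B) → card A + card B ≤ d i
    two-parts {A} {B} i s t dis = subst (_≤ d i) (over-∪ dis (λ _ → 1)) (card-mono (∪-⊆ s t))

  -- Members of K inside P have degree at least m already within P ∪ {x}.
  merged-clique-low : ∀ {q v} → q ∈ K → q ∈ P → v ∈ K → v ≢ x → v ∉ P → card (W ∩ E x) ≤ m
  merged-clique-low {q} {v} q∈K q∈P v∈K v≢x v∉P = +-cancelʳ-≤ (j * (m + k) + m * r + 2) (d x) m (begin
    d x + (j * (m + k) + m * r + 2)                   ≡⟨ shuffle (d x) (j * (m + k)) (m * r) ⟩
    d x + (j * (m + k) + m * r) + 2                   ≤⟨ +-monoˡ-≤ 2 (+-monoʳ-≤ (d x) (+-mono-≤ (over-lower rowJ) (rows-≥ irr cr (λ p → remove-⊆ (∖-⊆ p))))) ⟩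
    d x + (over J d + over ((W - x) ∖ J) d) + 2       ≡⟨ cong (λ a → d x + a + 2) (over-∖ J⊆ d) ⟨
    d x + over (W - x) d + 2                          ≡⟨ cong (_+ 2) (over-remove x∈W d) ⟨
    arcs E W W + 2                                    ≤⟨ sp ⟩
    m * card W + m                                    ≡⟨ cong (λ a → m * a + m) (trans (card-remove x∈W) (cong suc (over-∖ J⊆ (λ _ → 1)))) ⟩
    m * suc (j + r) + m                               ≡⟨ shuffle′ m j r ⟩
    m + (m * j + m * r + m)                           ≤⟨ +-monoʳ-≤ m (+-monoʳ-≤ (m * j + m * r) m≤) ⟩
    m + (m * j + m * r + (j * k + 2))                 ≡⟨ cong (m +_) (shuffle″ m j k r) ⟩
    m + (j * (m + k) + m * r + 2)                     ∎)
    where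
    open ≤-Reasoning
    J K₁ : VSet n
    J = (K - x) ∩ P
    K₁ = (K - x) ∖ P
    j k r : ℕ
    j = card J
    k = card K₁
    r = card ((W - x) ∖ J)
    x∈W : x ∈ W
    x∈W = K⊆ x∈K
    q≢x : q ≢ x
    q≢x refl = x∉P q∈P
    J⊆ : J ⊆ W - x
    J⊆ p = let a , a≢x = ∈--⁻ (∩-⊆ˡ p) in ∈--⁺ (K⊆ a) a≢x
    -- `K` consists of x, j vertices in `P` and k outside, both numbers positive because of q and v.
    -- The surplus j k thus consumes the slack m - 2, and none is left for x.
    m≤ : m ≤ j * k + 2
    m≤ = begin
      m              ≡⟨ sb ⟨
      suc b          ≡⟨ cong suc (over-split (K - x) P (λ _ → 1)) ⟩
      suc (j + k)    ≤⟨ s≤s (product-≥ (card-≥1 (∈-∩⁺ (∈--⁺ q∈K q≢x) q∈P)) (card-≥1 (∈-∖⁺ (∈--⁺ v∈K v≢x) v∉P))) ⟩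
      2 + j * k      ≡⟨ +-comm 2 (j * k) ⟩
      j * k + 2      ∎
    rowJ : ∀ {i} → i ∈ J → m + k ≤ d i
    rowJ {i} i∈ = ≤-trans (+-monoˡ-≤ k (≤-trans (min-degree (Merge.loop-free M) crP (∩-⊆ʳ i∈))
        (merge-degree M x∉P y∈P (λ { refl → y∉K (remove-⊆ (∩-⊆ˡ i∈)) }))))
      (two-parts i
        (λ p → ∈-∩⁺ (∪-⊆ P⊆W (⁅⁆-⊆ x∈W) (∩-⊆ˡ p)) (∩-⊆ʳ p))
        (λ p → let a , _ = ∈-∖⁻ p in ∈-∩⁺ (K⊆ (remove-⊆ a)) (clique (remove-⊆ (∩-⊆ˡ i∈)) (remove-⊆ a) (λ { refl → proj₂ (∈-∖⁻ p) (∩-⊆ʳ i∈) })))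
        (λ p q → let a , c = ∈-∖⁻ q in apart (∈-∪⁻ (∩-⊆ˡ p)) (proj₂ (∈--⁻ a)) c))
      where
      apart : ∀ {z} → z ∈ P ⊎ z ∈ ⁅ x ⁆ → z ≢ x → z ∉ P → ⊥
      apart (inj₁ p) _ z∉ = z∉ p
      apart (inj₂ p) z≢ _ = z≢ (∈⁅⁆⇒≡ p)
    shuffle : ∀ a b c → a + (b + c + 2) ≡ a + (b + c) + 2
    shuffle = solve-∀
    shuffle′ : ∀ m j r → m * suc (j + r) + m ≡ m + (m * j + m * r + m)
    shuffle′ = solve-∀
    shuffle″ : ∀ m j k r → m * j + m * r + (j * k + 2) ≡ j * (m + k) + m * r + 2
    shuffle″ = solve-∀

  -- The rows of x and y pay for the merged row of y and still cover the b arcs from x and all arcs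
  -- from y into `K - x`. The latter are booked on their ends q, to be exchanged later with the
  -- count in the opposite direction.
  merged-count : (∀ {q} → q ∈ K → q ∉ P) →
                 card (P ∩ E′ y) + over (P - y) d + over (K - x) (λ q → ⟦ E y q ⟧ + d q) ≤ m * card P + (m * b + b)
  merged-count dis = +-cancelʳ-≤ (b + m * r + 2) _ _ (begin
    c + pd + over (K - x) (λ q → ⟦ E y q ⟧ + d q) + (b + m * r + 2)
      ≡⟨ cong (λ a → c + pd + a + (b + m * r + 2)) (over-+ (K - x) _ d) ⟩
    c + pd + (over (K - x) (λ q → ⟦ E y q ⟧) + over (K - x) d) + (b + m * r + 2)
      ≡⟨ cong (λ a → c + pd + (a + over (K - x) d) + (b + m * r + 2)) (card-∩ (K - x) (E y)) ⟨
    c + pd + (card ((K - x) ∩ E y) + over (K - x) d) + (b + m * r + 2)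
      ≤⟨ +-mono-≤ (+-monoˡ-≤ (card ((K - x) ∩ E y) + over (K - x) d) (+-monoˡ-≤ pd (merge-degree-y M x∉P y∈P)))
                  (+-monoˡ-≤ 2 (+-monoʳ-≤ b (rows-≥ irr cr (λ p → remove-⊆ (∖-⊆ (∖-⊆ p)))))) ⟩
    card (P ∩ E y) + card (P ∩ E x) + pd + (card ((K - x) ∩ E y) + over (K - x) d) + (b + over R d + 2)
      ≡⟨ shuffle (card (P ∩ E y)) (card (P ∩ E x)) pd (card ((K - x) ∩ E y)) (over (K - x) d) b (over R d) ⟩
    card (P ∩ E x) + b + ((card (P ∩ E y) + card ((K - x) ∩ E y) + pd) + (over (K - x) d + over R d)) + 2
      ≤⟨ +-monoˡ-≤ 2 (+-mono-≤ row-x (+-monoˡ-≤ (over (K - x) d + over R d) (+-monoˡ-≤ pd row-y))) ⟩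
    d x + (d y + pd + (over (K - x) d + over R d)) + 2
      ≡⟨ cong (λ a → d x + a + 2) (trans (unfold d) (cong (_+ (over (K - x) d + over R d)) (over-remove y∈P d))) ⟨
    d x + over (W - x) d + 2
      ≡⟨ cong (_+ 2) (over-remove x∈W d) ⟨
    arcs E W W + 2
      ≤⟨ sp ⟩
    m * card W + m
      ≡⟨ cong (λ a → m * a + m) (trans (card-remove x∈W) (cong suc (unfold (λ _ → 1)))) ⟩
    m * suc (card P + (b + r)) + m
      ≡⟨ cong (λ z → z * suc (card P + (b + r)) + z) sb ⟨
    suc b * suc (card P + (b + r)) + suc b
      ≡⟨ shuffle′ b (card P) r ⟩
    suc b * card P + (suc b * b + b) + (b + suc b * r + 2)
      ≡⟨ cong (λ z → z * card P + (z * b + b) + (b + z * r + 2)) sb ⟩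
    m * card P + (m * b + b) + (b + m * r + 2) ∎)
    where
    open ≤-Reasoning
    R : VSet n
    R = (W - x) ∖ P ∖ (K - x)
    r c pd : ℕ
    r = card R
    c = card (P ∩ E′ y)
    pd = over (P - y) d
    x∈W : x ∈ W
    x∈W = K⊆ x∈K
    unfold : ∀ f → over (W - x) f ≡ over P f + (over (K - x) f + over R f)
    unfold f = trans (over-∖ (λ p → ∈--⁺ (P⊆W p) (λ { refl → x∉P p })) f)
      (cong (over P f +_) (over-∖ (λ p → let a , a≢ = ∈--⁻ p in ∈-∖⁺ (∈--⁺ (K⊆ a) a≢) (dis a)) f))
    row-x : card (P ∩ E x) + b ≤ d x
    row-x = two-parts x (λ p → ∈-∩⁺ (P⊆W (∩-⊆ˡ p)) (∩-⊆ʳ p))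
      (λ p → let a , a≢ = ∈--⁻ p in ∈-∩⁺ (K⊆ a) (clique x∈K a (λ q → a≢ (sym q))))
      (λ p q → dis (remove-⊆ q) (∩-⊆ˡ p))
    row-y : card (P ∩ E y) + card ((K - x) ∩ E y) ≤ d y
    row-y = two-parts y (λ p → ∈-∩⁺ (P⊆W (∩-⊆ˡ p)) (∩-⊆ʳ p)) (λ p → ∈-∩⁺ (K⊆ (remove-⊆ (∩-⊆ˡ p))) (∩-⊆ʳ p))
      (λ p q → dis (remove-⊆ (∩-⊆ˡ q)) (∩-⊆ˡ p))
    shuffle : ∀ a a′ p k o b r → a + a′ + p + (k + o) + (b + r + 2) ≡ a′ + b + ((a + k + p) + (o + r)) + 2
    shuffle = solve-∀
    shuffle′ : ∀ b p r → suc b * suc (p + (b + r)) + suc b ≡ suc b * p + (suc b * b + b) + (b + suc b * r + 2)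
    shuffle′ = solve-∀

  merged-total : m * card P ≤ card (P ∩ E′ y) + over (P - y) d
  merged-total = begin
    m * card P                          ≡⟨ trans (cong (m *_) (card-remove y∈P)) (*-suc m (card (P - y))) ⟩
    m + m * card (P - y)                ≤⟨ +-mono-≤ (min-degree (Merge.loop-free M) crP y∈P) (rows-≥ irr cr (λ p → P⊆W (remove-⊆ p))) ⟩
    card (P ∩ E′ y) + over (P - y) d    ∎
    where open ≤-Reasoning

  merged-arcs : arcs E′ P P ≤ card (P ∩ E′ y) + over (P - y) d
  merged-arcs = ≤-trans (≤-reflexive (over-remove y∈P (λ i → card (P ∩ E′ i))))
    (+-monoʳ-≤ (card (P ∩ E′ y)) (over-monoʳ (P - y) λ p → ≤-trans (merge-degree M x∉P y∈P (proj₂ (∈--⁻ p)))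
      (card-mono λ q → ∈-∩⁺ (∪-⊆ P⊆W (⁅⁆-⊆ (K⊆ x∈K)) (∩-⊆ˡ q)) (∩-⊆ʳ q))))

  merged-low : card (P ∩ E′ y) + over (P - y) d ≤ m * card P → ∀ {i} → i ∈ P - y → d i ≤ m
  merged-low h = over-tight {f = λ _ → m} (λ p → min-degree irr cr (P⊆W (remove-⊆ p)))
    (subst (over (P - y) d ≤_) (sym (over-const (P - y) m)) (+-cancelˡ-≤ m _ _ (begin
      m + over (P - y) d                  ≤⟨ +-monoˡ-≤ _ (min-degree (Merge.loop-free M) crP y∈P) ⟩
      card (P ∩ E′ y) + over (P - y) d    ≤⟨ h ⟩
      m * card P                          ≡⟨ trans (cong (m *_) (card-remove y∈P)) (trans (*-suc m (card (P - y))) (cong (m +_) (*-comm m _))) ⟩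
      m + card (P - y) * m                ∎)))
    where open ≤-Reasoning

module _ {m n : ℕ} {E : Arcs n} {W : VSet n} (3≤m : 3 ≤ m) (irr : Loopless E) (cr : Critical m E W)
         (sp : Sparse m E W) (ih : Smaller m W) where

  private
    irr⁻ : Loopless (flip E)
    irr⁻ = Loopless-flip {E = E} irr

    cr⁻ : Critical m (flip E) W
    cr⁻ = Critical-flip cr

    sp⁻ : Sparse m (flip E) W
    sp⁻ = Sparse-flip {m = m} {E = E} {W = W} sp

  -- A second attached vertex would give a link, hence a spindle.
  attached-once : (C : SubClique m E W) → ∀ {x y} → Attached E W (SubClique.K C) x y → ¬ Conclusion m E W →
                  ¬ ¬ (∀ {z w} → Attached E W (SubClique.K C) z w → w ≡ y)
  attached-once C {x} {y} at nc k = k λ {z} {w} a → by a (w ≟ y)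
    where
    by : ∀ {z w} → Attached E W (SubClique.K C) z w → Dec (w ≡ y) → w ≡ y
    by a (yes p) = p
    by a (no p) = ⊥-elim (link-exists 3≤m irr cr sp ih C at a (λ q → p (sym q)) λ L →
      nc (inj₂ (link-spindle 3≤m irr cr sp ih C at a (λ q → p (sym q)) L)))

  clique-extends : (C : SubClique m E W) → ∀ {y} → y ∈ W → y ∉ SubClique.K C →
                   (∀ {z} → z ∈ SubClique.K C → y ∈ E z × z ∈ E y) → Conclusion m E W
  clique-extends C {y} y∈ y∉ h = inj₁ (clique-whole irr cr (∪-⊆ K⊆ (⁅⁆-⊆ y∈)) (trans (card-insert y∉) (cong suc size))
      λ a b → cl (∈-∪⁻ a) (∈-∪⁻ b))
    where
    open SubClique C
    cl : ∀ {i j} → i ∈ K ⊎ i ∈ ⁅ y ⁆ → j ∈ K ⊎ j ∈ ⁅ y ⁆ → i ≢ j → j ∈ E i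
    cl (inj₁ a) (inj₁ b) ne = clique a b ne
    cl (inj₁ a) (inj₂ b) _  = subst (_∈ E _) (sym (∈⁅⁆⇒≡ b)) (proj₁ (h a))
    cl (inj₂ a) (inj₁ b) _  = subst (λ z → _ ∈ E z) (sym (∈⁅⁆⇒≡ a)) (proj₂ (h b))
    cl (inj₂ a) (inj₂ b) ne = ⊥-elim (ne (trans (∈⁅⁆⇒≡ a) (sym (∈⁅⁆⇒≡ b))))

  -- Every vertex of the clique is attached in both directions; when always to the same y, this
  -- vertex completes K_{m+1}.
  low-clique : (C : SubClique m E W) → (∀ {z} → z ∈ SubClique.K C → card (W ∩ E z) ≤ m × card (W ∩ flip E z) ≤ m) →
               ¬ ¬ Conclusion m E W
  low-clique C low nc = attached-once C at nc λ once →
    nc (clique-extends C (Attached.y∈W at) (Attached.y∉K at) λ z∈ →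
      (let _ , a , e = attached-out irr cr C z∈ (proj₁ (low z∈)) in subst (_∈ E _) (once a) e) ,
      (let _ , a , e = attached-in irr cr C z∈ (proj₂ (low z∈)) in subst (λ w → _ ∈ E w) (once a) e))
    where
    open SubClique C
    z∃ : ∃ λ z → z ∈ K
    z∃ = card-pos (subst (1 ≤_) (sym size) (≤-trans (s≤s z≤n) 3≤m))
    at : Attached E W K (proj₁ z∃) (proj₁ (attached-out irr cr C (proj₂ z∃) (proj₁ (low (proj₂ z∃)))))
    at = proj₁ (proj₂ (attached-out irr cr C (proj₂ z∃) (proj₁ (low (proj₂ z∃)))))

  from-clique : (C : SubClique m E W) → ¬ ¬ Conclusion m E W
  from-clique C nc = attached-once C at nc λ once →
    nc (clique-extends C (Attached.y∈W at) (Attached.y∉K at) λ {x} x∈ → digon once x∈ (y ∈? E x) (x ∈? E y))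
    where
    open SubClique C
    u∃ : ∃ λ u → u ∈ K × card (W ∩ E u) ≤ m
    u∃ = low-exists irr cr sp K⊆ (≤-trans (≤-reflexive (sym size)) (n≤1+n _))
    att : ∃ λ z → Attached E W K (proj₁ u∃) z × z ∈ E (proj₁ u∃)
    att = attached-out irr cr C (proj₁ (proj₂ u∃)) (proj₂ (proj₂ u∃))
    y : Fin n
    y = proj₁ att
    at : Attached E W K (proj₁ u∃) y
    at = proj₁ (proj₂ att)

    module _ (once : ∀ {z w} → Attached E W K z w → w ≡ y) where

      low⇒arc : ∀ {q} → q ∈ K → card (W ∩ E q) ≤ m → y ∈ E q
      low⇒arc {q} q∈ low = let _ , a , e = attached-out irr cr C q∈ low in subst (_∈ E q) (once a) e

      low⇒arc⁻ : ∀ {q} → q ∈ K → card (W ∩ flip E q) ≤ m → q ∈ E y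
      low⇒arc⁻ {q} q∈ low = let _ , a , e = attached-in irr cr C q∈ low in subst (λ w → q ∈ E w) (once a) e

      -- A vertex q without excess out-degree is attached, and then to y; either way the sum reaches
      -- m + 1.
      count-out : ∀ {q} → q ∈ K → suc m ≤ ⟦ E q y ⟧ + card (W ∩ E q)
      count-out {q} q∈ with card (W ∩ E q) ≤? m
      ... | no ¬p = ≤-trans (≰⇒> ¬p) (m≤n+m _ _)
      ... | yes p with low⇒arc q∈ p
      ...   | mem e = subst (λ c → suc m ≤ ⟦ c ⟧ + card (W ∩ E q)) (sym e) (s≤s (min-degree irr cr (K⊆ q∈)))

      count-in : ∀ {q} → q ∈ K → suc m ≤ ⟦ E y q ⟧ + card (W ∩ flip E q)
      count-in {q} q∈ with card (W ∩ flip E q) ≤? m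
      ... | no ¬p = ≤-trans (≰⇒> ¬p) (m≤n+m _ _)
      ... | yes p with low⇒arc⁻ q∈ p
      ...   | mem e = subst (λ c → suc m ≤ ⟦ c ⟧ + card (W ∩ flip E q)) (sym e) (s≤s (min-degree irr⁻ cr⁻ (K⊆ q∈)))

      module _ {x : Fin n} (x∈ : x ∈ K) (no-digon : ¬ (y ∈ E x × x ∈ E y)) where

        x≢y : x ≢ y
        x≢y p = Attached.y∉K at (subst (_∈ K) p x∈)

        M : Merge E (merge E x y) x y
        M = merge-Merge E x y irr

        module _ {v : Fin n} (v∈ : v ∈ K) (v≢x : v ≢ x) {P : VSet n} (P⊆W : P ⊆ W) (v∉P : v ∉ P) (x∉P : x ∉ P)
                 (y∈P : y ∈ P) (crP : Critical m (merge E x y) P) where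

          E′ : Arcs n
          E′ = merge E x y

          crP⁻ : Critical m (flip E′) P
          crP⁻ = Critical-flip crP

          y∉K : y ∉ K
          y∉K = Attached.y∉K at

          disjoint : ∀ {q} → q ∈ K → q ∉ P
          disjoint q∈ q∈P = no-digon
            ( low⇒arc x∈ (merged-clique-low irr cr sp C M x∈ y∉K P⊆W x∉P y∈P crP q∈ q∈P v∈ v≢x v∉P)
            , low⇒arc⁻ x∈ (merged-clique-low irr⁻ cr⁻ sp⁻ (SubClique-flip C) (Merge-flip M) x∈ y∉K P⊆W x∉P y∈P crP⁻ q∈ q∈P v∈ v≢x v∉P))

          A A⁻ b p : ℕ
          A = card (P ∩ E′ y) + over (P - y) (λ i → card (W ∩ E i))
          A⁻ = card (P ∩ flip E′ y) + over (P - y) (λ i → card (W ∩ flip E i))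
          b = card (K - x)
          p = card P

          -- `merged-count` adds the arc from y to q to the out-degree of q, while `count-in` pairs
          -- it with the in-degree. Only in the sum of both directions can the two terms be
          -- exchanged, and then each q contributes at least 2 (m + 1).
          sum-bound : A + A⁻ ≤ m * p + m * p
          sum-bound = +-cancelʳ-≤ (b * (suc m + suc m)) _ _ (begin
            A + A⁻ + b * (suc m + suc m)
              ≤⟨ +-monoʳ-≤ (A + A⁻) (over-lower λ q∈ → +-mono-≤ (count-out (remove-⊆ q∈)) (count-in (remove-⊆ q∈))) ⟩
            A + A⁻ + over (K - x) (λ q → (⟦ E q y ⟧ + card (W ∩ E q)) + (⟦ E y q ⟧ + card (W ∩ flip E q)))
              ≡⟨ cong (A + A⁻ +_) (over-congʳ (K - x) (λ {q} _ → regroup ⟦ E q y ⟧ (card (W ∩ E q)) ⟦ E y q ⟧ (card (W ∩ flip E q)))) ⟩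
            A + A⁻ + over (K - x) (λ q → (⟦ E y q ⟧ + card (W ∩ E q)) + (⟦ E q y ⟧ + card (W ∩ flip E q)))
              ≡⟨ cong (A + A⁻ +_) (over-+ (K - x) _ _) ⟩
            A + A⁻ + (over (K - x) (λ q → ⟦ E y q ⟧ + card (W ∩ E q)) + over (K - x) (λ q → ⟦ E q y ⟧ + card (W ∩ flip E q)))
              ≡⟨ exchange A A⁻ _ _ ⟩
            (A + over (K - x) (λ q → ⟦ E y q ⟧ + card (W ∩ E q))) + (A⁻ + over (K - x) (λ q → ⟦ E q y ⟧ + card (W ∩ flip E q)))
              ≤⟨ +-mono-≤ (merged-count irr cr sp C M x∈ y∉K P⊆W x∉P y∈P crP disjoint)
                          (merged-count irr⁻ cr⁻ sp⁻ (SubClique-flip C) (Merge-flip M) x∈ y∉K P⊆W x∉P y∈P crP⁻ disjoint) ⟩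
            (m * p + (m * b + b)) + (m * p + (m * b + b))
              ≡⟨ shuffle m p b ⟩
            m * p + m * p + b * (suc m + suc m) ∎)
            where
            open ≤-Reasoning
            regroup : ∀ a b c d → (a + b) + (c + d) ≡ (c + b) + (a + d)
            regroup = solve-∀
            exchange : ∀ a b c d → a + b + (c + d) ≡ (a + c) + (b + d)
            exchange = solve-∀
            shuffle : ∀ m p b → (m * p + (m * b + b)) + (m * p + (m * b + b)) ≡ m * p + m * p + b * (suc m + suc m)
            shuffle = solve-∀

          A≤ : A ≤ m * p
          A≤ = +-cancelʳ-≤ (m * p) A (m * p)
            (≤-trans (+-monoʳ-≤ A (merged-total irr⁻ cr⁻ sp⁻ (SubClique-flip C) (Merge-flip M) x∈ y∉K P⊆W x∉P y∈P crP⁻)) sum-bound)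

          A⁻≤ : A⁻ ≤ m * p
          A⁻≤ = +-cancelˡ-≤ (m * p) A⁻ (m * p)
            (≤-trans (+-monoˡ-≤ A⁻ (merged-total irr cr sp C M x∈ y∉K P⊆W x∉P y∈P crP)) sum-bound)

          few-arcs : arcs E′ P P ≤ m * p
          few-arcs = ≤-trans (merged-arcs irr cr sp C M x∈ y∉K P⊆W x∉P y∈P crP) A≤

          contradict : ⊥
          contradict = ih E′ P (card-< P⊆W (K⊆ v∈) v∉P) (Merge.loop-free M) crP (+-mono-≤ few-arcs (≤-trans (n≤1+n 2) 3≤m)) λ
            { (inj₂ spindle) → <⇒≱ (Spindle.excess spindle) few-arcs
            ; (inj₁ (c , cl)) → low-clique (record
                { K = P - y ; K⊆ = λ p → P⊆W (remove-⊆ p) ; size = suc-injective (trans (sym (card-remove y∈P)) c)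
                ; clique = λ a b i≢j → Merge.elsewhere M (proj₂ (∈--⁻ a)) (proj₂ (∈--⁻ b)) (cl (remove-⊆ a) (remove-⊆ b) i≢j) })
                (λ z∈ → merged-low irr cr sp C M x∈ y∉K P⊆W x∉P y∈P crP A≤ z∈
                      , merged-low irr⁻ cr⁻ sp⁻ (SubClique-flip C) (Merge-flip M) x∈ y∉K P⊆W x∉P y∈P crP⁻ A⁻≤ z∈)
                nc }

        -- A vertex v of out-degree m in `K - x` has both x and y as out-neighbours, which permits
        -- merging them as long as they form no digon.
        always-digon : ⊥
        always-digon =
          let v , v∈ , low = low-exists irr cr sp {A = K - x} (λ q → K⊆ (remove-⊆ q)) (≤-reflexive (trans (sym size) (card-remove x∈)))
              v∈K , v≢x = ∈--⁻ v∈
          in merge-critical irr cr (K⊆ v∈K) low (K⊆ x∈) (Attached.y∈W at) (clique v∈K x∈ v≢x) (low⇒arc v∈K low) x≢y no-digon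
               λ (P , P⊆W , v∉P , x∉P , y∈P , crP) → contradict v∈K v≢x P⊆W v∉P x∉P y∈P crP

      digon : ∀ {x} → x ∈ K → Dec (y ∈ E x) → Dec (x ∈ E y) → y ∈ E x × x ∈ E y
      digon x∈ (yes a) (yes b) = a , b
      digon x∈ (no ¬a) _ = ⊥-elim (always-digon x∈ (λ (a , _) → ¬a a))
      digon x∈ _ (no ¬b) = ⊥-elim (always-digon x∈ (λ (_ , b) → ¬b b))

-- Induction on the size of W

sparse-critical : ∀ {m n} → 3 ≤ m → (E : Arcs n) (W : VSet n) → Loopless E → Critical m E W → Sparse m E W →
                  ¬ ¬ Conclusion m E W
sparse-critical {m} {n} 3≤m E W = go (suc (card W)) E W ≤-refl
  where
  go : ∀ c (E : Arcs n) (W : VSet n) → card W < c → Loopless E → Critical m E W → Sparse m E W → ¬ ¬ Conclusion m E W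
  go (suc c) E W lt irr cr sp k = clique-exists 3≤m irr cr sp ih λ C → from-clique 3≤m irr cr sp ih C k
    where
    ih : Smaller m W
    ih E′ P smaller = go c E′ P (≤-trans smaller (≤-pred lt))

-- Translation to the given definitions

module _ {n : ℕ} where

-- Turns a cardinality into a numbering: a `Shape` knows the sizes of its parts, while the
-- substitution into C₅ has vertices indexed by `Fin`.
record Enumeration {n : ℕ} (A : VSet n) (c : ℕ) : Set where
  field
    nth       : Fin c → Fin n
    nth-∈     : ∀ x → nth x ∈ A
    index     : ∀ {i} → i ∈ A → Fin c
    nth-index : ∀ {i} (p : i ∈ A) → nth (index p) ≡ i
    injective : ∀ {x y} → nth x ≡ nth y → x ≡ y

module _ {n : ℕ} (A : VSet (suc n)) {c : ℕ} (en : Enumeration (A ∘ suc) c) where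

  open Enumeration en

  private
    ∈-suc⁻ : ∀ {i} → suc i ∈ A → i ∈ A ∘ suc
    ∈-suc⁻ (mem p) = mem p

    ∈-suc⁺ : ∀ {i} → i ∈ A ∘ suc → suc i ∈ A
    ∈-suc⁺ (mem p) = mem p

  cons : zero ∈ A → Enumeration A (suc c)
  cons z∈ = record
    { nth       = λ { zero → zero ; (suc x) → suc (nth x) }
    ; nth-∈     = λ { zero → z∈ ; (suc x) → ∈-suc⁺ (nth-∈ x) }
    ; index     = λ { {zero} _ → zero ; {suc i} p → suc (index (∈-suc⁻ p)) }
    ; nth-index = λ { {zero} _ → refl ; {suc i} p → cong suc (nth-index (∈-suc⁻ p)) }
    ; injective = λ { {zero} {zero} _ → refl ; {suc x} {suc y} p → cong suc (injective (Fin-suc-injective p)) }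
    }

  skip : zero ∉ A → Enumeration A c
  skip z∉ = record
    { nth       = λ x → suc (nth x)
    ; nth-∈     = λ x → ∈-suc⁺ (nth-∈ x)
    ; index     = λ { {zero} p → ⊥-elim (z∉ p) ; {suc i} p → index (∈-suc⁻ p) }
    ; nth-index = λ { {zero} p → ⊥-elim (z∉ p) ; {suc i} p → cong suc (nth-index (∈-suc⁻ p)) }
    ; injective = λ p → injective (Fin-suc-injective p)
    }

opaque
  unfolding over Full

  card-suc : ∀ {n} (A : VSet (suc n)) → card A ≡ ⟦ A zero ⟧ + card (A ∘ suc)
  card-suc A = refl

  over-Full : ∀ {n} (f : Fin n → ℕ) → over Full f ≡ sum f
  over-Full f = refl

enumerate : ∀ {n} (A : VSet n) → Enumeration A (card A)
enumerate {zero} A = record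
  { nth = λ x → ⊥-elim (none x) ; nth-∈ = λ x → ⊥-elim (none x) ; index = λ { {()} } ; nth-index = λ { {()} }
  ; injective = λ {x} → ⊥-elim (none x) }
  where
  none : Fin (card A) → ⊥
  none x with subst Fin (card-empty {A = A} (λ { {()} })) x
  ... | ()
enumerate {suc n} A with zero ∈? A
... | yes z∈@(mem p) = subst (Enumeration A) (sym (trans (card-suc A) (cong (λ b → ⟦ b ⟧ + card (A ∘ suc)) p)))
                         (cons A (enumerate (A ∘ suc)) z∈)
... | no z∉ = subst (Enumeration A) (sym (trans (card-suc A) (cong (λ b → ⟦ b ⟧ + card (A ∘ suc)) (∉⇒false {A = A} z∉))))
                (skip A (enumerate (A ∘ suc)) z∉)

list-sum : ∀ {n} (f : Fin n → ℕ) → ListAction.sum (List.map f (List.allFin n)) ≡ sum f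
list-sum f = trans (cong ListAction.sum (List.map-tabulate (λ i → i) f)) (tabulated f)
  where
  tabulated : ∀ {n} (f : Fin n → ℕ) → ListAction.sum (List.tabulate f) ≡ sum f
  tabulated {zero}  f = refl
  tabulated {suc n} f = cong (f zero +_) (tabulated (λ i → f (suc i)))

arcCount≡arcs : ∀ G → arcCount G ≡ arcs (arc G) Full Full
arcCount≡arcs G = begin
  arcCount G                                      ≡⟨ list-sum (λ i → ListAction.sum (List.map (λ j → ⟦ arc G i j ⟧) (List.allFin (n G)))) ⟩
  sum (λ i → ListAction.sum (List.map (λ j → ⟦ arc G i j ⟧) (List.allFin (n G)))) ≡⟨ sum-cong-≗ (λ i → list-sum (λ j → ⟦ arc G i j ⟧)) ⟩
  sum (λ i → sum (λ j → ⟦ arc G i j ⟧))           ≡⟨ over-Full _ ⟨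
  over Full (λ i → sum (λ j → ⟦ arc G i j ⟧))     ≡⟨ over-congʳ Full (λ {i} _ → trans (card-∩ Full (arc G i)) (over-Full _)) ⟨
  arcs (arc G) Full Full                          ∎
  where open ≡-Reasoning

module _ {k t : ℕ} where

  private
    Vertex = SubV 5 (Dsizes k t)
    Adj = SubArc 5 C5arc (Dsizes k t) (λ i → Karc (Dsizes k t i))

  SubArc⁺ : {u v : Vertex} → (proj₁ u ≡ proj₁ v × u ≢ v) ⊎ C5arc (proj₁ u) (proj₁ v) → Adj u v
  SubArc⁺ (inj₁ (refl , u≢v)) = inj₁ (refl , λ { refl → u≢v refl })
  SubArc⁺ (inj₂ a)            = inj₂ a

  SubArc⁻ : {u v : Vertex} → Adj u v → (proj₁ u ≡ proj₁ v × u ≢ v) ⊎ C5arc (proj₁ u) (proj₁ v)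
  SubArc⁻ (inj₁ (refl , x≢y)) = inj₁ (refl , λ { refl → x≢y refl })
  SubArc⁻ (inj₂ a)            = inj₂ a

module _ {G : Digraph} where

  private
    E : Arcs (n G)
    E = arc G

  arc-loopless : Loopless E
  arc-loopless {i} (mem p) with trans (sym (loopless G i)) p
  ... | ()

  induced : VSet (n G) → Subdigraph G
  induced A = record
    { keepV     = A
    ; keepA     = λ i j → E i j ∧ (A i ∧ A j)
    ; keepA-arc = λ i j p → proj₁ (∧-true p)
    ; keepA-V   = λ i j p → ∧-true (proj₂ (∧-true {E i j} p))
    }
    where
    ∧-true : ∀ {a b} → a ∧ b ≡ true → a ≡ true × b ≡ true
    ∧-true {true} p = refl , p

  dicritical⇒critical : ∀ {m} → Dicritical (suc m) G → Critical m E Full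
  dicritical⇒critical ((_ , no-col) , proper) =
    (λ (f , val) → no-col (f , λ v w → val v (walk-map (λ (p , q) → ∈-full , ∈-full , mem p , q) w))) ,
    λ {v} _ k → k (colour v)
    where
    colour : ∀ v → Colourable _ E (Full - v)
    colour v = let f , val = proper (induced (Full - v)) (inj₁ (v , ∉⇒false {A = Full - v} (λ p → proj₂ (∈--⁻ p) refl)))
      in f , λ u w → val u (walk-map (λ { (mem a , mem b , mem e , q) → cong₂ _∧_ e (cong₂ _∧_ a b) , q }) w)

  IsoTo-via : ∀ {V : Set} (R : V → V → Set) (φ : Fin (n G) ↔ V) →
              (∀ {i j} → j ∈ E i → R (Inverse.to φ i) (Inverse.to φ j)) →
              (∀ {i j} → R (Inverse.to φ i) (Inverse.to φ j) → j ∈ E i) → IsoTo G V R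
  IsoTo-via R φ f g = φ , λ i j → (λ p → f (mem p)) , λ r → ∈⇒true (g r)

  to-injective : ∀ {V : Set} (φ : Fin (n G) ↔ V) {i j} → Inverse.to φ i ≡ Inverse.to φ j → i ≡ j
  to-injective φ {i} {j} p = trans (sym (Inverse.strictlyInverseʳ φ i))
    (trans (cong (Inverse.from φ) p) (Inverse.strictlyInverseʳ φ j))

  clique⇒IsK : ∀ {k} → n G ≡ k → Clique E Full → IsK k G
  clique⇒IsK {k} e cl = IsoTo-via (Karc k) φ (λ a p → arc-loopless (subst (_∈ E _) (sym (to-injective φ p)) a))
    (λ ne → cl ∈-full ∈-full (λ p → ne (cong (Inverse.to φ) p)))
    where
    φ : Fin (n G) ↔ Fin k
    φ = mk↔ₛ′ (subst Fin e) (subst Fin (sym e)) (there e) (back e)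
      where
      there : ∀ {a b} (e : a ≡ b) x → subst Fin e (subst Fin (sym e) x) ≡ x
      there refl x = refl
      back : ∀ {a b} (e : a ≡ b) x → subst Fin (sym e) (subst Fin e x) ≡ x
      back refl x = refl

  shape⇒InDk : ∀ {m} → Shape m E Full → InDk (suc m) G
  shape⇒InDk {m} S = t , 1≤t , t≤ , IsoTo-via (SubArc 5 C5arc (Dsizes (suc m) t) (λ i → Karc (Dsizes (suc m) t i))) φ
    (λ a → SubArc⁺ {suc m} {t} (enter (arc⁺ ∈-full ∈-full a)))
    (λ a → arc⁻ ∈-full ∈-full (leave (SubArc⁻ {suc m} {t} a)))
    where
    open Shape S

    en : ∀ c → Enumeration (Full ∩ (λ i → ⁅ cl i ⁆ c)) (Dsizes (suc m) t c)
    en c = subst (Enumeration _) (sizes c) (enumerate _)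

    own : ∀ i → i ∈ Full ∩ (λ j → ⁅ cl j ⁆ (cl i))
    own i with x∈⁅x⁆ {x = cl i}
    ... | mem p = ∈-∩⁺ {B = λ j → ⁅ cl j ⁆ (cl i)} ∈-full (mem p)

    class≡ : ∀ {c i} → i ∈ Full ∩ (λ j → ⁅ cl j ⁆ c) → c ≡ cl i
    class≡ {c} {i} p with ∩-⊆ʳ {A = Full} {B = λ j → ⁅ cl j ⁆ c} p
    ... | mem q = ∈⁅⁆⇒≡ {i = c} {x = cl i} (mem q)

    to : Fin (n G) → SubV 5 (Dsizes (suc m) t)
    to i = cl i , Enumeration.index (en (cl i)) (own i)

    from : SubV 5 (Dsizes (suc m) t) → Fin (n G)
    from (c , x) = Enumeration.nth (en c) x

    to∘from : ∀ u → to (from u) ≡ u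
    to∘from (c , x) = relabel (own (from (c , x))) (sym (class≡ (Enumeration.nth-∈ (en c) x)))
      where
      -- The class is generalised to a variable d so that its equation with c can be matched by
      -- `refl`.
      relabel : ∀ {d} (p : from (c , x) ∈ Full ∩ (λ j → ⁅ cl j ⁆ d)) → d ≡ c →
                _≡_ {A = SubV 5 (Dsizes (suc m) t)} (d , Enumeration.index (en d) p) (c , x)
      relabel p refl = cong (c ,_) (Enumeration.injective (en c) (Enumeration.nth-index (en c) p))

    φ : Fin (n G) ↔ SubV 5 (Dsizes (suc m) t)
    φ = mk↔ₛ′ to from to∘from (λ i → Enumeration.nth-index (en (cl i)) (own i))

    enter : ∀ {i j} → (cl i ≡ cl j × i ≢ j) ⊎ C5arc (cl i) (cl j) → (cl i ≡ cl j × to i ≢ to j) ⊎ C5arc (cl i) (cl j)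
    enter (inj₁ (p , i≢j)) = inj₁ (p , λ q → i≢j (to-injective φ q))
    enter (inj₂ a)         = inj₂ a

    leave : ∀ {i j} → (cl i ≡ cl j × to i ≢ to j) ⊎ C5arc (cl i) (cl j) → (cl i ≡ cl j × i ≢ j) ⊎ C5arc (cl i) (cl j)
    leave (inj₁ (p , ne)) = inj₁ (p , λ q → ne (cong to q))
    leave (inj₂ a)        = inj₂ a

theorem1p6 : (k : ℕ) → 4 ≤ k → (G : Digraph) → Dicritical k G →
    ¬ IsK k G → ¬ InDk k G →
    (k ∸ 1) * n G + (k ∸ 2) ≤ arcCount G
theorem1p6 (suc m@(suc m′)) (s≤s 3≤m) G crit not-K not-D = decidable-stable (m * n G + m′ ≤? arcCount G) λ few →
  sparse-critical 3≤m (arc G) Full (arc-loopless {G}) (dicritical⇒critical crit) (sparse (≰⇒> few)) λ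
    { (inj₁ (c , cl)) → not-K (clique⇒IsK {G} (trans (sym (card-Full (n G))) c) cl)
    ; (inj₂ spindle) → not-D (shape⇒InDk {G} (Spindle.shape spindle)) }
  where
  -- Here k - 2 is m - 1, so failure of the bound means at most m n + m - 2 arcs, which is `Sparse`.
  sparse : arcCount G < m * n G + m′ → Sparse m (arc G) Full
  sparse lt = begin
    arcs (arc G) Full Full + 2      ≡⟨ trans (cong (_+ 2) (sym (arcCount≡arcs G))) (+-comm (arcCount G) 2) ⟩
    2 + arcCount G                  ≤⟨ s≤s lt ⟩
    suc (m * n G + m′)              ≡⟨ +-suc (m * n G) m′ ⟨
    m * n G + m                     ≡⟨ cong (λ a → m * a + m) (card-Full (n G)) ⟨
    m * card (Full {n G}) + m       ∎
    where open ≤-Reasoning
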